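{- Fix $\gamma\in(0,1)$ and let $d_N=(1-\gamma)\sqrt{\frac{\log N}{2\log\log N}}$ and $M=\exp\{2\sqrt{\log N\log\log N}\}$. Let $\varepsilon>0$ be sufficiently small. Let $d,N\in\mathbb{N}$ with $2\leqslant d\leqslant d_N$, and let $G$ be a group of order $N$ such that (a) $G$ contains at most $N^{(2+\varepsilon)/4}$ involutions; (b) $G$ contains at most $N^{1/d}$ elements $x$ with $\operatorname{cl}(x)\leqslant M$; (c) $G$ contains at most $N^{1/(2d)}$ involutions $x$ with $\operatorname{cl}(x)\leqslant M$. If $\Gamma\in\mathcal{G}(G,p)$ with $p\geqslant\sqrt[d]{\frac{1+\varepsilon}{2^d}\cdot\frac{\log N}{N^{d-1}}}$, then with high probability the diameter of $\Gamma$ is at most $d$; that is, $\Pr(\operatorname{diam}(\Gamma)>d)\to0$ as $N\to\infty$, uniformly over all groups $G$ satisfying (a)–(c), all such $d$ and all such $p$.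
   Context: For a group $G$ and a subset $S\subseteq G$, the (undirected) Cayley graph $\Gamma(G;S)$ has vertex set $G$ and an edge between $g\neq h$ iff $g^{ -1}h\in S$ or $h^{ -1}g\in S$ (loops and multiple edges ignored). The model $\mathcal{G}(G,p)$ is the probability space of Cayley graphs $\Gamma(G;S)$ where each element of $G$ is put in $S$ independently with probability $p$. The diameter of a disconnected graph is infinite. For $x\in G$, $\operatorname{cl}(x)$ is the size of the conjugacy class $\{y^{ -1}xy:y\in G\}$. An involution is an element $x$ with $x^2=1$. -}

module Defs where

open import Level using (Level; 0ℓ; _⊔_) renaming (suc to lsuc)
open import Algebra.Bundles using (CommutativeRing; Semiring; Group)
open import Algebra.Structures using (IsCommutativeRing)
import Algebra.Definitions.RawSemiring as RawSemiringDefs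
open import Data.Bool.Base using (if_then_else_)
open import Data.Fin.Base using (Fin)
import Data.Fin.Properties as Fin
open import Data.Fin.Subset using (Subset; inside; outside; ∣_∣; ∁; _∈_)
open import Data.Fin.Subset.Properties using (_∈?_)
open import Data.List.Base using (List; []; _∷_; _++_; map; foldr; filter; length; allFin; upTo)
open import Data.Nat.Base as ℕ using (ℕ; zero; suc; _!)
import Data.Nat.Properties as ℕ
open import Data.Product.Base using (∃; ∃-syntax; _×_; _,_)
open import Data.Sum.Base using (_⊎_)
import Data.Sum.Base as Sum
open import Data.Vec.Base using ([]; _∷_)
open import Function.Base using (_∘_)
open import Function.Bundles using (Inverse)
open import Relation.Binary.Definitions using () renaming (Decidable to Decidable₂)
open import Relation.Binary.PropositionalEquality.Core using (_≡_; _≢_; refl; cong; subst)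
open import Relation.Binary.PropositionalEquality.Properties using (setoid)
import Relation.Binary.Construct.NonStrictToStrict as ToStrict
open import Relation.Binary.Structures using (IsDecTotalOrder)
open import Relation.Nullary using (¬_; Dec; does)
open import Relation.Nullary.Decidable using (map′; ¬?; _×-dec_; _⊎-dec_)
open import Relation.Unary using (Pred; Decidable)
open import Relation.Binary.Core using (Rel)

-- A Dedekind-complete ordered field; classically this determines ℝ up to
-- unique isomorphism.  As in classical mathematics the order is decidable.
-- The operations _⁻¹ and sup are total, but are only constrained on
-- arguments for which they are meaningful.  `archimedean` follows classically
-- from completeness; it is a field because the bound n is otherwise available
-- only up to double negation.

record Reals : Set₁ where
  infix  8 _⁻¹ -_
  infixl 7 _*_ _/_
  infixl 6 _+_ _-_
  infix  4 _≤_

  field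
    ℝ       : Set
    _≤_     : Rel ℝ 0ℓ
    _+_ _*_ : ℝ → ℝ → ℝ
    -_ _⁻¹  : ℝ → ℝ
    0# 1#   : ℝ
    sup     : Pred ℝ 0ℓ → ℝ

    isCommutativeRing : IsCommutativeRing _≡_ _+_ _*_ -_ 0# 1#
    isDecTotalOrder   : IsDecTotalOrder _≡_ _≤_

    0≢1        : 0# ≢ 1#
    *-inverseʳ : ∀ {x} → x ≢ 0# → x * x ⁻¹ ≡ 1#
    +-monoʳ-≤  : ∀ x {y z} → y ≤ z → x + y ≤ x + z
    *-nonneg   : ∀ {x y} → 0# ≤ x → 0# ≤ y → 0# ≤ x * y

  _UpperBoundOf_ : ℝ → Pred ℝ 0ℓ → Set
  b UpperBoundOf P = ∀ {x} → P x → x ≤ b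

  commutativeRing : CommutativeRing 0ℓ 0ℓ
  commutativeRing = record { isCommutativeRing = isCommutativeRing }

  open RawSemiringDefs (Semiring.rawSemiring (CommutativeRing.semiring commutativeRing)) public
    using (_^_) renaming (_×_ to _·_)

  fromℕ : ℕ → ℝ
  fromℕ n = n · 1#

  field
    sup-upper   : ∀ {P b} → b UpperBoundOf P → sup P UpperBoundOf P
    sup-least   : ∀ {P b} → ∃ P → b UpperBoundOf P → sup P ≤ b
    archimedean : ∀ x → ∃[ n ] x ≤ fromℕ n

  open IsDecTotalOrder isDecTotalOrder public using (_≟_; _≤?_)
  open ToStrict _≡_ _≤_ public using (_<_)

  _-_ _/_ : ℝ → ℝ → ℝ
  x - y = x + - y
  x / y = x * y ⁻¹

  Σ[_] : List ℝ → ℝ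
  Σ[_] = foldr _+_ 0#

  expPartialSum : ℝ → ℕ → ℝ
  expPartialSum x n = Σ[ map (λ k → x ^ k / fromℕ (k !)) (upTo n) ]

  -- For x ≥ 0 the partial sums of the exponential series increase, so their
  -- limit is their supremum.
  expNonneg : ℝ → ℝ
  expNonneg x = sup λ s → ∃[ n ] s ≡ expPartialSum x n

  exp : ℝ → ℝ
  exp x = if does (0# ≤? x) then expNonneg x else expNonneg (- x) ⁻¹

  -- Meaningful for x > 0.
  log : ℝ → ℝ
  log x = sup λ y → exp y ≤ x

  -- Meaningful for x > 0.
  infixr 8 _^ʳ_
  _^ʳ_ : ℝ → ℝ → ℝ
  x ^ʳ y = exp (y * log x)

  -- The nonnegative n-th root, meaningful for n ≥ 1 and x ≥ 0.
  root : ℕ → ℝ → ℝ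
  root n x = sup λ y → y ^ n ≤ x

  √ : ℝ → ℝ
  √ = root 2

  subsets : ∀ n → List (Subset n)
  subsets zero    = [] ∷ []
  subsets (suc n) = map (inside ∷_) (subsets n) ++ map (outside ∷_) (subsets n)

  -- The probability that P holds of a random subset of Fin n containing each
  -- element independently with probability p.
  Pr : ∀ {n a} → ℝ → {P : Pred (Subset n) a} → Decidable P → ℝ
  Pr {n} p P? = Σ[ map (λ S → p ^ ∣ S ∣ * (1# - p) ^ ∣ ∁ S ∣) (filter P? (subsets n)) ]

  -- d_N and M.  They are meaningful once log log N > 0, i.e. for N ≥ 3.
  diameterBound : ℝ → ℕ → ℝ
  diameterBound γ N = (1# - γ) * √ (logN / (fromℕ 2 * log logN))
    where logN = log (fromℕ N)

  classBound : ℕ → ℝ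
  classBound N = exp (fromℕ 2 * √ (logN * log logN))
    where logN = log (fromℕ N)

record FiniteGroup (c ℓ : Level) (N : ℕ) : Set (lsuc (c ⊔ ℓ)) where
  field
    group       : Group c ℓ
    enumeration : Inverse (setoid (Fin N)) (Group.setoid group)

  open Group group renaming (Carrier to G; refl to ≈-refl; sym to ≈-sym; trans to ≈-trans)
  open Inverse enumeration using ()
    renaming (to to element; from to index; from-cong to index-cong; strictlyInverseˡ to element-index)

  _≈?_ : Decidable₂ _≈_
  g ≈? h = map′
    (λ eq → ≈-trans (≈-sym (element-index g)) (≈-trans (reflexive (cong element eq)) (element-index h)))
    index-cong
    (index g Fin.≟ index h)

  ∃? : ∀ {a} {P : Pred G a} → (∀ {g h} → g ≈ h → P g → P h) → Decidable P → Dec (∃ P)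
  ∃? resp P? = map′
    (λ (i , p) → element i , p)
    (λ (g , p) → index g , resp (≈-sym (element-index g)) p)
    (Fin.any? (P? ∘ element))

  ∀? : ∀ {a} {P : Pred G a} → (∀ {g h} → g ≈ h → P g → P h) → Decidable P → Dec (∀ g → P g)
  ∀? resp P? = map′
    (λ f g → resp (element-index g) (f (index g)))
    (λ f i → f (element i))
    (Fin.all? (P? ∘ element))

  # : ∀ {a} {P : Pred G a} → Decidable P → ℕ
  # P? = length (filter (P? ∘ element) (allFin N))

  _∈ClassOf_ : G → G → Set (c ⊔ ℓ)
  z ∈ClassOf x = ∃[ y ] z ≈ (y ⁻¹ ∙ x) ∙ y

  _∈ClassOf?_ : Decidable₂ _∈ClassOf_
  z ∈ClassOf? x = ∃?
    (λ y≈y′ eq → ≈-trans eq (∙-cong (∙-cong (⁻¹-cong y≈y′) ≈-refl) y≈y′))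
    (λ y → z ≈? ((y ⁻¹ ∙ x) ∙ y))

  cl : G → ℕ
  cl x = # (_∈ClassOf? x)

  -- The identity counts as an involution.
  Involution : Pred G ℓ
  Involution x = x ∙ x ≈ ε

  involution? : Decidable Involution
  involution? x = (x ∙ x) ≈? ε

  -- A subset of G is represented by the set of indices of its elements.
  _∈ˢ_ : G → Subset N → Set
  g ∈ˢ S = index g ∈ S

  module Cayley (S : Subset N) where

    Adjacent : Rel G ℓ
    Adjacent g h = ¬ g ≈ h × ((g ⁻¹ ∙ h) ∈ˢ S ⊎ (h ⁻¹ ∙ g) ∈ˢ S)

    data Walk : ℕ → G → G → Set (c ⊔ ℓ) where
      stop : ∀ {g h} → g ≈ h → Walk zero g h
      step : ∀ {k g x h} → Adjacent g x → Walk k x h → Walk (suc k) g h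

    DistanceAtMost : ℕ → G → G → Set (c ⊔ ℓ)
    DistanceAtMost d g h = ∃[ k ] (k ℕ.≤ d × Walk k g h)

    -- Fails for every d if the graph is disconnected.
    DiameterAtMost : ℕ → Set (c ⊔ ℓ)
    DiameterAtMost d = ∀ g h → DistanceAtMost d g h

    quotient-resp : ∀ {g g′ h h′} → g ≈ g′ → h ≈ h′ → (g ⁻¹ ∙ h) ∈ˢ S → (g′ ⁻¹ ∙ h′) ∈ˢ S
    quotient-resp p q = subst (_∈ S) (index-cong (∙-cong (⁻¹-cong p) q))

    adjacent-resp : ∀ {g g′ h h′} → g ≈ g′ → h ≈ h′ → Adjacent g h → Adjacent g′ h′
    adjacent-resp p q (g≉h , e) =
      (λ g′≈h′ → g≉h (≈-trans p (≈-trans g′≈h′ (≈-sym q)))) ,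
      Sum.map (quotient-resp p q) (quotient-resp q p) e

    walk-resp : ∀ {k g g′ h h′} → g ≈ g′ → h ≈ h′ → Walk k g h → Walk k g′ h′
    walk-resp p q (stop g≈h) = stop (≈-trans (≈-sym p) (≈-trans g≈h q))
    walk-resp p q (step a w) = step (adjacent-resp p ≈-refl a) (walk-resp ≈-refl q w)

    adjacent? : Decidable₂ Adjacent
    adjacent? g h =
      ¬? (g ≈? h) ×-dec (index (g ⁻¹ ∙ h) ∈? S ⊎-dec index (h ⁻¹ ∙ g) ∈? S)

    walk? : ∀ k → Decidable₂ (Walk k)
    walk? zero    g h = map′ stop (λ { (stop g≈h) → g≈h }) (g ≈? h)
    walk? (suc k) g h = map′
      (λ (x , a , w) → step a w)
      (λ { (step a w) → _ , a , w })
      (∃? (λ x≈y (a , w) → adjacent-resp ≈-refl x≈y a , walk-resp x≈y ≈-refl w)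
          (λ x → adjacent? g x ×-dec walk? k x h))

    distanceAtMost? : ∀ d → Decidable₂ (DistanceAtMost d)
    distanceAtMost? d g h = map′
      (λ (k , k<1+d , w) → k , ℕ.s≤s⁻¹ k<1+d , w)
      (λ (k , k≤d , w) → k , ℕ.s≤s k≤d , w)
      (ℕ.anyUpTo? (λ k → walk? k g h) (suc d))

    diameterAtMost? : ∀ d → Dec (DiameterAtMost d)
    diameterAtMost? d =
      ∀? (λ p f h → distance-resp p ≈-refl (f h))
         (λ g → ∀? (distance-resp ≈-refl) (distanceAtMost? d g))
      where
      distance-resp : ∀ {g g′ h h′} → g ≈ g′ → h ≈ h′ →
                      DistanceAtMost d g h → DistanceAtMost d g′ h′
      distance-resp p q (k , k≤d , w) = k , k≤d , walk-resp p q w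

  open Cayley public using (DiameterAtMost; diameterAtMost?)

  DiameterExceeds : ℕ → Pred (Subset N) (c ⊔ ℓ)
  DiameterExceeds d S = ¬ DiameterAtMost S d

  diameterExceeds? : ∀ d → Decidable (DiameterExceeds d)
  diameterExceeds? d S = ¬? (diameterAtMost? S d)

{-# OPTIONS --safe #-}

-- Fix h ≠ 1 and call (e , t) with t₁⋯t_d = h a word; it is realised by S when every letter t_i^{e_i} lies in S, and
-- then h is at distance at most d.  There are 2^d N^{d-1} words, so at the threshold probability (1+ε) log N of them
-- are realised on average.
--
-- Words with equal letter sets are related by a signed permutation of the letters.  Solving t₁⋯t_d = h for one letter
-- turns a second equation on the permuted word into one where every other letter occurs twice.  Unless the signed
-- permutation is a rotation or an inverted rotation, some letter occurs twice with the same sign or two letters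
-- interleave, and the fraction of solutions is at most the square root of the fraction of commuting pairs, which is
-- small by (b).  A nontrivial rotation fixes h only if a partial product commutes with h, which is rare when cl(h) > M.
-- So, few words aside, a letter set belongs to at most m words, where m is 1 or d according to whether cl(h) > M, and is
-- doubled for involutions.
--
-- One word per letter set gives a family to which Janson's inequality applies with negligible dependence, so h is
-- missed with probability at most exp(−(1+3ε/4) log N / m).  Hypotheses (a)–(c) bound the number of h of each kind
-- by N^{1/m} up to a factor N^{ε/4}, so the sum over h tends to 0.

module Submission where

open import Defs
open import Algebra.Bundles using (CommutativeRing; Group)
import Algebra.Properties.CommutativeSemiring.Exp as CommutativeSemiringExp
import Algebra.Properties.Group as GroupProperties
import Algebra.Properties.Ring as RingProperties
import Algebra.Properties.Semiring.Exp as SemiringExp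
import Algebra.Properties.Semiring.Mult as SemiringMult
import Algebra.Solver.Ring as RingSolver
open import Algebra.Solver.Ring.AlmostCommutativeRing
  using (AlmostCommutativeRing; _-Raw-AlmostCommutative⟶_; fromCommutativeRing)
open import Algebra.Structures using (IsGroup)
open import Data.Bool.Base using (Bool; _xor_; _∧_; false; if_then_else_; not; true)
import Data.Bool.Properties as Bool
open import Data.Empty using (⊥; ⊥-elim)
open import Data.Fin.Base as Fin using (Fin; fromℕ<; punchOut; suc; toℕ; zero)
import Data.Fin.Properties as Fin
import Data.Fin.Subset as Subset
open import Data.Fin.Subset using (Subset; inside; outside; ∁; ∣_∣)
import Data.Fin.Subset.Properties as Subset
open import Data.Integer.Base as ℤ using (-[1+_]; _⊖_; _◃_; ℤ)
import Data.Integer.Properties as ℤ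
open import Data.List.Base
  using (List; []; _++_; _∷_; allFin; applyUpTo; cartesianProductWith; drop; filter; foldr; length; map;
    tabulate; take)
import Data.List.Membership.DecPropositional as ListMembership
open import Data.List.Membership.Propositional using (_∈_; _∉_)
open import Data.List.Membership.Propositional.Properties
  using (∈-++⁺ʳ; ∈-++⁺ˡ; ∈-++⁻; ∈-allFin; ∈-map⁺; ∈-map⁻; ∈-tabulate⁺; ∈-∃++)
import Data.List.Properties as List
open import Data.List.Relation.Binary.Permutation.Propositional
  using (_↭_; prep; ↭-refl; ↭-sym; ↭-trans; ↭⇒↭ₛ)
import Data.List.Relation.Binary.Permutation.Propositional.Properties as Perm
import Data.List.Relation.Binary.Permutation.Setoid.Properties as PermSetoid
open import Data.List.Relation.Binary.Sublist.Propositional using ([]; _∷_; _∷ʳ_; _⊆_; ⊆-trans)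
import Data.List.Relation.Binary.Sublist.Propositional.Properties as Sublist
import Data.List.Relation.Unary.All as All
open import Data.List.Relation.Unary.All using (All; []; _∷_)
import Data.List.Relation.Unary.All.Properties as All
import Data.List.Relation.Unary.AllPairs as AllPairs
open import Data.List.Relation.Unary.AllPairs using (AllPairs; []; _∷_)
import Data.List.Relation.Unary.AllPairs.Properties as AllPairs
import Data.List.Relation.Unary.Any as Any
open import Data.List.Relation.Unary.Any using (here; there)
import Data.List.Relation.Unary.Unique.DecPropositional as DecUnique
open import Data.List.Relation.Unary.Unique.Propositional using (Unique)
import Data.List.Relation.Unary.Unique.Propositional.Properties as Unique
open import Data.Maybe.Base using (Maybe; is-just; just; nothing)
open import Data.Nat.Base as ℕ using (_!; _∸_; suc; s≤s; zero; z≤n; ℕ)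
import Data.Nat.Properties as ℕ
open import Data.Product.Base using (_,_; _×_; proj₁; proj₂; ∃-syntax)
import Data.Product.Properties as Product
open import Data.Sign.Base as Sign using (Sign)
import Data.Sum.Base as Sum
open import Data.Sum.Base using (_⊎_; inj₁; inj₂)
open import Data.Unit.Base using (tt; ⊤)
open import Data.Vec.Base as Vec using (Vec; []; _[_]≔_; _∷_; lookup; replicate; toList)
import Data.Vec.Membership.DecPropositional as VecMembership
open import Data.Vec.Membership.Propositional using () renaming (_∈_ to _∈ᵛ_; _∉_ to _∉ᵛ_)
open import Data.Vec.N-ary using (Eq; N-ary; curryⁿ; curryⁿ-cong)
import Data.Vec.Properties as Vec
import Data.Vec.Relation.Unary.Any as VecAny
open import Data.Vec.Relation.Unary.Any using (here; there)
import Data.Vec.Relation.Unary.Any.Properties as VecAny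
open import Function.Base using (_$_; _∘_; id)
open import Function.Bundles using (Inverse)
open import Level using (0ℓ)
open import Relation.Binary.Bundles using (Poset)
open import Relation.Binary.Core using (Rel)
open import Relation.Binary.Definitions
  using (DecidableEquality; tri<; tri>; tri≈) renaming (Decidable to Decidable₂)
open import Relation.Binary.PropositionalEquality
  using (_≡_; _≢_; cong; cong₂; module ≡-Reasoning; refl; subst; subst₂; sym; trans)
open import Relation.Binary.PropositionalEquality.Properties using (setoid)
import Relation.Binary.Reasoning.PartialOrder as PartialOrderReasoning
import Relation.Binary.Reflection as Reflection
open import Relation.Binary.Structures using (IsDecTotalOrder)
open import Relation.Nullary
open import Relation.Nullary.Decidable using (_×-dec_; _⊎-dec_; map′; ¬?; ⌊_⌋)
open import Relation.Unary using (Decidable; Pred)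

-- The length `d` grows with N, so exceptional equations must be rare enough to survive a union over
-- all signed permutations of `d` letters. Put L = log N, y = log log N and u = √(L y). There are at
-- most (2d)^d ≤ exp (d y) patterns, and the bound d_N forces 2 d² y ≤ L, hence d y ≤ 3u/4. The
-- choice M = exp (2u) makes the centralizer of an element of a class larger than M at most N exp
-- (-2u). The square root of the density of commuting pairs is then still of order exp (-u), which
-- beats exp (3u/4).
--
-- In Janson's inequality the danger lies in words that share some but not all letters; two words
-- with the same letter set are excluded by making the family an antichain. Given one word, a
-- dependent word has a letter inside it and a letter outside it. The outside letter costs `p` and
-- is determined by the product, so the dependence is the mean divided by about N p, up to a factor
-- of order d³. At the threshold N p is at least (log N)^4, whereas the mean times the remaining
-- factors is of order (log N)^3 at most.

-- Ordered-field arithmetic and a ring solver over the reals.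

module OrderedField (R : Reals) where
  open Reals R
  open CommutativeRing commutativeRing public
    using (+-assoc; +-comm; +-identityˡ; +-identityʳ; -‿inverseˡ; -‿inverseʳ; *-assoc; *-comm;
           *-identityˡ; *-identityʳ; distribˡ; distribʳ; zeroˡ; zeroʳ; semiring; commutativeSemiring; ring)
  open RingProperties ring using (-‿distribˡ-*; -‿distribʳ-*; -‿involutive; -‿+-comm)
    renaming (-0#≈0# to -0≡0)
  open SemiringExp semiring public using (^-homo-*; ^-assocʳ)
  open CommutativeSemiringExp commutativeSemiring public using (^-distrib-*)
  open SemiringMult semiring using (×-homo-+; ×1-homo-*)

  fromℕ-+ : ∀ m n → fromℕ (m ℕ.+ n) ≡ fromℕ m + fromℕ n
  fromℕ-+ = ×-homo-+ 1#

  fromℕ-* : ∀ m n → fromℕ (m ℕ.* n) ≡ fromℕ m * fromℕ n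
  fromℕ-* = ×1-homo-*

  private
    -- The coefficients 0 and 1 are interpreted by 0# and 1# themselves (fromℕ 1 is 1# + 0#).
    ⟦_⟧ℕ : ℕ → ℝ
    ⟦ 1 ⟧ℕ = 1#
    ⟦ n ⟧ℕ = fromℕ n

    ⟦⟧ℕ≡fromℕ : ∀ n → ⟦ n ⟧ℕ ≡ fromℕ n
    ⟦⟧ℕ≡fromℕ 0             = refl
    ⟦⟧ℕ≡fromℕ 1             = sym (+-identityʳ 1#)
    ⟦⟧ℕ≡fromℕ (suc (suc n)) = refl

    ⟦_⟧ℤ : ℤ → ℝ
    ⟦ ℤ.+ n ⟧ℤ      = ⟦ n ⟧ℕ
    ⟦ -[1+ n ] ⟧ℤ = - ⟦ suc n ⟧ℕ

    cancel-1 : ∀ a b → (1# + a) - (1# + b) ≡ a - b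
    cancel-1 a b = begin
      (1# + a) + - (1# + b)      ≡⟨ cong ((1# + a) +_) (sym (-‿+-comm 1# b)) ⟩
      (1# + a) + (- 1# + - b)    ≡⟨ cong (_+ (- 1# + - b)) (+-comm 1# a) ⟩
      (a + 1#) + (- 1# + - b)    ≡⟨ +-assoc a 1# _ ⟩
      a + (1# + (- 1# + - b))    ≡⟨ cong (a +_) (sym (+-assoc 1# (- 1#) (- b))) ⟩
      a + ((1# - 1#) + - b)      ≡⟨ cong (λ z → a + (z + - b)) (-‿inverseʳ 1#) ⟩
      a + (0# + - b)             ≡⟨ cong (a +_) (+-identityˡ (- b)) ⟩
      a - b                      ∎
      where open ≡-Reasoning

    ⟦⟧-⊖ : ∀ m n → ⟦ m ⊖ n ⟧ℤ ≡ fromℕ m - fromℕ n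
    ⟦⟧-⊖ m       zero    = trans (⟦⟧ℕ≡fromℕ m) (sym (trans (cong (fromℕ m +_) -0≡0) (+-identityʳ _)))
    ⟦⟧-⊖ zero    (suc n) = trans (cong -_ (⟦⟧ℕ≡fromℕ (suc n))) (sym (+-identityˡ _))
    ⟦⟧-⊖ (suc m) (suc n) = begin
      ⟦ suc m ⊖ suc n ⟧ℤ           ≡⟨ cong ⟦_⟧ℤ (ℤ.[1+m]⊖[1+n]≡m⊖n m n) ⟩
      ⟦ m ⊖ n ⟧ℤ                   ≡⟨ ⟦⟧-⊖ m n ⟩
      fromℕ m - fromℕ n            ≡⟨ cancel-1 _ _ ⟨
      fromℕ (suc m) - fromℕ (suc n) ∎
      where open ≡-Reasoning

    ⟦⟧-+ : ∀ i j → ⟦ i ℤ.+ j ⟧ℤ ≡ ⟦ i ⟧ℤ + ⟦ j ⟧ℤ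
    ⟦⟧-+ (ℤ.+ m) (ℤ.+ n) = begin
      ⟦ m ℕ.+ n ⟧ℕ        ≡⟨ ⟦⟧ℕ≡fromℕ (m ℕ.+ n) ⟩
      fromℕ (m ℕ.+ n)     ≡⟨ fromℕ-+ m n ⟩
      fromℕ m + fromℕ n   ≡⟨ cong₂ _+_ (⟦⟧ℕ≡fromℕ m) (⟦⟧ℕ≡fromℕ n) ⟨
      ⟦ m ⟧ℕ + ⟦ n ⟧ℕ     ∎
      where open ≡-Reasoning
    ⟦⟧-+ (ℤ.+ m) -[1+ n ] =
      trans (⟦⟧-⊖ m (suc n)) (sym (cong₂ (λ a b → a - b) (⟦⟧ℕ≡fromℕ m) (⟦⟧ℕ≡fromℕ (suc n))))
    ⟦⟧-+ -[1+ m ] (ℤ.+ n) = trans (⟦⟧-⊖ n (suc m))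
      (trans (sym (cong₂ (λ a b → a - b) (⟦⟧ℕ≡fromℕ n) (⟦⟧ℕ≡fromℕ (suc m)))) (+-comm _ _))
    ⟦⟧-+ -[1+ m ] -[1+ n ] = begin
      - ⟦ suc (suc (m ℕ.+ n)) ⟧ℕ            ≡⟨ cong (λ k → - fromℕ (suc k)) (ℕ.+-suc m n) ⟨
      - fromℕ (suc m ℕ.+ suc n)            ≡⟨ cong -_ (fromℕ-+ (suc m) (suc n)) ⟩
      - (fromℕ (suc m) + fromℕ (suc n))    ≡⟨ -‿+-comm _ _ ⟨
      - fromℕ (suc m) + - fromℕ (suc n)    ≡⟨ cong₂ (λ a b → - a + - b) (⟦⟧ℕ≡fromℕ (suc m)) (⟦⟧ℕ≡fromℕ (suc n)) ⟨
      - ⟦ suc m ⟧ℕ + - ⟦ suc n ⟧ℕ           ∎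
      where open ≡-Reasoning

    ⟦⟧-neg : ∀ i → ⟦ ℤ.- i ⟧ℤ ≡ - ⟦ i ⟧ℤ
    ⟦⟧-neg (ℤ.+ zero)  = sym -0≡0
    ⟦⟧-neg (ℤ.+ suc n) = refl
    ⟦⟧-neg -[1+ n ]  = sym (-‿involutive _)

    ⟦⟧-*ℕ : ∀ m n → ⟦ m ℕ.* n ⟧ℕ ≡ ⟦ m ⟧ℕ * ⟦ n ⟧ℕ
    ⟦⟧-*ℕ m n = trans (⟦⟧ℕ≡fromℕ (m ℕ.* n))
      (trans (fromℕ-* m n) (sym (cong₂ _*_ (⟦⟧ℕ≡fromℕ m) (⟦⟧ℕ≡fromℕ n))))

    ⟦⟧-+◃ : ∀ n → ⟦ Sign.+ ◃ n ⟧ℤ ≡ ⟦ n ⟧ℕ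
    ⟦⟧-+◃ zero    = refl
    ⟦⟧-+◃ (suc n) = refl

    ⟦⟧--◃ : ∀ n → ⟦ Sign.- ◃ n ⟧ℤ ≡ - ⟦ n ⟧ℕ
    ⟦⟧--◃ zero    = sym -0≡0
    ⟦⟧--◃ (suc n) = refl

    ⟦⟧-* : ∀ i j → ⟦ i ℤ.* j ⟧ℤ ≡ ⟦ i ⟧ℤ * ⟦ j ⟧ℤ
    ⟦⟧-* (ℤ.+ m) (ℤ.+ n) = trans (⟦⟧-+◃ (m ℕ.* n)) (⟦⟧-*ℕ m n)
    ⟦⟧-* (ℤ.+ m) -[1+ n ] =
      trans (⟦⟧--◃ (m ℕ.* suc n)) (trans (cong -_ (⟦⟧-*ℕ m (suc n))) (-‿distribʳ-* _ _))
    ⟦⟧-* -[1+ m ] (ℤ.+ n) =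
      trans (⟦⟧--◃ (suc m ℕ.* n)) (trans (cong -_ (⟦⟧-*ℕ (suc m) n)) (-‿distribˡ-* _ _))
    ⟦⟧-* -[1+ m ] -[1+ n ] = begin
      ⟦ suc m ℕ.* suc n ⟧ℕ              ≡⟨ ⟦⟧-*ℕ (suc m) (suc n) ⟩
      ⟦ suc m ⟧ℕ * ⟦ suc n ⟧ℕ           ≡⟨ -‿involutive _ ⟨
      - - (⟦ suc m ⟧ℕ * ⟦ suc n ⟧ℕ)     ≡⟨ cong -_ (-‿distribˡ-* _ _) ⟩
      - (- ⟦ suc m ⟧ℕ * ⟦ suc n ⟧ℕ)     ≡⟨ -‿distribʳ-* _ _ ⟩
      - ⟦ suc m ⟧ℕ * - ⟦ suc n ⟧ℕ       ∎
      where open ≡-Reasoning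

    almostCommutativeRing : AlmostCommutativeRing _ _
    almostCommutativeRing = fromCommutativeRing commutativeRing

    morphism : ℤ.+-*-rawRing -Raw-AlmostCommutative⟶ almostCommutativeRing
    morphism = record
      { ⟦_⟧    = ⟦_⟧ℤ
      ; +-homo = ⟦⟧-+
      ; *-homo = ⟦⟧-*
      ; -‿homo = ⟦⟧-neg
      ; 0-homo = refl
      ; 1-homo = refl
      }

    coeff≟ : ∀ i j → Maybe (⟦ i ⟧ℤ ≡ ⟦ j ⟧ℤ)
    coeff≟ i j with i ℤ.≟ j
    ... | yes i≡j = just (cong ⟦_⟧ℤ i≡j)
    ... | no  _   = nothing

  open RingSolver ℤ.+-*-rawRing almostCommutativeRing morphism coeff≟ public
    using (Polynomial; _:+_; _:*_; _:-_; :-_; _:=_)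
  open RingSolver ℤ.+-*-rawRing almostCommutativeRing morphism coeff≟
    using (con; var; ⟦_⟧; ⟦_⟧N-cong; normalise; correct; _≟N_)
  open Reflection (setoid ℝ) var ⟦_⟧ (λ p → ⟦ p ⟧) (λ _ _ → refl) using (close)

  κ : ∀ {n} → ℕ → Polynomial n
  κ k = con (ℤ.+ k)

  -- Comparing normal forms as syntax keeps the reals out of the conversion checker.
  solve : ∀ n (f : N-ary n (Polynomial n) (Polynomial n × Polynomial n)) →
          is-just (normalise (proj₁ (close n f)) ≟N normalise (proj₂ (close n f))) ≡ true →
          Eq n _≡_ (curryⁿ ⟦ proj₁ (close n f) ⟧) (curryⁿ ⟦ proj₂ (close n f) ⟧)
  solve n f eq with close n f
  ... | p , q with normalise p ≟N normalise q in eqN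
  ...   | just p≈q = curryⁿ-cong _≡_ ⟦ p ⟧ ⟦ q ⟧ λ ρ →
            trans (sym (correct p ρ)) (trans (⟦ p≈q ⟧N-cong ρ) (correct q ρ))

  open IsDecTotalOrder isDecTotalOrder public
    using (isPartialOrder; total)
    renaming (refl to ≤-refl; reflexive to ≤-reflexive; trans to ≤-trans; antisym to ≤-antisym)

  ≤-poset : Poset _ _ _
  ≤-poset = record { isPartialOrder = isPartialOrder }

  module ≤-Reasoning = PartialOrderReasoning ≤-poset

  <⇒≤ : ∀ {x y} → x < y → x ≤ y
  <⇒≤ = proj₁

  <⇒≢ : ∀ {x y} → x < y → x ≢ y
  <⇒≢ = proj₂

  ≰⇒> : ∀ {x y} → ¬ x ≤ y → y < x
  ≰⇒> {x} {y} x≰y with total x y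
  ... | inj₁ x≤y = ⊥-elim (x≰y x≤y)
  ... | inj₂ y≤x = y≤x , λ { refl → x≰y ≤-refl }

  <⇒≱ : ∀ {x y} → x < y → ¬ y ≤ x
  <⇒≱ (x≤y , x≢y) y≤x = x≢y (≤-antisym x≤y y≤x)

  ≮⇒≥ : ∀ {x y} → ¬ x < y → y ≤ x
  ≮⇒≥ {x} {y} x≮y with y ≤? x
  ... | yes y≤x = y≤x
  ... | no  y≰x = ⊥-elim (x≮y (≰⇒> y≰x))

  <-≤-trans : ∀ {x y z} → x < y → y ≤ z → x < z
  <-≤-trans x<y y≤z = ≤-trans (<⇒≤ x<y) y≤z , λ { refl → <⇒≱ x<y y≤z }

  ≤-<-trans : ∀ {x y z} → x ≤ y → y < z → x < z
  ≤-<-trans x≤y y<z = ≤-trans x≤y (<⇒≤ y<z) , λ { refl → <⇒≱ y<z x≤y }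

  +-mono-≤ : ∀ {a b c d} → a ≤ b → c ≤ d → a + c ≤ b + d
  +-mono-≤ {a} {b} {c} {d} a≤b c≤d = begin
    a + c ≤⟨ +-monoʳ-≤ a c≤d ⟩
    a + d ≡⟨ +-comm a d ⟩
    d + a ≤⟨ +-monoʳ-≤ d a≤b ⟩
    d + b ≡⟨ +-comm d b ⟩
    b + d ∎
    where open ≤-Reasoning

  +-monoˡ-≤ : ∀ x {y z} → y ≤ z → y + x ≤ z + x
  +-monoˡ-≤ x y≤z = +-mono-≤ y≤z ≤-refl

  x≤y⇒0≤y-x : ∀ {x y} → x ≤ y → 0# ≤ y - x
  x≤y⇒0≤y-x {x} {y} x≤y = subst (_≤ y - x) (-‿inverseʳ x) (+-monoˡ-≤ (- x) x≤y)

  -- Nonlinear inequalities are proved throughout by exhibiting `z` as a certificate and leaving the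
  -- identity to `solve`.
  ≤-slack : ∀ {x y} z → 0# ≤ z → y ≡ x + z → x ≤ y
  ≤-slack {x} z 0≤z refl = subst (_≤ x + z) (+-identityʳ x) (+-monoʳ-≤ x 0≤z)

  +-nonneg : ∀ {x y} → 0# ≤ x → 0# ≤ y → 0# ≤ x + y
  +-nonneg 0≤x 0≤y = subst (_≤ _) (+-identityˡ 0#) (+-mono-≤ 0≤x 0≤y)

  x≤x+y : ∀ {x y} → 0# ≤ y → x ≤ x + y
  x≤x+y {y = y} 0≤y = ≤-slack y 0≤y refl

  x≤y+x : ∀ {x y} → 0# ≤ y → x ≤ y + x
  x≤y+x {x} {y} 0≤y = ≤-slack y 0≤y (+-comm y x)

  +-cancelʳ-≤ : ∀ {x y} z → x + z ≤ y + z → x ≤ y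
  +-cancelʳ-≤ {x} {y} z h = subst₂ _≤_ (undo x) (undo y) (+-monoˡ-≤ (- z) h)
    where undo = λ a → solve 2 (λ a z → (a :+ z) :- z := a) refl a z

  neg-mono-≤ : ∀ {x y} → x ≤ y → - y ≤ - x
  neg-mono-≤ {x} {y} x≤y = ≤-slack (y - x) (x≤y⇒0≤y-x x≤y)
    (solve 2 (λ x y → :- x := :- y :+ (y :- x)) refl x y)

  *-monoˡ-≤ : ∀ {z} → 0# ≤ z → ∀ {x y} → x ≤ y → z * x ≤ z * y
  *-monoˡ-≤ {z} 0≤z {x} {y} x≤y = ≤-slack (z * (y - x)) (*-nonneg 0≤z (x≤y⇒0≤y-x x≤y))
    (solve 3 (λ x y z → z :* y := z :* x :+ z :* (y :- x)) refl x y z)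

  *-monoʳ-≤ : ∀ {z} → 0# ≤ z → ∀ {x y} → x ≤ y → x * z ≤ y * z
  *-monoʳ-≤ {z} 0≤z {x} {y} x≤y = subst₂ _≤_ (*-comm z x) (*-comm z y) (*-monoˡ-≤ 0≤z x≤y)

  *-mono-≤ : ∀ {a b c d} → 0# ≤ b → 0# ≤ c → a ≤ b → c ≤ d → a * c ≤ b * d
  *-mono-≤ 0≤b 0≤c a≤b c≤d = ≤-trans (*-monoʳ-≤ 0≤c a≤b) (*-monoˡ-≤ 0≤b c≤d)

  square-nonneg : ∀ x → 0# ≤ x * x
  square-nonneg x with total 0# x
  ... | inj₁ 0≤x = *-nonneg 0≤x 0≤x
  ... | inj₂ x≤0 = subst (0# ≤_) (solve 1 (λ x → (:- x) :* (:- x) := x :* x) refl x)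
                     (*-nonneg 0≤-x 0≤-x)
    where 0≤-x = subst (_≤ - x) -0≡0 (neg-mono-≤ x≤0)

  0≤1 : 0# ≤ 1#
  0≤1 = subst (0# ≤_) (*-identityʳ 1#) (square-nonneg 1#)

  0<1 : 0# < 1#
  0<1 = 0≤1 , 0≢1

  fromℕ-nonneg : ∀ n → 0# ≤ fromℕ n
  fromℕ-nonneg zero    = ≤-refl
  fromℕ-nonneg (suc n) = +-nonneg 0≤1 (fromℕ-nonneg n)

  fromℕ-mono-≤ : ∀ {m n} → m ℕ.≤ n → fromℕ m ≤ fromℕ n
  fromℕ-mono-≤ {n = n} z≤n = fromℕ-nonneg n
  fromℕ-mono-≤ (s≤s m≤n) = +-monoʳ-≤ 1# (fromℕ-mono-≤ m≤n)

  1≤fromℕ-suc : ∀ n → 1# ≤ fromℕ (suc n)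
  1≤fromℕ-suc n = x≤x+y (fromℕ-nonneg n)

  0<fromℕ-suc : ∀ n → 0# < fromℕ (suc n)
  0<fromℕ-suc n = <-≤-trans 0<1 (1≤fromℕ-suc n)

  0<⇒≢0 : ∀ {x} → 0# < x → x ≢ 0#
  0<⇒≢0 0<x x≡0 = <⇒≢ 0<x (sym x≡0)

  x*x⁻¹ : ∀ {x} → 0# < x → x * x ⁻¹ ≡ 1#
  x*x⁻¹ 0<x = *-inverseʳ (0<⇒≢0 0<x)

  *-cancelˡ-≡ : ∀ {z x y} → 0# < z → z * x ≡ z * y → x ≡ y
  *-cancelˡ-≡ {z} {x} {y} 0<z eq = begin
    x                ≡⟨ undo x ⟩
    z ⁻¹ * (z * x)   ≡⟨ cong (z ⁻¹ *_) eq ⟩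
    z ⁻¹ * (z * y)   ≡⟨ undo y ⟨
    y                ∎
    where
    open ≡-Reasoning
    undo : ∀ a → a ≡ z ⁻¹ * (z * a)
    undo a = trans (sym (*-identityˡ a)) (trans (cong (_* a) (sym (x*x⁻¹ 0<z)))
      (solve 3 (λ z w a → z :* w :* a := w :* (z :* a)) refl z (z ⁻¹) a))

  *-pos : ∀ {x y} → 0# < x → 0# < y → 0# < x * y
  *-pos {x} {y} 0<x 0<y = *-nonneg (<⇒≤ 0<x) (<⇒≤ 0<y) ,
    λ 0≡xy → <⇒≢ 0<y (*-cancelˡ-≡ 0<x (trans (zeroʳ x) 0≡xy))

  *-cancelˡ-≤ : ∀ {z x y} → 0# < z → z * x ≤ z * y → x ≤ y
  *-cancelˡ-≤ {z} {x} {y} 0<z zx≤zy with x ≤? y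
  ... | yes x≤y = x≤y
  ... | no  x≰y = ⊥-elim (x≰y (≤-reflexive (*-cancelˡ-≡ 0<z
                    (≤-antisym zx≤zy (*-monoˡ-≤ (<⇒≤ 0<z) (<⇒≤ (≰⇒> x≰y)))))))

  *-cancelʳ-≤ : ∀ {z x y} → 0# < z → x * z ≤ y * z → x ≤ y
  *-cancelʳ-≤ {z} {x} {y} 0<z h = *-cancelˡ-≤ 0<z (subst₂ _≤_ (*-comm x z) (*-comm y z) h)

  *-monoˡ-< : ∀ {z x y} → 0# < z → x < y → z * x < z * y
  *-monoˡ-< 0<z x<y = *-monoˡ-≤ (<⇒≤ 0<z) (<⇒≤ x<y) , <⇒≢ x<y ∘ *-cancelˡ-≡ 0<z

  ⁻¹-pos : ∀ {x} → 0# < x → 0# < x ⁻¹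
  ⁻¹-pos {x} 0<x = ≰⇒> λ x⁻¹≤0 → <⇒≱ 0<1 (begin
    1#        ≡⟨ x*x⁻¹ 0<x ⟨
    x * x ⁻¹  ≤⟨ *-monoˡ-≤ (<⇒≤ 0<x) x⁻¹≤0 ⟩
    x * 0#    ≡⟨ zeroʳ x ⟩
    0#        ∎)
    where open ≤-Reasoning

  /-cancel : ∀ {y} → 0# < y → ∀ x → x / y * y ≡ x
  /-cancel {y} 0<y x = begin
    x * y ⁻¹ * y   ≡⟨ solve 3 (λ x y w → x :* w :* y := y :* w :* x) refl x y (y ⁻¹) ⟩
    y * y ⁻¹ * x   ≡⟨ cong (_* x) (x*x⁻¹ 0<y) ⟩
    1# * x         ≡⟨ *-identityˡ x ⟩
    x              ∎
    where open ≡-Reasoning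

  ≤/ : ∀ {x y z} → 0# < y → x * y ≤ z → x ≤ z / y
  ≤/ {x} {y} {z} 0<y h = *-cancelʳ-≤ 0<y (≤-trans h (≤-reflexive (sym (/-cancel 0<y z))))

  /≤ : ∀ {x y z} → 0# < y → z ≤ x * y → z / y ≤ x
  /≤ {x} {y} {z} 0<y h = *-cancelʳ-≤ 0<y (≤-trans (≤-reflexive (/-cancel 0<y z)) h)

  /-nonneg : ∀ {x y} → 0# ≤ x → 0# < y → 0# ≤ x / y
  /-nonneg 0≤x 0<y = *-nonneg 0≤x (<⇒≤ (⁻¹-pos 0<y))

  /-pos : ∀ {x y} → 0# < x → 0# < y → 0# < x / y
  /-pos 0<x 0<y = *-pos 0<x (⁻¹-pos 0<y)

  ^-nonneg : ∀ {x} → 0# ≤ x → ∀ n → 0# ≤ x ^ n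
  ^-nonneg 0≤x zero    = 0≤1
  ^-nonneg 0≤x (suc n) = *-nonneg 0≤x (^-nonneg 0≤x n)

  ^-pos : ∀ {x} → 0# < x → ∀ n → 0# < x ^ n
  ^-pos 0<x zero    = 0<1
  ^-pos 0<x (suc n) = *-pos 0<x (^-pos 0<x n)

  ^-mono-≤ : ∀ {x y} → 0# ≤ x → x ≤ y → ∀ n → x ^ n ≤ y ^ n
  ^-mono-≤ 0≤x x≤y zero    = ≤-refl
  ^-mono-≤ 0≤x x≤y (suc n) = *-mono-≤ (≤-trans 0≤x x≤y) (^-nonneg 0≤x n) x≤y (^-mono-≤ 0≤x x≤y n)

  ^-mono-< : ∀ {x y} → 0# ≤ x → x < y → ∀ n → x ^ suc n < y ^ suc n
  ^-mono-< {x} {y} 0≤x x<y n = ≤-<-trans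
    (*-monoˡ-≤ 0≤x (^-mono-≤ 0≤x (<⇒≤ x<y) n))
    (subst₂ _<_ (*-comm _ x) (*-comm _ y) (*-monoˡ-< (^-pos (≤-<-trans 0≤x x<y) n) x<y))

  1≤^ : ∀ {x} → 1# ≤ x → ∀ n → 1# ≤ x ^ n
  1≤^ 1≤x zero    = ≤-refl
  1≤^ {x} 1≤x (suc n) = subst (_≤ x * x ^ n) (*-identityʳ 1#)
    (*-mono-≤ (≤-trans 0≤1 1≤x) 0≤1 1≤x (1≤^ 1≤x n))

  ^-cancel-≤ : ∀ {x y} n → 0# ≤ y → x ^ suc n ≤ y ^ suc n → x ≤ y
  ^-cancel-≤ {x} {y} n 0≤y h with x ≤? y
  ... | yes x≤y = x≤y
  ... | no  x≰y = ⊥-elim (<⇒≱ (^-mono-< 0≤y (≰⇒> x≰y) n) h)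

  square-cancel-≤ : ∀ {x y} → 0# ≤ y → x * x ≤ y * y → x ≤ y
  square-cancel-≤ {x} {y} 0≤y h = ^-cancel-≤ 1 0≤y
    (subst₂ _≤_ (cong (x *_) (sym (*-identityʳ x))) (cong (y *_) (sym (*-identityʳ y))) h)

-- Exponential, logarithm and roots from completeness.

module Exponential (R : Reals) where
  open Reals R
  open OrderedField R

  partial : (ℕ → ℝ) → ℕ → ℝ
  partial f zero    = 0#
  partial f (suc n) = f 0 + partial (f ∘ suc) n

  Σ-upTo : ∀ (f : ℕ → ℝ) (g : ℕ → ℕ) n → Σ[ map f (applyUpTo g n) ] ≡ partial (f ∘ g) n
  Σ-upTo f g zero    = refl
  Σ-upTo f g (suc n) = cong (f (g 0) +_) (Σ-upTo f (λ k → g (suc k)) n)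

  partial-cong : ∀ {f g} → (∀ k → f k ≡ g k) → ∀ n → partial f n ≡ partial g n
  partial-cong eq zero    = refl
  partial-cong eq (suc n) = cong₂ _+_ (eq 0) (partial-cong (eq ∘ suc) n)

  partial-mono : ∀ {f g} → (∀ k → f k ≤ g k) → ∀ n → partial f n ≤ partial g n
  partial-mono le zero    = ≤-refl
  partial-mono le (suc n) = +-mono-≤ (le 0) (partial-mono (le ∘ suc) n)

  partial-scale : ∀ c f n → partial (λ k → c * f k) n ≡ c * partial f n
  partial-scale c f zero    = sym (zeroʳ c)
  partial-scale c f (suc n) = trans (cong (c * f 0 +_) (partial-scale c (f ∘ suc) n)) (sym (distribˡ c _ _))

  partial-+ : ∀ f g n → partial (λ k → f k + g k) n ≡ partial f n + partial g n
  partial-+ f g zero    = sym (+-identityˡ 0#)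
  partial-+ f g (suc n) = trans (cong (f 0 + g 0 +_) (partial-+ (f ∘ suc) (g ∘ suc) n))
    (solve 4 (λ a b c d → (a :+ b) :+ (c :+ d) := (a :+ c) :+ (b :+ d)) refl _ _ _ _)

  Nonneg : (ℕ → ℝ) → Set
  Nonneg f = ∀ k → 0# ≤ f k

  partial-nonneg : ∀ {f} → Nonneg f → ∀ n → 0# ≤ partial f n
  partial-nonneg f≥0 zero    = ≤-refl
  partial-nonneg f≥0 (suc n) = +-nonneg (f≥0 0) (partial-nonneg (f≥0 ∘ suc) n)

  partial-mono-ℕ : ∀ {f m n} → Nonneg f → m ℕ.≤ n → partial f m ≤ partial f n
  partial-mono-ℕ {n = n} f≥0 z≤n = partial-nonneg f≥0 n
  partial-mono-ℕ f≥0 (s≤s m≤n)   = +-monoʳ-≤ _ (partial-mono-ℕ (f≥0 ∘ suc) m≤n)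

  -- The Cauchy product. Peeling off `f 0` shifts `f`, which keeps the recursion structural in the
  -- index.
  conv : (ℕ → ℝ) → (ℕ → ℝ) → ℕ → ℝ
  conv f g zero    = f 0 * g 0
  conv f g (suc n) = f 0 * g (suc n) + conv (f ∘ suc) g n

  conv-cong : ∀ {f f′ g g′} → (∀ k → f k ≡ f′ k) → (∀ k → g k ≡ g′ k) → ∀ n → conv f g n ≡ conv f′ g′ n
  conv-cong p q zero    = cong₂ _*_ (p 0) (q 0)
  conv-cong p q (suc n) = cong₂ _+_ (cong₂ _*_ (p 0) (q (suc n))) (conv-cong (p ∘ suc) q n)

  conv-scaleˡ : ∀ c f g n → conv (λ k → c * f k) g n ≡ c * conv f g n
  conv-scaleˡ c f g zero    = *-assoc c _ _
  conv-scaleˡ c f g (suc n) = trans (cong₂ _+_ (*-assoc c _ _) (conv-scaleˡ c (f ∘ suc) g n)) (sym (distribˡ c _ _))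

  conv-scaleʳ : ∀ c f g n → conv f (λ k → c * g k) n ≡ c * conv f g n
  conv-scaleʳ c f g zero    = solve 3 (λ c x y → x :* (c :* y) := c :* (x :* y)) refl c _ _
  conv-scaleʳ c f g (suc n) = trans
    (cong₂ _+_ (solve 3 (λ c x y → x :* (c :* y) := c :* (x :* y)) refl c _ _) (conv-scaleʳ c (f ∘ suc) g n))
    (sym (distribˡ c _ _))

  conv-last : ∀ f g n → conv f g (suc n) ≡ conv f (g ∘ suc) n + f (suc n) * g 0
  conv-last f g zero    = refl
  conv-last f g (suc n) = trans (cong (f 0 * g (suc (suc n)) +_) (conv-last (f ∘ suc) g n)) (sym (+-assoc _ _ _))

  -- The Leibniz rule: in a term with i + j = n the weight m + n splits as (m + i) + j. The offset
  -- `m` counts the entries of `f` already peeled off.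
  conv-weight : ∀ f g m n → fromℕ (m ℕ.+ n) * conv f g n ≡
                conv (λ i → fromℕ (m ℕ.+ i) * f i) g n + conv f (λ j → fromℕ j * g j) n
  conv-weight f g m zero    =
    solve 3 (λ a x y → a :* (x :* y) := a :* x :* y :+ x :* (κ 0 :* y)) refl _ _ _
  conv-weight f g m (suc n) = begin
    fromℕ (m ℕ.+ suc n) * (f 0 * g (suc n) + conv (f ∘ suc) g n)
      ≡⟨ distribˡ _ _ _ ⟩
    fromℕ (m ℕ.+ suc n) * (f 0 * g (suc n)) + fromℕ (m ℕ.+ suc n) * conv (f ∘ suc) g n
      ≡⟨ cong₂ _+_ (trans (cong (_* (f 0 * g (suc n))) (fromℕ-+ m (suc n)))
                     (cong (λ k → (fromℕ k + fromℕ (suc n)) * (f 0 * g (suc n))) (sym (ℕ.+-identityʳ m))))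
                   (trans (cong (λ k → fromℕ k * conv (f ∘ suc) g n) (ℕ.+-suc m n))
                     (conv-weight (f ∘ suc) g (suc m) n)) ⟩
    (fromℕ (m ℕ.+ 0) + fromℕ (suc n)) * (f 0 * g (suc n)) +
      (conv (λ i → fromℕ (suc m ℕ.+ i) * f (suc i)) g n + conv (f ∘ suc) (λ j → fromℕ j * g j) n)
      ≡⟨ solve 6 (λ a b x y c d → (a :+ b) :* (x :* y) :+ (c :+ d) :=
                   (a :* x :* y :+ c) :+ (x :* (b :* y) :+ d)) refl _ _ _ _ _ _ ⟩
    (fromℕ (m ℕ.+ 0) * f 0 * g (suc n) + conv (λ i → fromℕ (suc m ℕ.+ i) * f (suc i)) g n) +
      (f 0 * (fromℕ (suc n) * g (suc n)) + conv (f ∘ suc) (λ j → fromℕ j * g j) n)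
      ≡⟨ cong (λ z → (fromℕ (m ℕ.+ 0) * f 0 * g (suc n) + z) +
                (f 0 * (fromℕ (suc n) * g (suc n)) + conv (f ∘ suc) (λ j → fromℕ j * g j) n))
           (conv-cong (λ i → cong (λ k → fromℕ k * f (suc i)) (sym (ℕ.+-suc m i))) (λ _ → refl) n) ⟩
    conv (λ i → fromℕ (m ℕ.+ i) * f i) g (suc n) + conv f (λ j → fromℕ j * g j) (suc n) ∎
    where open ≡-Reasoning

  partial-conv : ∀ f g n → partial (conv f g) (suc n) ≡ f 0 * partial g (suc n) + partial (conv (f ∘ suc) g) n
  partial-conv f g n = begin
    f 0 * g 0 + partial (λ k → f 0 * g (suc k) + conv (f ∘ suc) g k) n
      ≡⟨ cong (f 0 * g 0 +_) (partial-+ (λ k → f 0 * g (suc k)) (conv (f ∘ suc) g) n) ⟩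
    f 0 * g 0 + (partial (λ k → f 0 * g (suc k)) n + partial (conv (f ∘ suc) g) n)
      ≡⟨ cong (λ z → f 0 * g 0 + (z + partial (conv (f ∘ suc) g) n)) (partial-scale (f 0) (g ∘ suc) n) ⟩
    f 0 * g 0 + (f 0 * partial (g ∘ suc) n + partial (conv (f ∘ suc) g) n)
      ≡⟨ solve 4 (λ a b c d → a :* b :+ (a :* c :+ d) := a :* (b :+ c) :+ d) refl _ _ _ _ ⟩
    f 0 * (g 0 + partial (g ∘ suc) n) + partial (conv (f ∘ suc) g) n ∎
    where open ≡-Reasoning

  conv-nonneg : ∀ {f g} → Nonneg f → Nonneg g → Nonneg (conv f g)
  conv-nonneg f≥0 g≥0 zero    = *-nonneg (f≥0 0) (g≥0 0)
  conv-nonneg f≥0 g≥0 (suc n) = +-nonneg (*-nonneg (f≥0 0) (g≥0 _)) (conv-nonneg (f≥0 ∘ suc) g≥0 n)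

  -- The triangle i + j < n lies in the square i, j < n. With the reverse inclusion in
  -- `≤-partial-conv`, of a rectangle in a larger triangle, this replaces an appeal to absolute
  -- convergence.
  partial-conv-≤ : ∀ {f g} → Nonneg f → Nonneg g → ∀ n → partial (conv f g) n ≤ partial f n * partial g n
  partial-conv-≤ f≥0 g≥0 zero = ≤-reflexive (sym (zeroˡ 0#))
  partial-conv-≤ {f} {g} f≥0 g≥0 (suc n) = begin
    partial (conv f g) (suc n)
      ≡⟨ partial-conv f g n ⟩
    f 0 * partial g (suc n) + partial (conv (f ∘ suc) g) n
      ≤⟨ +-monoʳ-≤ _ (≤-trans (partial-conv-≤ (f≥0 ∘ suc) g≥0 n)
           (*-monoˡ-≤ (partial-nonneg (f≥0 ∘ suc) n) (partial-mono-ℕ g≥0 (ℕ.n≤1+n n)))) ⟩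
    f 0 * partial g (suc n) + partial (f ∘ suc) n * partial g (suc n)
      ≡⟨ distribʳ _ _ _ ⟨
    partial f (suc n) * partial g (suc n) ∎
    where open ≤-Reasoning

  ≤-partial-conv : ∀ {f g} → Nonneg f → Nonneg g → ∀ n m → partial f n * partial g m ≤ partial (conv f g) (n ℕ.+ m)
  ≤-partial-conv {f} {g} f≥0 g≥0 zero m =
    ≤-trans (≤-reflexive (zeroˡ _)) (partial-nonneg (conv-nonneg f≥0 g≥0) m)
  ≤-partial-conv {f} {g} f≥0 g≥0 (suc n) m = begin
    (f 0 + partial (f ∘ suc) n) * partial g m
      ≡⟨ distribʳ _ _ _ ⟩
    f 0 * partial g m + partial (f ∘ suc) n * partial g m
      ≤⟨ +-mono-≤ (*-monoˡ-≤ (f≥0 0) (partial-mono-ℕ g≥0 (ℕ.m≤n+m m (suc n)))) (≤-partial-conv (f≥0 ∘ suc) g≥0 n m) ⟩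
    f 0 * partial g (suc (n ℕ.+ m)) + partial (conv (f ∘ suc) g) (n ℕ.+ m)
      ≡⟨ partial-conv f g (n ℕ.+ m) ⟨
    partial (conv f g) (suc (n ℕ.+ m)) ∎
    where open ≤-Reasoning

  expTerm : ℝ → ℕ → ℝ
  expTerm x k = x ^ k / fromℕ (k !)

  0<k! : ∀ k → 0# < fromℕ (k !)
  0<k! k with k ! | ℕ.1≤n! k
  ... | suc n | _ = 0<fromℕ-suc n

  expTerm-nonneg : ∀ {x} → 0# ≤ x → Nonneg (expTerm x)
  expTerm-nonneg 0≤x k = /-nonneg (^-nonneg 0≤x k) (0<k! k)

  expTerm-zero : ∀ x → expTerm x 0 ≡ 1#
  expTerm-zero x = *-cancelˡ-≡ (0<k! 0) (trans (*-comm _ _) (trans (/-cancel (0<k! 0) 1#)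
    (sym (trans (*-identityʳ _) (+-identityʳ 1#)))))

  expTerm-suc : ∀ x k → fromℕ (suc k) * expTerm x (suc k) ≡ x * expTerm x k
  expTerm-suc x k = *-cancelˡ-≡ (0<k! k) (begin
    fromℕ (k !) * (fromℕ (suc k) * expTerm x (suc k))
      ≡⟨ solve 3 (λ a b c → a :* (b :* c) := c :* (b :* a)) refl _ _ _ ⟩
    expTerm x (suc k) * (fromℕ (suc k) * fromℕ (k !))
      ≡⟨ cong (expTerm x (suc k) *_) (fromℕ-* (suc k) (k !)) ⟨
    expTerm x (suc k) * fromℕ (suc k !)
      ≡⟨ /-cancel (0<k! (suc k)) _ ⟩
    x * x ^ k
      ≡⟨ cong (x *_) (/-cancel (0<k! k) _) ⟨
    x * (expTerm x k * fromℕ (k !))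
      ≡⟨ solve 3 (λ a b c → a :* (b :* c) := c :* (a :* b)) refl _ _ _ ⟩
    fromℕ (k !) * (x * expTerm x k) ∎)
    where open ≡-Reasoning

  -- The binomial theorem without binomial coefficients: after multiplication by n + 1 the left side
  -- follows `expTerm-suc` and the right side `conv-weight`, and the two recursions agree.
  expTerm-+ : ∀ x y n → expTerm (x + y) n ≡ conv (expTerm x) (expTerm y) n
  expTerm-+ x y zero    = trans (expTerm-zero (x + y))
    (sym (trans (cong₂ _*_ (expTerm-zero x) (expTerm-zero y)) (*-identityˡ 1#)))
  expTerm-+ x y (suc n) = *-cancelˡ-≡ (0<fromℕ-suc n) (begin
    fromℕ (suc n) * expTerm (x + y) (suc n)
      ≡⟨ expTerm-suc (x + y) n ⟩
    (x + y) * expTerm (x + y) n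
      ≡⟨ cong ((x + y) *_) (expTerm-+ x y n) ⟩
    (x + y) * conv a b n
      -- The two added zeros become the terms of index 0 in the weighted convolutions, where the
      -- weight vanishes.
      ≡⟨ solve 3 (λ x y c → (x :+ y) :* c := (κ 0 :+ x :* c) :+ (y :* c :+ κ 0)) refl _ _ _ ⟩
    (0# + x * conv a b n) + (y * conv a b n + 0#)
      ≡⟨ cong₂ _+_
           (cong₂ _+_ (solve 2 (λ u v → κ 0 := κ 0 :* u :* v) refl (a 0) (b (suc n)))
             (trans (sym (conv-scaleˡ x a b n)) (conv-cong (sym ∘ expTerm-suc x) (λ _ → refl) n)))
           (cong₂ _+_ (trans (sym (conv-scaleʳ y a b n)) (conv-cong (λ _ → refl) (sym ∘ expTerm-suc y) n))
             (solve 2 (λ u v → κ 0 := u :* (κ 0 :* v)) refl (a (suc n)) (b 0))) ⟩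
    conv (λ i → fromℕ i * a i) b (suc n) +
      (conv a (λ j → fromℕ (suc j) * b (suc j)) n + a (suc n) * (0# * b 0))
      ≡⟨ cong (conv (λ i → fromℕ i * a i) b (suc n) +_) (conv-last a (λ j → fromℕ j * b j) n) ⟨
    conv (λ i → fromℕ i * a i) b (suc n) + conv a (λ j → fromℕ j * b j) (suc n)
      ≡⟨ conv-weight a b 0 (suc n) ⟨
    fromℕ (suc n) * conv a b (suc n) ∎)
    where
    open ≡-Reasoning
    a = expTerm x
    b = expTerm y

  expSum : ℝ → ℕ → ℝ
  expSum x = partial (expTerm x)

  expSum-nonneg : ∀ {x} → 0# ≤ x → Nonneg (expSum x)
  expSum-nonneg 0≤x = partial-nonneg (expTerm-nonneg 0≤x)

  expSum-+-≤ : ∀ {x y} → 0# ≤ x → 0# ≤ y → ∀ n → expSum (x + y) n ≤ expSum x n * expSum y n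
  expSum-+-≤ {x} {y} 0≤x 0≤y n = ≤-trans (≤-reflexive (partial-cong (expTerm-+ x y) n))
    (partial-conv-≤ (expTerm-nonneg 0≤x) (expTerm-nonneg 0≤y) n)

  ≤-expSum-+ : ∀ {x y} → 0# ≤ x → 0# ≤ y → ∀ n m → expSum x n * expSum y m ≤ expSum (x + y) (n ℕ.+ m)
  ≤-expSum-+ {x} {y} 0≤x 0≤y n m = ≤-trans
    (≤-partial-conv (expTerm-nonneg 0≤x) (expTerm-nonneg 0≤y) n m)
    (≤-reflexive (sym (partial-cong (expTerm-+ x y) (n ℕ.+ m))))

  geometric : ∀ {x} → 0# ≤ x → ∀ n → (1# - x) * partial (x ^_) n ≤ 1#
  geometric {x} 0≤x n = ≤-slack (x ^ n) (^-nonneg 0≤x n) (sym (telescope n))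
    where
    telescope : ∀ n → (1# - x) * partial (x ^_) n + x ^ n ≡ 1#
    telescope zero    = solve 1 (λ x → (κ 1 :- x) :* κ 0 :+ κ 1 := κ 1) refl x
    telescope (suc n) = begin
      (1# - x) * (1# + partial (λ k → x * x ^ k) n) + x * x ^ n
        ≡⟨ cong (λ z → (1# - x) * (1# + z) + x * x ^ n) (partial-scale x (x ^_) n) ⟩
      (1# - x) * (1# + x * partial (x ^_) n) + x * x ^ n
        ≡⟨ solve 3 (λ x p q → (κ 1 :- x) :* (κ 1 :+ x :* p) :+ x :* q :=
             (κ 1 :- x) :+ x :* ((κ 1 :- x) :* p :+ q)) refl x _ _ ⟩
      (1# - x) + x * ((1# - x) * partial (x ^_) n + x ^ n)
        ≡⟨ cong (λ z → (1# - x) + x * z) (telescope n) ⟩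
      (1# - x) + x * 1#
        ≡⟨ solve 1 (λ x → (κ 1 :- x) :+ x :* κ 1 := κ 1) refl x ⟩
      1# ∎
      where open ≡-Reasoning

  expTerm≤^ : ∀ {x} → 0# ≤ x → ∀ k → expTerm x k ≤ x ^ k
  expTerm≤^ {x} 0≤x k = /≤ (0<k! k) (subst (_≤ x ^ k * fromℕ (k !)) (*-identityʳ _)
    (*-monoˡ-≤ (^-nonneg 0≤x k) (≤-trans (1≤fromℕ-suc 0) (fromℕ-mono-≤ (ℕ.1≤n! k)))))

  [1-x]*expSum≤1 : ∀ {x} → 0# ≤ x → x ≤ 1# → ∀ n → (1# - x) * expSum x n ≤ 1#
  [1-x]*expSum≤1 0≤x x≤1 n = ≤-trans
    (*-monoˡ-≤ (x≤y⇒0≤y-x x≤1) (partial-mono (expTerm≤^ 0≤x) n)) (geometric 0≤x n)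

  expSum-multiple : ∀ {x} → 0# ≤ x → ∀ n k → expSum (fromℕ (suc k) * x) n ≤ expSum x n ^ suc k
  expSum-multiple {x} 0≤x n zero = ≤-reflexive (trans
    (cong (λ z → expSum z n) (solve 1 (λ x → (κ 1 :+ κ 0) :* x := x) refl x)) (sym (*-identityʳ _)))
  expSum-multiple {x} 0≤x n (suc k) = begin
    expSum (fromℕ (suc (suc k)) * x) n
      ≡⟨ cong (λ z → expSum z n) (solve 2 (λ a x → (κ 1 :+ a) :* x := x :+ a :* x) refl (fromℕ (suc k)) x) ⟩
    expSum (x + fromℕ (suc k) * x) n
      ≤⟨ expSum-+-≤ 0≤x (*-nonneg (fromℕ-nonneg (suc k)) 0≤x) n ⟩
    expSum x n * expSum (fromℕ (suc k) * x) n
      ≤⟨ *-monoˡ-≤ (expSum-nonneg 0≤x n) (expSum-multiple 0≤x n k) ⟩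
    expSum x n * expSum x n ^ suc k ∎
    where open ≤-Reasoning

  0<2 : 0# < fromℕ 2
  0<2 = 0<fromℕ-suc 1

  -- Writing x as a multiple (2m + 2) t with t ≤ 1/2 reduces the bound to the geometric series.
  expSum-bounded : ∀ {x} → 0# ≤ x → ∃[ b ] (∀ n → expSum x n ≤ b)
  expSum-bounded {x} 0≤x with archimedean x
  ... | m , x≤m = fromℕ 2 ^ K , λ n → begin
      expSum x n               ≡⟨ cong (λ z → expSum z n) (trans (sym (/-cancel 0<K x)) (*-comm t _)) ⟩
      expSum (fromℕ K * t) n   ≤⟨ expSum-multiple 0≤t n k ⟩
      expSum t n ^ K           ≤⟨ ^-mono-≤ (expSum-nonneg 0≤t n) (expSum-t≤2 n) K ⟩
      fromℕ 2 ^ K              ∎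
    where
    open ≤-Reasoning
    -- `suc k` is definitionally `2 ℕ.* suc m`, as `fromℕ-*` expects below.
    k = m ℕ.+ suc (m ℕ.+ 0)
    K = suc k
    0<K : 0# < fromℕ K
    0<K = 0<fromℕ-suc k
    t = x / fromℕ K
    0≤t : 0# ≤ t
    0≤t = /-nonneg 0≤x 0<K
    2t≤1 : fromℕ 2 * t ≤ 1#
    2t≤1 = *-cancelʳ-≤ (0<fromℕ-suc m) (begin
      fromℕ 2 * t * fromℕ (suc m)    ≡⟨ solve 3 (λ a t b → a :* t :* b := t :* (a :* b)) refl _ t _ ⟩
      t * (fromℕ 2 * fromℕ (suc m))  ≡⟨ cong (t *_) (fromℕ-* 2 (suc m)) ⟨
      t * fromℕ K                    ≡⟨ /-cancel 0<K x ⟩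
      x                              ≤⟨ x≤m ⟩
      fromℕ m                        ≤⟨ fromℕ-mono-≤ (ℕ.n≤1+n m) ⟩
      fromℕ (suc m)                  ≡⟨ *-identityˡ _ ⟨
      1# * fromℕ (suc m)             ∎)
    t≤1 : t ≤ 1#
    t≤1 = ≤-trans (≤-slack t 0≤t (solve 1 (λ t → κ 2 :* t := t :+ t) refl t)) 2t≤1
    expSum-t≤2 : ∀ n → expSum t n ≤ fromℕ 2
    expSum-t≤2 n = ≤-trans
      (≤-slack (expSum t n * (1# - fromℕ 2 * t)) (*-nonneg (expSum-nonneg 0≤t n) (x≤y⇒0≤y-x 2t≤1))
        (solve 2 (λ s t → κ 2 :* ((κ 1 :- t) :* s) := s :+ s :* (κ 1 :- κ 2 :* t)) refl _ t))
      (≤-trans (*-monoˡ-≤ (<⇒≤ 0<2) ([1-x]*expSum≤1 0≤t t≤1 n)) (≤-reflexive (*-identityʳ _)))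

  expPartialSum≡ : ∀ x n → expPartialSum x n ≡ expSum x n
  expPartialSum≡ x n = Σ-upTo (expTerm x) id n

  expSum≤expNonneg : ∀ {x} → 0# ≤ x → ∀ n → expSum x n ≤ expNonneg x
  expSum≤expNonneg {x} 0≤x n = sup-upper
    (λ { (k , refl) → ≤-trans (≤-reflexive (expPartialSum≡ x k)) (proj₂ (expSum-bounded 0≤x) k) })
    (n , sym (expPartialSum≡ x n))

  expNonneg-least : ∀ {x b} → (∀ n → expSum x n ≤ b) → expNonneg x ≤ b
  expNonneg-least {x} bound = sup-least (_ , 0 , refl)
    (λ { (k , refl) → ≤-trans (≤-reflexive (expPartialSum≡ x k)) (bound k) })

  1+x≤expNonneg : ∀ {x} → 0# ≤ x → 1# + x ≤ expNonneg x
  1+x≤expNonneg {x} 0≤x = ≤-trans (≤-reflexive (sym (cong₂ _+_ (expTerm-zero x) expTerm-one)))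
    (expSum≤expNonneg 0≤x 2)
    where
    expTerm-one : expTerm x 1 + 0# ≡ x
    expTerm-one = trans (+-identityʳ _) (*-cancelˡ-≡ (0<fromℕ-suc 0) (trans (expTerm-suc x 0)
      (trans (cong (x *_) (expTerm-zero x))
        (solve 1 (λ x → x :* κ 1 := (κ 1 :+ κ 0) :* x) refl x))))

  1≤expNonneg : ∀ {x} → 0# ≤ x → 1# ≤ expNonneg x
  1≤expNonneg 0≤x = ≤-trans (x≤x+y 0≤x) (1+x≤expNonneg 0≤x)

  0<expNonneg : ∀ {x} → 0# ≤ x → 0# < expNonneg x
  0<expNonneg 0≤x = <-≤-trans 0<1 (1≤expNonneg 0≤x)

  -- For the lower bound the two suprema are taken in turn, each after division by the other factor.
  expNonneg-+ : ∀ {x y} → 0# ≤ x → 0# ≤ y → expNonneg (x + y) ≡ expNonneg x * expNonneg y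
  expNonneg-+ {x} {y} 0≤x 0≤y = ≤-antisym
    (expNonneg-least λ n → ≤-trans (expSum-+-≤ 0≤x 0≤y n)
      (*-mono-≤ (<⇒≤ (0<expNonneg 0≤x)) (expSum-nonneg 0≤y n) (expSum≤expNonneg 0≤x n) (expSum≤expNonneg 0≤y n)))
    (≤-trans (≤-reflexive (*-comm _ _)) (≤-trans
      (*-monoʳ-≤ (<⇒≤ (0<expNonneg 0≤x)) (expNonneg-least λ m → ≤/ (0<expNonneg 0≤x) (exp*sum m)))
      (≤-reflexive (/-cancel (0<expNonneg 0≤x) _))))
    where
    E = expNonneg (x + y)
    -- Division needs a positive partial sum; a nonpositive one, such as the empty sum, is treated
    -- apart.
    exp*sum : ∀ m → expSum y m * expNonneg x ≤ E
    exp*sum m with expSum y m ≤? 0#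
    ... | yes s≤0 = ≤-trans (*-monoʳ-≤ (<⇒≤ (0<expNonneg 0≤x)) s≤0)
                      (≤-trans (≤-reflexive (zeroˡ _)) (<⇒≤ (0<expNonneg (+-nonneg 0≤x 0≤y))))
    ... | no s≰0 = ≤-trans
                     (*-monoˡ-≤ (expSum-nonneg 0≤y m) (expNonneg-least λ n → ≤/ (≰⇒> s≰0)
                       (≤-trans (≤-expSum-+ 0≤x 0≤y n m) (expSum≤expNonneg (+-nonneg 0≤x 0≤y) (n ℕ.+ m)))))
                     (≤-reflexive (trans (*-comm _ _) (/-cancel (≰⇒> s≰0) E)))

  exp-of-nonneg : ∀ {x} → 0# ≤ x → exp x ≡ expNonneg x
  exp-of-nonneg {x} 0≤x with 0# ≤? x
  ... | yes _   = refl
  ... | no  0≰x = ⊥-elim (0≰x 0≤x)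

  ¬0≤x⇒0≤-x : ∀ {x} → ¬ 0# ≤ x → 0# ≤ - x
  ¬0≤x⇒0≤-x {x} 0≰x = ≤-slack (0# - x) (x≤y⇒0≤y-x (<⇒≤ (≰⇒> 0≰x)))
    (solve 1 (λ x → :- x := κ 0 :+ (κ 0 :- x)) refl x)

  -- Multiplying by `expNonneg a` with `a` large moves the argument to the nonnegative side, where
  -- `exp` has a single formula. This spares `exp-+` a case analysis on three signs.
  exp-shift : ∀ {x a} → 0# ≤ a → 0# ≤ x + a → exp x * expNonneg a ≡ expNonneg (x + a)
  exp-shift {x} {a} 0≤a 0≤x+a with 0# ≤? x
  ... | yes 0≤x = sym (expNonneg-+ 0≤x 0≤a)
  ... | no  0≰x = *-cancelˡ-≡ (0<expNonneg 0≤-x) (begin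
      e (- x) * (e (- x) ⁻¹ * e a)   ≡⟨ *-assoc _ _ _ ⟨
      e (- x) * e (- x) ⁻¹ * e a     ≡⟨ cong (_* e a) (x*x⁻¹ (0<expNonneg 0≤-x)) ⟩
      1# * e a                       ≡⟨ *-identityˡ _ ⟩
      e a                            ≡⟨ cong e (solve 2 (λ x a → a := :- x :+ (x :+ a)) refl x a) ⟩
      e (- x + (x + a))              ≡⟨ expNonneg-+ 0≤-x 0≤x+a ⟩
      e (- x) * e (x + a)            ∎)
    where
    open ≡-Reasoning
    e = expNonneg
    0≤-x = ¬0≤x⇒0≤-x 0≰x

  shift : ∀ x → ∃[ a ] (0# ≤ a × 0# ≤ x + a)
  shift x with 0# ≤? x
  ... | yes 0≤x = 0# , ≤-refl , subst (0# ≤_) (sym (+-identityʳ x)) 0≤x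
  ... | no  0≰x = - x , ¬0≤x⇒0≤-x 0≰x , ≤-reflexive (sym (-‿inverseʳ x))

  exp-+ : ∀ x y → exp (x + y) ≡ exp x * exp y
  exp-+ x y with shift x | shift y
  ... | a , 0≤a , 0≤x+a | b , 0≤b , 0≤y+b = *-cancelˡ-≡ (0<expNonneg (+-nonneg 0≤a 0≤b)) (begin
      e (a + b) * exp (x + y)          ≡⟨ *-comm _ _ ⟩
      exp (x + y) * e (a + b)          ≡⟨ exp-shift (+-nonneg 0≤a 0≤b)
          (subst (0# ≤_) (sym regroup) (+-nonneg 0≤x+a 0≤y+b)) ⟩
      e (x + y + (a + b))              ≡⟨ cong e regroup ⟩
      e ((x + a) + (y + b))            ≡⟨ expNonneg-+ 0≤x+a 0≤y+b ⟩
      e (x + a) * e (y + b)            ≡⟨ cong₂ _*_ (exp-shift 0≤a 0≤x+a) (exp-shift 0≤b 0≤y+b) ⟨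
      exp x * e a * (exp y * e b)      ≡⟨ solve 4 (λ p q r s → p :* q :* (r :* s) := q :* s :* (p :* r)) refl _ _ _ _ ⟩
      e a * e b * (exp x * exp y)      ≡⟨ cong (_* (exp x * exp y)) (expNonneg-+ 0≤a 0≤b) ⟨
      e (a + b) * (exp x * exp y)      ∎)
    where
    open ≡-Reasoning
    e = expNonneg
    regroup : x + y + (a + b) ≡ (x + a) + (y + b)
    regroup = solve 4 (λ x y a b → x :+ y :+ (a :+ b) := (x :+ a) :+ (y :+ b)) refl x y a b

  0<exp : ∀ x → 0# < exp x
  0<exp x with 0# ≤? x
  ... | yes 0≤x = 0<expNonneg 0≤x
  ... | no  0≰x = ⁻¹-pos (0<expNonneg (¬0≤x⇒0≤-x 0≰x))

  exp-nonneg : ∀ x → 0# ≤ exp x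
  exp-nonneg x = <⇒≤ (0<exp x)

  exp-0 : exp 0# ≡ 1#
  exp-0 = *-cancelˡ-≡ (0<exp 0#) (trans (sym (exp-+ 0# 0#))
    (trans (cong exp (+-identityˡ 0#)) (sym (*-identityʳ _))))

  exp-inverse : ∀ x → exp x * exp (- x) ≡ 1#
  exp-inverse x = trans (sym (exp-+ x (- x))) (trans (cong exp (-‿inverseʳ x)) exp-0)

  [1-x]*exp≤1 : ∀ {x} → 0# ≤ x → x < 1# → (1# - x) * exp x ≤ 1#
  [1-x]*exp≤1 {x} 0≤x x<1 = subst (λ z → (1# - x) * z ≤ 1#) (sym (exp-of-nonneg 0≤x))
    (≤-trans (*-monoˡ-≤ (<⇒≤ 0<1-x) (expNonneg-least λ n → ≤/ 0<1-x
      (≤-trans (≤-reflexive (*-comm _ _)) ([1-x]*expSum≤1 0≤x (<⇒≤ x<1) n))))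
      (≤-reflexive (trans (*-comm _ _) (/-cancel 0<1-x 1#))))
    where
    0<1-x : 0# < 1# - x
    0<1-x = x≤y⇒0≤y-x (<⇒≤ x<1) , λ 0≡1-x → <⇒≢ x<1
      (trans (sym (+-identityˡ x)) (trans (cong (_+ x) 0≡1-x) (solve 1 (λ x → (κ 1 :- x) :+ x := κ 1) refl x)))

  -- For -1 < x ≤ 0 this is the geometric bound on `exp (- x)` turned upside down; for x ≤ -1 the
  -- left side is not positive.
  1+x≤exp : ∀ x → 1# + x ≤ exp x
  1+x≤exp x with total 0# x
  ... | inj₁ 0≤x = subst (1# + x ≤_) (sym (exp-of-nonneg 0≤x)) (1+x≤expNonneg 0≤x)
  ... | inj₂ x≤0 with 1# + x ≤? 0#
  ...   | yes 1+x≤0 = ≤-trans 1+x≤0 (exp-nonneg x)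
  ...   | no  1+x≰0 = *-cancelʳ-≤ (0<exp (- x)) (begin
      (1# + x) * exp (- x)     ≡⟨ cong (_* exp (- x)) (solve 1 (λ x → κ 1 :+ x := κ 1 :- (:- x)) refl x) ⟩
      (1# - - x) * exp (- x)   ≤⟨ [1-x]*exp≤1 0≤-x -x<1 ⟩
      1#                       ≡⟨ exp-inverse x ⟨
      exp x * exp (- x)        ∎)
    where
    open ≤-Reasoning
    0≤-x : 0# ≤ - x
    0≤-x = ≤-slack (0# - x) (x≤y⇒0≤y-x x≤0) (solve 1 (λ x → :- x := κ 0 :+ (κ 0 :- x)) refl x)
    -x<1 : - x < 1#
    -x<1 = ≰⇒> λ 1≤-x → 1+x≰0 (≤-slack (- x - 1#) (x≤y⇒0≤y-x 1≤-x)
      (solve 1 (λ x → κ 0 := (κ 1 :+ x) :+ (:- x :- κ 1)) refl x))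

  1≤exp : ∀ {x} → 0# ≤ x → 1# ≤ exp x
  1≤exp {x} 0≤x = ≤-trans (x≤x+y 0≤x) (1+x≤exp x)

  exp-split : ∀ x y → exp y ≡ exp x * exp (y - x)
  exp-split x y = trans (cong exp (solve 2 (λ x y → y := x :+ (y :- x)) refl x y)) (exp-+ x (y - x))

  exp-mono-≤ : ∀ {x y} → x ≤ y → exp x ≤ exp y
  exp-mono-≤ {x} {y} x≤y = subst₂ _≤_ (*-identityʳ _) (sym (exp-split x y))
    (*-monoˡ-≤ (exp-nonneg x) (1≤exp (x≤y⇒0≤y-x x≤y)))

  exp-injective : ∀ {x y} → exp x ≡ exp y → x ≡ y
  exp-injective eq = ≤-antisym (half eq) (half (sym eq))
    where
    half : ∀ {x y} → exp x ≡ exp y → x ≤ y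
    half {x} {y} eq = +-cancelʳ-≤ (1# - y) (begin
      x + (1# - y)     ≡⟨ solve 2 (λ x y → x :+ (κ 1 :- y) := κ 1 :+ (x :- y)) refl x y ⟩
      1# + (x - y)     ≤⟨ 1+x≤exp (x - y) ⟩
      exp (x - y)      ≡⟨ *-cancelˡ-≡ (0<exp y) (trans (sym (exp-split y x)) (trans eq (sym (*-identityʳ _)))) ⟩
      1#               ≡⟨ solve 1 (λ y → κ 1 := y :+ (κ 1 :- y)) refl y ⟩
      y + (1# - y)     ∎)
      where open ≤-Reasoning

  exp-cancel-≤ : ∀ {x y} → exp x ≤ exp y → x ≤ y
  exp-cancel-≤ {x} {y} h with x ≤? y
  ... | yes x≤y = x≤y
  ... | no  x≰y = ≤-reflexive (exp-injective (≤-antisym h (exp-mono-≤ (<⇒≤ (≰⇒> x≰y)))))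

  exp-multiple : ∀ n x → exp (fromℕ n * x) ≡ exp x ^ n
  exp-multiple zero    x = trans (cong exp (zeroˡ x)) exp-0
  exp-multiple (suc n) x = trans
    (cong exp (solve 2 (λ a x → (κ 1 :+ a) :* x := x :+ a :* x) refl (fromℕ n) x))
    (trans (exp-+ x (fromℕ n * x)) (cong (exp x *_) (exp-multiple n x)))

  private
    -- A substitute for continuity of `exp`: with t = 1 - a/b one has a/b = 1 - t ≤ exp (-t).
    exp-gap : ∀ {a b} → 0# < a → a < b → ∃[ t ] (0# < t × a * exp t ≤ b)
    exp-gap {a} {b} 0<a a<b = 1# - a / b , 0<t , (begin
        a * exp t                    ≡⟨ cong (_* exp t) (/-cancel 0<b a) ⟨
        a / b * b * exp t            ≡⟨ solve 3 (λ q b e → q :* b :* e := b :* (q :* e)) refl _ b _ ⟩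
        b * (a / b * exp t)          ≤⟨ *-monoˡ-≤ (<⇒≤ 0<b) (*-monoʳ-≤ (exp-nonneg t) q≤exp) ⟩
        b * (exp (- t) * exp t)      ≡⟨ cong (b *_) (trans (*-comm _ _) (exp-inverse t)) ⟩
        b * 1#                       ≡⟨ *-identityʳ b ⟩
        b                            ∎)
      where
      open ≤-Reasoning
      0<b = ≤-<-trans (<⇒≤ 0<a) a<b
      t = 1# - a / b
      q≤exp : a / b ≤ exp (- t)
      q≤exp = ≤-trans (≤-reflexive (solve 1 (λ q → q := κ 1 :+ :- (κ 1 :- q)) refl (a / b)))
                (1+x≤exp (- t))
      0<t : 0# < t
      0<t = ≰⇒> λ t≤0 → <⇒≱ a<b (begin
        b             ≡⟨ *-identityˡ b ⟨
        1# * b        ≤⟨ *-monoʳ-≤ (<⇒≤ 0<b) (≤-slack (0# - t) (x≤y⇒0≤y-x t≤0)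
                           (solve 1 (λ q → q := κ 1 :+ (κ 0 :- (κ 1 :- q))) refl (a / b))) ⟩
        a / b * b     ≡⟨ /-cancel 0<b a ⟩
        a             ∎)

    x+t≰x : ∀ {x t} → 0# < t → ¬ x + t ≤ x
    x+t≰x {x} {t} 0<t h = <⇒≱ 0<t (+-cancelʳ-≤ x (subst₂ _≤_ (+-comm x t) (sym (+-identityˡ x)) h))

  -- By `exp-gap`, a supremum whose exponential is too small could be raised within the set, and one
  -- whose exponential is too large could be replaced by a smaller upper bound.
  exp-log : ∀ {x} → 0# < x → exp (log x) ≡ x
  exp-log {x} 0<x = ≤-antisym (≮⇒≥ above) (≮⇒≥ below)
    where
    Below : ℝ → Set
    Below y = exp y ≤ x

    bounded : x UpperBoundOf Below
    bounded {y} h = ≤-trans (≤-trans (x≤y+x 0≤1) (1+x≤exp y)) h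

    -- A witness that the set is nonempty: exp (1/x) ≥ 1/x, hence exp (-1/x) ≤ x.
    low : ℝ
    low = - (x ⁻¹)

    low-in : exp low ≤ x
    low-in = begin
      exp low                   ≡⟨ *-identityˡ _ ⟨
      1# * exp low              ≡⟨ cong (_* exp low) (x*x⁻¹ 0<x) ⟨
      x * x ⁻¹ * exp low        ≡⟨ *-assoc _ _ _ ⟩
      x * (x ⁻¹ * exp low)      ≤⟨ *-monoˡ-≤ (<⇒≤ 0<x) (*-monoʳ-≤ (exp-nonneg low)
                                     (≤-trans (x≤y+x 0≤1) (1+x≤exp (x ⁻¹)))) ⟩
      x * (exp (x ⁻¹) * exp low) ≡⟨ cong (x *_) (exp-inverse (x ⁻¹)) ⟩
      x * 1#                    ≡⟨ *-identityʳ x ⟩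
      x                         ∎
      where open ≤-Reasoning

    upper : ∀ y → exp y ≤ x → y ≤ log x
    upper y = sup-upper {P = Below} {b = x} (λ {z} → bounded {z}) {y}

    least : ∀ b → (∀ y → exp y ≤ x → y ≤ b) → log x ≤ b
    least b h = sup-least {P = Below} {b = b} (low , low-in) (λ {y} → h y)

    below : ¬ exp (log x) < x
    below lt = let (t , 0<t , h) = exp-gap (0<exp (log x)) lt in
      x+t≰x {log x} {t} 0<t (upper (log x + t) (subst (_≤ x) (sym (exp-+ (log x) t)) h))

    above : ¬ x < exp (log x)
    above lt = let (t , 0<t , h) = exp-gap 0<x lt in step-back t 0<t h
      where
      open ≤-Reasoning
      step-back : ∀ t → 0# < t → x * exp t ≤ exp (log x) → ⊥
      step-back t 0<t h = x+t≰x {log x - t} 0<t (subst (_≤ log x - t)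
        (solve 2 (λ s t → s := (s :- t) :+ t) refl (log x) t)
        (least (log x - t) λ y ey≤x → +-cancelʳ-≤ t (exp-cancel-≤ {y + t} {log x - t + t} (begin
          exp (y + t)         ≡⟨ exp-+ y t ⟩
          exp y * exp t       ≤⟨ *-monoʳ-≤ (exp-nonneg t) ey≤x ⟩
          x * exp t           ≤⟨ h ⟩
          exp (log x)         ≡⟨ cong exp (solve 2 (λ s t → s := (s :- t) :+ t) refl (log x) t) ⟩
          exp (log x - t + t) ∎))))

  root-of-^ : ∀ k {r} → 0# ≤ r → root (suc k) (r ^ suc k) ≡ r
  root-of-^ k {r} 0≤r = ≤-antisym (sup-least (r , ≤-refl) (λ {y} → bounded {y}))
                                  (sup-upper {b = r} (λ {y} → bounded {y}) ≤-refl)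
    where
    bounded : ∀ {y} → y ^ suc k ≤ r ^ suc k → y ≤ r
    bounded = ^-cancel-≤ k 0≤r

  -- The root is exhibited as exp (log x / k), and `root-of-^` evaluates the supremum, so
  -- completeness enters only through the logarithm.
  root-pos : ∀ k {x} → 0# < x → 0# < root (suc k) x × root (suc k) x ^ suc k ≡ x
  root-pos k {x} 0<x = subst (0# <_) (sym root≡r) (0<exp _) , trans (cong (_^ suc k) root≡r) r^≡x
    where
    r = exp (log x / fromℕ (suc k))
    r^≡x : r ^ suc k ≡ x
    r^≡x = trans (sym (exp-multiple (suc k) _)) (trans (cong exp
      (trans (*-comm _ _) (/-cancel (0<fromℕ-suc k) (log x)))) (exp-log 0<x))
    root≡r : root (suc k) x ≡ r
    root≡r = trans (cong (root (suc k)) (sym r^≡x)) (root-of-^ k (exp-nonneg _))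

-- Finite sums, indicators and sums over enumerated types.

module Sums (R : Reals) where
  open Reals R
  open OrderedField R

  ∑ : ∀ {a} {A : Set a} → List A → (A → ℝ) → ℝ
  ∑ xs f = Σ[ map f xs ]

  module _ {a} {A : Set a} where

    ∑-cong : ∀ {f g : A → ℝ} → (∀ x → f x ≡ g x) → ∀ xs → ∑ xs f ≡ ∑ xs g
    ∑-cong eq []       = refl
    ∑-cong eq (x ∷ xs) = cong₂ _+_ (eq x) (∑-cong eq xs)

    ∑-mono : ∀ {f g : A → ℝ} → (∀ x → f x ≤ g x) → ∀ xs → ∑ xs f ≤ ∑ xs g
    ∑-mono le []       = ≤-refl
    ∑-mono le (x ∷ xs) = +-mono-≤ (le x) (∑-mono le xs)

    ∑-mono-All : ∀ {f g : A → ℝ} {xs} → All (λ x → f x ≤ g x) xs → ∑ xs f ≤ ∑ xs g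
    ∑-mono-All []         = ≤-refl
    ∑-mono-All (le ∷ les) = +-mono-≤ le (∑-mono-All les)

    ∑-zero : ∀ (xs : List A) → ∑ xs (λ _ → 0#) ≡ 0#
    ∑-zero []       = refl
    ∑-zero (x ∷ xs) = trans (+-identityˡ _) (∑-zero xs)

    ∑-nonneg : ∀ {f : A → ℝ} → (∀ x → 0# ≤ f x) → ∀ xs → 0# ≤ ∑ xs f
    ∑-nonneg f≥0 []       = ≤-refl
    ∑-nonneg f≥0 (x ∷ xs) = +-nonneg (f≥0 x) (∑-nonneg f≥0 xs)

    ∑-+ : ∀ (f g : A → ℝ) xs → ∑ xs (λ x → f x + g x) ≡ ∑ xs f + ∑ xs g
    ∑-+ f g []       = sym (+-identityˡ 0#)
    ∑-+ f g (x ∷ xs) = trans (cong (f x + g x +_) (∑-+ f g xs))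
      (solve 4 (λ a b c d → (a :+ b) :+ (c :+ d) := (a :+ c) :+ (b :+ d)) refl (f x) (g x) (∑ xs f) (∑ xs g))

    ∑-*ˡ : ∀ c (f : A → ℝ) xs → ∑ xs (λ x → c * f x) ≡ c * ∑ xs f
    ∑-*ˡ c f []       = sym (zeroʳ c)
    ∑-*ˡ c f (x ∷ xs) = trans (cong (c * f x +_) (∑-*ˡ c f xs)) (sym (distribˡ c _ _))

    ∑-*ʳ : ∀ c (f : A → ℝ) xs → ∑ xs (λ x → f x * c) ≡ ∑ xs f * c
    ∑-*ʳ c f xs = trans (∑-cong (λ x → *-comm (f x) c) xs) (trans (∑-*ˡ c f xs) (*-comm c _))

    ∑-const : ∀ c (xs : List A) → ∑ xs (λ _ → c) ≡ fromℕ (length xs) * c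
    ∑-const c []       = sym (zeroˡ c)
    ∑-const c (x ∷ xs) = trans (cong (c +_) (∑-const c xs))
      (solve 2 (λ c n → c :+ n :* c := (κ 1 :+ n) :* c) refl c (fromℕ (length xs)))

    ∑-1 : ∀ (xs : List A) → ∑ xs (λ _ → 1#) ≡ fromℕ (length xs)
    ∑-1 xs = trans (∑-const 1# xs) (*-identityʳ _)

    ∑-++ : ∀ (f : A → ℝ) xs ys → ∑ (xs ++ ys) f ≡ ∑ xs f + ∑ ys f
    ∑-++ f []       ys = sym (+-identityˡ _)
    ∑-++ f (x ∷ xs) ys = trans (cong (f x +_) (∑-++ f xs ys)) (sym (+-assoc _ _ _))

    ∑-sublist : ∀ {f : A → ℝ} → (∀ x → 0# ≤ f x) → ∀ {xs ys} → xs ⊆ ys → ∑ xs f ≤ ∑ ys f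
    ∑-sublist f≥0 []            = ≤-refl
    ∑-sublist f≥0 (y ∷ʳ xs⊆ys)  = ≤-trans (∑-sublist f≥0 xs⊆ys) (x≤y+x (f≥0 y))
    ∑-sublist f≥0 (refl ∷ xs⊆ys) = +-monoʳ-≤ _ (∑-sublist f≥0 xs⊆ys)

    ∑-map : ∀ {b} {B : Set b} (f : A → ℝ) (g : B → A) xs → ∑ (map g xs) f ≡ ∑ xs (f ∘ g)
    ∑-map f g xs = cong Σ[_] (sym (List.map-∘ xs))

    ∑-swap : ∀ {b} {B : Set b} (f : A → B → ℝ) xs ys → ∑ xs (λ x → ∑ ys (f x)) ≡ ∑ ys (λ y → ∑ xs (λ x → f x y))
    ∑-swap f []       ys = sym (zeros ys)
      where
      zeros : ∀ ys → ∑ ys (λ _ → 0#) ≡ 0#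
      zeros []       = refl
      zeros (y ∷ ys) = trans (+-identityˡ _) (zeros ys)
    ∑-swap {B = B} f (x ∷ xs) ys = trans (cong (∑ ys (f x) +_) (∑-swap f xs ys)) (sym (add ys))
      where
      g : B → ℝ
      g y = ∑ xs (λ x → f x y)
      add : ∀ ys → ∑ ys (λ y → f x y + g y) ≡ ∑ ys (f x) + ∑ ys g
      add []       = sym (+-identityˡ 0#)
      add (y ∷ ys) = trans (cong (f x y + g y +_) (add ys))
        (solve 4 (λ a b c d → (a :+ b) :+ (c :+ d) := (a :+ c) :+ (b :+ d)) refl (f x y) (g y) (∑ ys (f x)) (∑ ys g))

  𝟙 : ∀ {a} {P : Set a} → Dec P → ℝ
  𝟙 P? = if does P? then 1# else 0#

  module _ {a} {P : Set a} where

    𝟙-yes : (P? : Dec P) → P → 𝟙 P? ≡ 1#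
    𝟙-yes (yes _) p = refl
    𝟙-yes (no ¬p) p = ⊥-elim (¬p p)

    𝟙-no : (P? : Dec P) → ¬ P → 𝟙 P? ≡ 0#
    𝟙-no (yes p) ¬p = ⊥-elim (¬p p)
    𝟙-no (no _)  ¬p = refl

    𝟙-nonneg : (P? : Dec P) → 0# ≤ 𝟙 P?
    𝟙-nonneg (yes _) = 0≤1
    𝟙-nonneg (no _)  = ≤-refl

    𝟙≤1 : (P? : Dec P) → 𝟙 P? ≤ 1#
    𝟙≤1 (yes _) = ≤-refl
    𝟙≤1 (no _)  = 0≤1

    𝟙-≤ : (P? : Dec P) → ∀ {x} → 0# ≤ x → (P → 1# ≤ x) → 𝟙 P? ≤ x
    𝟙-≤ (yes p) 0≤x h = h p
    𝟙-≤ (no _)  0≤x h = 0≤x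

    𝟙*-≤ : (P? : Dec P) → ∀ {x y} → 0# ≤ y → (P → x ≤ y) → 𝟙 P? * x ≤ y
    𝟙*-≤ (yes p) 0≤y h = ≤-trans (≤-reflexive (*-identityˡ _)) (h p)
    𝟙*-≤ (no _)  0≤y h = ≤-trans (≤-reflexive (zeroˡ _)) 0≤y

    𝟙*-cong : (P? : Dec P) → ∀ {x y} → (P → x ≡ y) → 𝟙 P? * x ≡ 𝟙 P? * y
    𝟙*-cong (yes p) h = cong (1# *_) (h p)
    𝟙*-cong (no _)  h = trans (zeroˡ _) (sym (zeroˡ _))

  module _ {a b} {P : Set a} {Q : Set b} where

    𝟙-mono : (P? : Dec P) (Q? : Dec Q) → (P → Q) → 𝟙 P? ≤ 𝟙 Q?
    𝟙-mono P? Q? P⇒Q = 𝟙-≤ P? (𝟙-nonneg Q?) (λ p → ≤-reflexive (sym (𝟙-yes Q? (P⇒Q p))))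

    𝟙-cong : (P? : Dec P) (Q? : Dec Q) → (P → Q) → (Q → P) → 𝟙 P? ≡ 𝟙 Q?
    𝟙-cong (yes p) Q? P⇒Q Q⇒P = sym (𝟙-yes Q? (P⇒Q p))
    𝟙-cong (no ¬p) Q? P⇒Q Q⇒P = sym (𝟙-no Q? (¬p ∘ Q⇒P))

  fromℕ-filter : ∀ {a p} {A : Set a} {P : Pred A p} (P? : Decidable P) xs →
                 fromℕ (length (filter P? xs)) ≡ ∑ xs (𝟙 ∘ P?)
  fromℕ-filter P? []       = refl
  fromℕ-filter P? (x ∷ xs) with P? x
  ... | yes _ = cong (1# +_) (fromℕ-filter P? xs)
  ... | no  _ = trans (fromℕ-filter P? xs) (sym (+-identityˡ _))

  ∑-filter : ∀ {a p} {A : Set a} {P : Pred A p} (P? : Decidable P) (f : A → ℝ) xs →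
             ∑ (filter P? xs) f ≡ ∑ xs (λ x → 𝟙 (P? x) * f x)
  ∑-filter P? f []       = refl
  ∑-filter P? f (x ∷ xs) with P? x
  ... | yes _ = cong₂ _+_ (sym (*-identityˡ _)) (∑-filter P? f xs)
  ... | no  _ = trans (∑-filter P? f xs) (sym (trans (cong (_+ ∑ xs (λ x → 𝟙 (P? x) * f x)) (zeroˡ (f x)))
      (+-identityˡ _)))

  -- `∑-point` says that every element is listed exactly once, in the form in which sums consume it:
  -- as a delta function.
  record Enumeration (A : Set) : Set where
    infix 4 _≟ᵉ_
    field
      elements : List A
      _≟ᵉ_     : DecidableEquality A
      ∑-point  : ∀ a f → ∑ elements (λ x → 𝟙 (x ≟ᵉ a) * f x) ≡ f a

    size : ℝ
    size = fromℕ (length elements)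

    ∑-𝟙≡ : ∀ a → ∑ elements (λ x → 𝟙 (x ≟ᵉ a)) ≡ 1#
    ∑-𝟙≡ a = trans (∑-cong (λ x → sym (*-identityʳ _)) elements) (∑-point a (λ _ → 1#))

    ∑-𝟙≤1 : ∀ {p} {P : Pred A p} (P? : Decidable P) a → (∀ {x} → P x → x ≡ a) →
            ∑ elements (𝟙 ∘ P?) ≤ 1#
    ∑-𝟙≤1 P? a unique = ≤-trans (∑-mono (λ x → 𝟙-mono (P? x) (x ≟ᵉ a) unique) elements) (≤-reflexive (∑-𝟙≡ a))

    -- No element of `P` is at hand, so the count c is compared with its square: any x in `P` gives
    -- c ≤ 1 by `∑-𝟙≤1`, whence c² ≤ c.
    ∑-𝟙-unique : ∀ {p} {P : Pred A p} (P? : Decidable P) → (∀ {x y} → P x → P y → x ≡ y) →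
                 ∑ elements (𝟙 ∘ P?) ≤ 1#
    ∑-𝟙-unique P? unique with ∑ elements (𝟙 ∘ P?) ≤? 1#
    ... | yes c≤1 = c≤1
    ... | no  c≰1 = *-cancelˡ-≤ (≤-<-trans 0≤1 (≰⇒> c≰1)) (begin
      c * c
        ≡⟨ ∑-*ʳ c (𝟙 ∘ P?) elements ⟨
      ∑ elements (λ x → 𝟙 (P? x) * c)
        ≤⟨ ∑-mono (λ x → 𝟙*-≤ (P? x) (𝟙-nonneg (P? x)) λ px → ≤-trans
             (∑-𝟙≤1 P? x (λ py → unique py px)) (≤-reflexive (sym (𝟙-yes (P? x) px)))) elements ⟩
      c
        ≡⟨ *-identityʳ c ⟨
      c * 1# ∎)
      where
      open ≤-Reasoning
      c = ∑ elements (𝟙 ∘ P?)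

    term≤∑ : ∀ {f} → (∀ x → 0# ≤ f x) → ∀ a → f a ≤ ∑ elements f
    term≤∑ {f} f≥0 a = ≤-trans (≤-reflexive (sym (∑-point a f)))
      (∑-mono (λ x → 𝟙*-≤ (x ≟ᵉ a) (f≥0 x) (λ _ → ≤-refl)) elements)

    -- Both sides are the sum of `f y` over the graph of `σ`, read by rows and by columns.
    ∑-reindex : ∀ (σ τ : A → A) → (∀ x → σ (τ x) ≡ x) → (∀ x → τ (σ x) ≡ x) →
                ∀ f → ∑ elements (f ∘ σ) ≡ ∑ elements f
    ∑-reindex σ τ στ τσ f = begin
      ∑ elements (f ∘ σ)
        ≡⟨ ∑-cong (λ x → sym (∑-point (σ x) f)) elements ⟩
      ∑ elements (λ x → ∑ elements (λ y → 𝟙 (y ≟ᵉ σ x) * f y))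
        ≡⟨ ∑-swap (λ x y → 𝟙 (y ≟ᵉ σ x) * f y) elements elements ⟩
      ∑ elements (λ y → ∑ elements (λ x → 𝟙 (y ≟ᵉ σ x) * f y))
        ≡⟨ ∑-cong (λ y → trans (∑-cong (λ x → cong (_* f y) (𝟙-cong (y ≟ᵉ σ x) (x ≟ᵉ τ y)
             (λ { refl → sym (τσ x) }) (λ { refl → sym (στ y) }))) elements)
             (∑-point (τ y) (λ _ → f y))) elements ⟩
      ∑ elements f ∎
      where open ≡-Reasoning

  open Enumeration

  ∑-allFin : ∀ {n} (f : Fin (suc n) → ℝ) → ∑ (allFin (suc n)) f ≡ f zero + ∑ (allFin n) (f ∘ suc)
  ∑-allFin {n} f = cong (λ l → f zero + Σ[ l ])
    (trans (List.map-tabulate suc f) (sym (List.map-tabulate id (f ∘ suc))))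

  Fin-enumeration : ∀ n → Enumeration (Fin n)
  Fin-enumeration n = record { elements = allFin n ; _≟ᵉ_ = Fin._≟_ ; ∑-point = point }
    where
    point : ∀ {n} (a : Fin n) (f : Fin n → ℝ) → ∑ (allFin n) (λ x → 𝟙 (x Fin.≟ a) * f x) ≡ f a
    point {suc n} zero f = begin
      ∑ (allFin (suc n)) (λ x → 𝟙 (x Fin.≟ zero) * f x)
        ≡⟨ ∑-allFin (λ x → 𝟙 (x Fin.≟ zero) * f x) ⟩
      1# * f zero + ∑ (allFin n) (λ x → 0# * f (suc x))
        ≡⟨ cong₂ _+_ (*-identityˡ _) (trans (∑-cong (λ x → zeroˡ _) (allFin n)) (∑-zero (allFin n))) ⟩
      f zero + 0#
        ≡⟨ +-identityʳ _ ⟩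
      f zero ∎
      where open ≡-Reasoning
    point {suc n} (suc a) f = begin
      ∑ (allFin (suc n)) (λ x → 𝟙 (x Fin.≟ suc a) * f x)
        ≡⟨ ∑-allFin (λ x → 𝟙 (x Fin.≟ suc a) * f x) ⟩
      0# * f zero + ∑ (allFin n) (λ x → 𝟙 (suc x Fin.≟ suc a) * f (suc x))
        ≡⟨ cong₂ _+_ (zeroˡ _) (trans (∑-cong (λ x → cong (_* f (suc x))
             (𝟙-cong (suc x Fin.≟ suc a) (x Fin.≟ a) Fin.suc-injective (cong suc))) (allFin n)) (point a (f ∘ suc))) ⟩
      0# + f (suc a)
        ≡⟨ +-identityˡ _ ⟩
      f (suc a) ∎
      where open ≡-Reasoning

  Fin-size : ∀ n → size (Fin-enumeration n) ≡ fromℕ n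
  Fin-size n = cong fromℕ (List.length-tabulate {n = n} id)

  Bool-enumeration : Enumeration Bool
  Bool-enumeration = record { elements = true ∷ false ∷ [] ; _≟ᵉ_ = Bool._≟_ ; ∑-point = point }
    where
    point : ∀ a f → ∑ (true ∷ false ∷ []) (λ x → 𝟙 (x Bool.≟ a) * f x) ≡ f a
    point true  f = solve 2 (λ x y → κ 1 :* x :+ (κ 0 :* y :+ κ 0) := x) refl (f true) (f false)
    point false f = solve 2 (λ x y → κ 0 :* x :+ (κ 1 :* y :+ κ 0) := y) refl (f true) (f false)

  ∑-cartesian : ∀ {A B C : Set} (h : A → B → C) (f : C → ℝ) xs ys →
                ∑ (cartesianProductWith h xs ys) f ≡ ∑ xs (λ x → ∑ ys (λ y → f (h x y)))
  ∑-cartesian h f []       ys = refl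
  ∑-cartesian h f (x ∷ xs) ys = trans (∑-++ f (map (h x) ys) (cartesianProductWith h xs ys))
    (cong₂ _+_ (∑-map f (h x) ys) (∑-cartesian h f xs ys))

  vecs : ∀ {A : Set} → List A → ∀ n → List (Vec A n)
  vecs xs zero    = [] ∷ []
  vecs xs (suc n) = cartesianProductWith _∷_ xs (vecs xs n)

  ∑-vecs : ∀ {A : Set} (xs : List A) n (f : Vec A (suc n) → ℝ) →
           ∑ (vecs xs (suc n)) f ≡ ∑ xs (λ x → ∑ (vecs xs n) (λ v → f (x ∷ v)))
  ∑-vecs xs n f = ∑-cartesian _∷_ f xs (vecs xs n)

  module Vectors {A : Set} (A-enum : Enumeration A) where
    private
      xs  = elements A-enum
      _≟ᴬ_ = _≟ᵉ_ A-enum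

    Vec-enumeration : ∀ n → Enumeration (Vec A n)
    Vec-enumeration n = record { elements = vecs xs n ; _≟ᵉ_ = Vec.≡-dec _≟ᴬ_ ; ∑-point = point }
      where
      point : ∀ {n} (a : Vec A n) f → ∑ (vecs xs n) (λ v → 𝟙 (Vec.≡-dec _≟ᴬ_ v a) * f v) ≡ f a
      point {zero}  []      f = trans (+-identityʳ _) (*-identityˡ _)
      point {suc n} (a ∷ v) f = begin
        ∑ (vecs xs (suc n)) (λ w → 𝟙 (Vec.≡-dec _≟ᴬ_ w (a ∷ v)) * f w)
          ≡⟨ ∑-vecs xs n (λ w → 𝟙 (Vec.≡-dec _≟ᴬ_ w (a ∷ v)) * f w) ⟩
        ∑ xs (λ x → ∑ (vecs xs n) (λ w → 𝟙 (Vec.≡-dec _≟ᴬ_ (x ∷ w) (a ∷ v)) * f (x ∷ w)))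
          ≡⟨ ∑-cong (λ x → trans (∑-cong (λ w → split x w) (vecs xs n)) (∑-*ˡ (𝟙 (x ≟ᴬ a)) _ (vecs xs n))) xs ⟩
        ∑ xs (λ x → 𝟙 (x ≟ᴬ a) * ∑ (vecs xs n) (λ w → 𝟙 (Vec.≡-dec _≟ᴬ_ w v) * f (x ∷ w)))
          ≡⟨ ∑-cong (λ x → cong (𝟙 (x ≟ᴬ a) *_) (point v (λ w → f (x ∷ w)))) xs ⟩
        ∑ xs (λ x → 𝟙 (x ≟ᴬ a) * f (x ∷ v))
          ≡⟨ ∑-point A-enum a (λ x → f (x ∷ v)) ⟩
        f (a ∷ v) ∎
        where
        open ≡-Reasoning
        split : ∀ x w → 𝟙 (Vec.≡-dec _≟ᴬ_ (x ∷ w) (a ∷ v)) * f (x ∷ w) ≡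
                        𝟙 (x ≟ᴬ a) * (𝟙 (Vec.≡-dec _≟ᴬ_ w v) * f (x ∷ w))
        split x w with x ≟ᴬ a
        ... | yes refl with Vec.≡-dec _≟ᴬ_ w v
        ...   | yes _ = sym (*-identityˡ _)
        ...   | no  _ = sym (*-identityˡ _)
        split x w | no _ = trans (zeroˡ _) (sym (zeroˡ _))

    Vec-size : ∀ n → size (Vec-enumeration n) ≡ size A-enum ^ n
    Vec-size zero    = +-identityʳ 1#
    Vec-size (suc n) = begin
      fromℕ (length (vecs xs (suc n)))             ≡⟨ ∑-1 (vecs xs (suc n)) ⟨
      ∑ (vecs xs (suc n)) (λ _ → 1#)               ≡⟨ ∑-vecs xs n (λ _ → 1#) ⟩
      ∑ xs (λ _ → ∑ (vecs xs n) (λ _ → 1#))        ≡⟨ ∑-const _ xs ⟩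
      size A-enum * ∑ (vecs xs n) (λ _ → 1#)       ≡⟨ cong (size A-enum *_) (trans (∑-1 (vecs xs n)) (Vec-size n)) ⟩
      size A-enum * size A-enum ^ n                ∎
      where open ≡-Reasoning

    -- Overwriting coordinate `i` reaches each vector from as many vectors as `A` has elements. A
    -- bound on every line in direction `i` thereby becomes a bound on the whole sum.
    ∑-update : ∀ {n} (i : Fin n) f →
               ∑ (vecs xs n) (λ v → ∑ xs (λ x → f (v [ i ]≔ x))) ≡ size A-enum * ∑ (vecs xs n) f
    ∑-update {suc n} zero f = begin
      ∑ (vecs xs (suc n)) (λ v → ∑ xs (λ x → f (v [ zero ]≔ x)))
        ≡⟨ ∑-vecs xs n _ ⟩
      ∑ xs (λ _ → ∑ (vecs xs n) (λ w → ∑ xs (λ x → f (x ∷ w))))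
        ≡⟨ ∑-const _ xs ⟩
      size A-enum * ∑ (vecs xs n) (λ w → ∑ xs (λ x → f (x ∷ w)))
        ≡⟨ cong (size A-enum *_) (∑-swap (λ w x → f (x ∷ w)) (vecs xs n) xs) ⟩
      size A-enum * ∑ xs (λ x → ∑ (vecs xs n) (λ w → f (x ∷ w)))
        ≡⟨ cong (size A-enum *_) (∑-vecs xs n f) ⟨
      size A-enum * ∑ (vecs xs (suc n)) f ∎
      where open ≡-Reasoning
    ∑-update {suc n} (suc i) f = begin
      ∑ (vecs xs (suc n)) (λ v → ∑ xs (λ x → f (v [ suc i ]≔ x)))
        ≡⟨ ∑-vecs xs n _ ⟩
      ∑ xs (λ y → ∑ (vecs xs n) (λ w → ∑ xs (λ x → f (y ∷ (w [ i ]≔ x)))))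
        ≡⟨ ∑-cong (λ y → ∑-update i (f ∘ (y ∷_))) xs ⟩
      ∑ xs (λ y → size A-enum * ∑ (vecs xs n) (λ w → f (y ∷ w)))
        ≡⟨ ∑-*ˡ (size A-enum) _ xs ⟩
      size A-enum * ∑ xs (λ y → ∑ (vecs xs n) (λ w → f (y ∷ w)))
        ≡⟨ cong (size A-enum *_) (∑-vecs xs n f) ⟨
      size A-enum * ∑ (vecs xs (suc n)) f ∎
      where open ≡-Reasoning

    ∏ : ∀ {n} → Vec (A → ℝ) n → Vec A n → ℝ
    ∏ []       []      = 1#
    ∏ (f ∷ fs) (x ∷ v) = f x * ∏ fs v

    ∏-nonneg : ∀ {n} (fs : Vec (A → ℝ) n) → (∀ i x → 0# ≤ lookup fs i x) → ∀ v → 0# ≤ ∏ fs v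
    ∏-nonneg []       fs≥0 []      = 0≤1
    ∏-nonneg (f ∷ fs) fs≥0 (x ∷ v) = *-nonneg (fs≥0 zero x) (∏-nonneg fs (fs≥0 ∘ suc) v)

    totals : ∀ {n} → Vec (A → ℝ) n → ℝ
    totals []       = 1#
    totals (f ∷ fs) = ∑ xs f * totals fs

    ∑-∏ : ∀ {n} (fs : Vec (A → ℝ) n) → ∑ (vecs xs n) (∏ fs) ≡ totals fs
    ∑-∏ []              = +-identityʳ 1#
    ∑-∏ {suc n} (f ∷ fs) = begin
      ∑ (vecs xs (suc n)) (∏ (f ∷ fs))
        ≡⟨ ∑-vecs xs n _ ⟩
      ∑ xs (λ x → ∑ (vecs xs n) (λ v → f x * ∏ fs v))
        ≡⟨ ∑-cong (λ x → trans (∑-*ˡ (f x) (∏ fs) (vecs xs n)) (cong (f x *_) (∑-∏ fs))) xs ⟩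
      ∑ xs (λ x → f x * totals fs)
        ≡⟨ ∑-*ʳ (totals fs) f xs ⟩
      ∑ xs f * totals fs ∎
      where open ≡-Reasoning

  _×-enumeration_ : ∀ {A B} → Enumeration A → Enumeration B → Enumeration (A × B)
  _×-enumeration_ {A} {B} EA EB = record { elements = cartesianProductWith _,_ (elements EA) ys ; _≟ᵉ_ = eq? ;
      ∑-point = point }
    where
    ys = elements EB
    eq? : DecidableEquality (A × B)
    eq? (a , b) (a′ , b′) = map′ (λ { (refl , refl) → refl }) (λ { refl → refl , refl })
      (_≟ᵉ_ EA a a′ ×-dec _≟ᵉ_ EB b b′)
    point : ∀ ab (f : A × B → ℝ) → ∑ (cartesianProductWith _,_ (elements EA) ys) (λ xy → 𝟙 (eq? xy ab) * f xy) ≡ f ab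
    point (a , b) f = begin
      ∑ (cartesianProductWith _,_ (elements EA) ys) (λ xy → 𝟙 (eq? xy (a , b)) * f xy)
        ≡⟨ ∑-cartesian _,_ (λ xy → 𝟙 (eq? xy (a , b)) * f xy) (elements EA) ys ⟩
      ∑ (elements EA) (λ x → ∑ ys (λ y → 𝟙 (eq? (x , y) (a , b)) * f (x , y)))
        ≡⟨ ∑-cong (λ x → trans (∑-cong (split x) ys) (∑-*ˡ (𝟙 (_≟ᵉ_ EA x a)) _ ys)) (elements EA) ⟩
      ∑ (elements EA) (λ x → 𝟙 (_≟ᵉ_ EA x a) * ∑ ys (λ y → 𝟙 (_≟ᵉ_ EB y b) * f (x , y)))
        ≡⟨ ∑-cong (λ x → cong (𝟙 (_≟ᵉ_ EA x a) *_) (∑-point EB b (λ y → f (x , y)))) (elements EA) ⟩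
      ∑ (elements EA) (λ x → 𝟙 (_≟ᵉ_ EA x a) * f (x , b))
        ≡⟨ ∑-point EA a (λ x → f (x , b)) ⟩
      f (a , b) ∎
      where
      open ≡-Reasoning
      split : ∀ x y → 𝟙 (eq? (x , y) (a , b)) * f (x , y) ≡ 𝟙 (_≟ᵉ_ EA x a) * (𝟙 (_≟ᵉ_ EB y b) * f (x , y))
      split x y with _≟ᵉ_ EA x a | _≟ᵉ_ EB y b
      ... | yes refl | yes refl = sym (*-identityˡ _)
      ... | yes _    | no  _    = sym (*-identityˡ _)
      ... | no  _    | yes _    = trans (zeroˡ _) (sym (zeroˡ _))
      ... | no  _    | no  _    = trans (zeroˡ _) (sym (zeroˡ _))

  ∑-× : ∀ {A B} (EA : Enumeration A) (EB : Enumeration B) f →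
        ∑ (elements (EA ×-enumeration EB)) f ≡ ∑ (elements EA) (λ x → ∑ (elements EB) (λ y → f (x , y)))
  ∑-× EA EB f = ∑-cartesian _,_ f (elements EA) (elements EB)

-- Random subsets and Janson's inequality.

module Expectation (R : Reals) where
  open Reals R
  open OrderedField R
  open Sums R

  -- Expectation by conditioning on the first element; `Pr≡𝔼` identifies it with the weighted sum
  -- over `subsets`.
  𝔼 : ℝ → ∀ n → (Subset n → ℝ) → ℝ
  𝔼 p zero    f = f []
  𝔼 p (suc n) f = p * 𝔼 p n (λ S → f (inside ∷ S)) + (1# - p) * 𝔼 p n (λ S → f (outside ∷ S))

  𝔼-cong : ∀ p n {f g : Subset n → ℝ} → (∀ S → f S ≡ g S) → 𝔼 p n f ≡ 𝔼 p n g
  𝔼-cong p zero    eq = eq []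
  𝔼-cong p (suc n) eq = cong₂ (λ a b → p * a + (1# - p) * b)
    (𝔼-cong p n (eq ∘ (inside ∷_))) (𝔼-cong p n (eq ∘ (outside ∷_)))

  𝔼-*ˡ : ∀ p c n f → 𝔼 p n (λ S → c * f S) ≡ c * 𝔼 p n f
  𝔼-*ˡ p c zero    f = refl
  𝔼-*ˡ p c (suc n) f = trans
    (cong₂ (λ a b → p * a + (1# - p) * b) (𝔼-*ˡ p c n (f ∘ (inside ∷_))) (𝔼-*ˡ p c n (f ∘ (outside ∷_))))
    (solve 4 (λ p c a b → p :* (c :* a) :+ (κ 1 :- p) :* (c :* b) :=
                c :* (p :* a :+ (κ 1 :- p) :* b)) refl p c _ _)

  𝔼-+ : ∀ p n f g → 𝔼 p n (λ S → f S + g S) ≡ 𝔼 p n f + 𝔼 p n g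
  𝔼-+ p zero    f g = refl
  𝔼-+ p (suc n) f g = trans
    (cong₂ (λ a b → p * a + (1# - p) * b) (𝔼-+ p n (f ∘ (inside ∷_)) (g ∘ (inside ∷_)))
                                          (𝔼-+ p n (f ∘ (outside ∷_)) (g ∘ (outside ∷_))))
    (solve 5 (λ p a b c d → p :* (a :+ b) :+ (κ 1 :- p) :* (c :+ d) :=
                (p :* a :+ (κ 1 :- p) :* c) :+ (p :* b :+ (κ 1 :- p) :* d)) refl p _ _ _ _)

  𝔼-const : ∀ p n c → 𝔼 p n (λ _ → c) ≡ c
  𝔼-const p zero    c = refl
  𝔼-const p (suc n) c = trans (cong (λ a → p * a + (1# - p) * a) (𝔼-const p n c))
    (solve 2 (λ p a → p :* a :+ (κ 1 :- p) :* a := a) refl p c)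

  𝔼-∑ : ∀ p n {a} {A : Set a} (xs : List A) (f : A → Subset n → ℝ) →
        𝔼 p n (λ S → ∑ xs (λ x → f x S)) ≡ ∑ xs (λ x → 𝔼 p n (f x))
  𝔼-∑ p n []       f = 𝔼-const p n 0#
  𝔼-∑ p n (x ∷ xs) f = trans (𝔼-+ p n (f x) (λ S → ∑ xs (λ x → f x S))) (cong (𝔼 p n (f x) +_) (𝔼-∑ p n xs f))

  Pr≡𝔼 : ∀ {n a} p {P : Pred (Subset n) a} (P? : Decidable P) → Pr p P? ≡ 𝔼 p n (λ S → 𝟙 (P? S))
  Pr≡𝔼 {n} p P? = trans (∑-filter P? (weight n) (subsets n)) (weighted n (𝟙 ∘ P?))
    where
    weight : ∀ n → Subset n → ℝ
    weight n S = p ^ ∣ S ∣ * (1# - p) ^ ∣ ∁ S ∣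

    weighted : ∀ n f → ∑ (subsets n) (λ S → f S * weight n S) ≡ 𝔼 p n f
    weighted zero    f = solve 1 (λ x → x :* (κ 1 :* κ 1) :+ κ 0 := x) refl (f [])
    weighted (suc n) f = begin
      ∑ (map (inside ∷_) (subsets n) ++ map (outside ∷_) (subsets n)) (λ S → f S * weight (suc n) S)
        ≡⟨ ∑-++ (λ S → f S * weight (suc n) S) (map (inside ∷_) (subsets n)) _ ⟩
      ∑ (map (inside ∷_) (subsets n)) (λ S → f S * weight (suc n) S) +
      ∑ (map (outside ∷_) (subsets n)) (λ S → f S * weight (suc n) S)
        ≡⟨ cong₂ _+_ (∑-map (λ S → f S * weight (suc n) S) (inside ∷_) (subsets n))
                     (∑-map (λ S → f S * weight (suc n) S) (outside ∷_) (subsets n)) ⟩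
      ∑ (subsets n) (λ S → f (inside ∷ S) * weight (suc n) (inside ∷ S)) +
      ∑ (subsets n) (λ S → f (outside ∷ S) * weight (suc n) (outside ∷ S))
        ≡⟨ cong₂ _+_
             (trans (∑-cong (λ S → solve 4 (λ a p b c → a :* ((p :* b) :* c) := p :* (a :* (b :* c))) refl
                               (f (inside ∷ S)) p (p ^ ∣ S ∣) ((1# - p) ^ ∣ ∁ S ∣)) (subsets n))
                    (∑-*ˡ p _ (subsets n)))
             (trans (∑-cong (λ S → solve 4 (λ a q b c → a :* (b :* (q :* c)) := q :* (a :* (b :* c))) refl
                               (f (outside ∷ S)) (1# - p) (p ^ ∣ S ∣) ((1# - p) ^ ∣ ∁ S ∣)) (subsets n))
                    (∑-*ˡ (1# - p) _ (subsets n))) ⟩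
      p * ∑ (subsets n) (λ S → f (inside ∷ S) * weight n S) +
      (1# - p) * ∑ (subsets n) (λ S → f (outside ∷ S) * weight n S)
        ≡⟨ cong₂ (λ a b → p * a + (1# - p) * b) (weighted n (f ∘ (inside ∷_))) (weighted n (f ∘ (outside ∷_))) ⟩
      𝔼 p (suc n) f ∎
      where open ≡-Reasoning

  module Weighted {p : ℝ} (0≤p : 0# ≤ p) (p≤1 : p ≤ 1#) where
    private
      0≤1-p : 0# ≤ 1# - p
      0≤1-p = x≤y⇒0≤y-x p≤1

    𝔼-mono : ∀ n {f g : Subset n → ℝ} → (∀ S → f S ≤ g S) → 𝔼 p n f ≤ 𝔼 p n g
    𝔼-mono zero    le = le []
    𝔼-mono (suc n) le = +-mono-≤ (*-monoˡ-≤ 0≤p (𝔼-mono n (le ∘ (inside ∷_))))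
                                 (*-monoˡ-≤ 0≤1-p (𝔼-mono n (le ∘ (outside ∷_))))

    𝔼-nonneg : ∀ n {f : Subset n → ℝ} → (∀ S → 0# ≤ f S) → 0# ≤ 𝔼 p n f
    𝔼-nonneg n {f} f≥0 = subst (_≤ 𝔼 p n f) (𝔼-const p n 0#) (𝔼-mono n f≥0)

  Antitone : ∀ {n} → (Subset n → ℝ) → Set
  Antitone f = ∀ {S T} → S Subset.⊆ T → f T ≤ f S

  -- Raising the probability of one coordinate from p to q changes the expectation by q - p times a
  -- nonpositive difference. It lets the union bound be computed at the threshold itself.
  𝔼-antitone : ∀ {p q} → 0# ≤ p → p ≤ q → q ≤ 1# → ∀ {n} {f : Subset n → ℝ} → Antitone f → 𝔼 q n f ≤ 𝔼 p n f
  𝔼-antitone 0≤p p≤q q≤1 {zero}  anti = ≤-refl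
  𝔼-antitone {p} {q} 0≤p p≤q q≤1 {suc n} {f} anti = begin
    q * 𝔼 q n f₁ + (1# - q) * 𝔼 q n f₀
      ≤⟨ +-mono-≤ (*-monoˡ-≤ (≤-trans 0≤p p≤q) (𝔼-antitone 0≤p p≤q q≤1 {f = f₁} λ S⊆T → anti (Subset.s⊆s S⊆T)))
                  (*-monoˡ-≤ (x≤y⇒0≤y-x q≤1) (𝔼-antitone 0≤p p≤q q≤1 {f = f₀} λ S⊆T → anti (Subset.s⊆s S⊆T))) ⟩
    q * 𝔼 p n f₁ + (1# - q) * 𝔼 p n f₀
      ≤⟨ ≤-slack ((q - p) * (𝔼 p n f₀ - 𝔼 p n f₁))
           (*-nonneg (x≤y⇒0≤y-x p≤q) (x≤y⇒0≤y-x (𝔼-mono n {f = f₁} {g = f₀} λ S → anti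
               (Subset.out⊆ (Subset.⊆-refl {x = S})))))
           (solve 4 (λ p q a b → p :* a :+ (κ 1 :- p) :* b :=
                      (q :* a :+ (κ 1 :- q) :* b) :+ (q :- p) :* (b :- a)) refl p q _ _) ⟩
    p * 𝔼 p n f₁ + (1# - p) * 𝔼 p n f₀ ∎
    where
    open ≤-Reasoning
    open Weighted 0≤p (≤-trans p≤q q≤1)
    f₁ f₀ : Subset n → ℝ
    f₁ S = f (inside ∷ S)
    f₀ S = f (outside ∷ S)

  χ : ∀ {n} → Fin n → Subset n → ℝ
  χ i S = if lookup S i then 1# else 0#

  -- Conditioning on i ∈ S is expressed by overwriting coordinate `i`, which keeps the expectation
  -- over all of `Subset n` and avoids a conditional measure.
  𝔼-χ : ∀ p {n} (i : Fin n) (f : Subset n → ℝ) → 𝔼 p n (λ S → χ i S * f S) ≡ p * 𝔼 p n (λ S → f (S [ i ]≔ inside))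
  𝔼-χ p {suc n} zero f = begin
    p * 𝔼 p n (λ S → 1# * f (inside ∷ S)) + (1# - p) * 𝔼 p n (λ S → 0# * f (outside ∷ S))
      ≡⟨ cong₂ (λ a b → p * a + (1# - p) * b) (𝔼-cong p n (λ S → *-identityˡ _))
           (trans (𝔼-cong p n (λ S → zeroˡ _)) (𝔼-const p n 0#)) ⟩
    p * 𝔼 p n (λ S → f (inside ∷ S)) + (1# - p) * 0#
      ≡⟨ solve 2 (λ p a → p :* a :+ (κ 1 :- p) :* κ 0 :=
           p :* (p :* a :+ (κ 1 :- p) :* a)) refl p _ ⟩
    p * (p * 𝔼 p n (λ S → f (inside ∷ S)) + (1# - p) * 𝔼 p n (λ S → f (inside ∷ S))) ∎
    where open ≡-Reasoning
  𝔼-χ p {suc n} (suc i) f = trans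
    (cong₂ (λ a b → p * a + (1# - p) * b) (𝔼-χ p i (f ∘ (inside ∷_))) (𝔼-χ p i (f ∘ (outside ∷_))))
    (solve 3 (λ p a b → p :* (p :* a) :+ (κ 1 :- p) :* (p :* b) :=
                p :* (p :* a :+ (κ 1 :- p) :* b)) refl p _ _)

  𝔼-condition : ∀ p {n} (i : Fin n) (f : Subset n → ℝ) →
    𝔼 p n f ≡ p * 𝔼 p n (λ S → f (S [ i ]≔ inside)) + (1# - p) * 𝔼 p n (λ S → f (S [ i ]≔ outside))
  𝔼-condition p {suc n} zero f =
    solve 3 (λ p a b → p :* a :+ (κ 1 :- p) :* b :=
      p :* (p :* a :+ (κ 1 :- p) :* a) :+ (κ 1 :- p) :* (p :* b :+ (κ 1 :- p) :* b)) refl p _ _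
  𝔼-condition p {suc n} (suc i) f = trans
    (cong₂ (λ a b → p * a + (1# - p) * b) (𝔼-condition p i (f ∘ (inside ∷_))) (𝔼-condition p i (f ∘ (outside ∷_))))
    (solve 5 (λ p a b c d → p :* (p :* a :+ (κ 1 :- p) :* b) :+ (κ 1 :- p) :* (p :* c :+ (κ 1 :- p) :* d) :=
      p :* (p :* a :+ (κ 1 :- p) :* c) :+ (κ 1 :- p) :* (p :* b :+ (κ 1 :- p) :* d)) refl p _ _ _ _)

  DecreasingAt IndependentOf : ∀ {n} → Fin n → (Subset n → ℝ) → Set
  DecreasingAt  i f = ∀ S → f (S [ i ]≔ inside) ≤ f (S [ i ]≔ outside)
  IndependentOf i f = ∀ S → f (S [ i ]≔ inside) ≡ f (S [ i ]≔ outside)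

  𝔼-χ-independent : ∀ p {n} (i : Fin n) {f : Subset n → ℝ} → IndependentOf i f → 𝔼 p n (λ S → χ i S * f S) ≡ p * 𝔼 p n f
  𝔼-χ-independent p {n} i {f} indep = trans (𝔼-χ p i f) (cong (p *_) (sym (begin
    𝔼 p n f
      ≡⟨ 𝔼-condition p i f ⟩
    p * 𝔼 p n (λ S → f (S [ i ]≔ inside)) + (1# - p) * 𝔼 p n (λ S → f (S [ i ]≔ outside))
      ≡⟨ cong (λ z → p * 𝔼 p n (λ S → f (S [ i ]≔ inside)) + (1# - p) * z) (sym (𝔼-cong p n indep)) ⟩
    p * 𝔼 p n (λ S → f (S [ i ]≔ inside)) + (1# - p) * 𝔼 p n (λ S → f (S [ i ]≔ inside))
      ≡⟨ solve 2 (λ p a → p :* a :+ (κ 1 :- p) :* a := a) refl p _ ⟩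
    𝔼 p n (λ S → f (S [ i ]≔ inside)) ∎)))
    where open ≡-Reasoning

  χ-nonneg : ∀ {n} (i : Fin n) S → 0# ≤ χ i S
  χ-nonneg i S with lookup S i
  ... | true  = 0≤1
  ... | false = ≤-refl

  χ≤1 : ∀ {n} (i : Fin n) S → χ i S ≤ 1#
  χ≤1 i S with lookup S i
  ... | true  = ≤-refl
  ... | false = 0≤1

  χ-update-≢ : ∀ {n} {i j : Fin n} → i ≢ j → ∀ S b → χ j (S [ i ]≔ b) ≡ χ j S
  χ-update-≢ i≢j S b = cong (if_then 1# else 0#) (Vec.lookup∘update′ (i≢j ∘ sym) S b)

  χ-update-≡ : ∀ {n} (i : Fin n) S b → χ i (S [ i ]≔ b) ≡ (if b then 1# else 0#)
  χ-update-≡ i S b = cong (if_then 1# else 0#) (Vec.lookup∘update i S b)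

  χs : ∀ {n k} → Vec (Fin n) k → Subset n → ℝ
  χs []       S = 1#
  χs (i ∷ is) S = χ i S * χs is S

  χs-nonneg : ∀ {n k} (is : Vec (Fin n) k) S → 0# ≤ χs is S
  χs-nonneg []       S = 0≤1
  χs-nonneg (i ∷ is) S = *-nonneg (χ-nonneg i S) (χs-nonneg is S)

  χs≤1 : ∀ {n k} (is : Vec (Fin n) k) S → χs is S ≤ 1#
  χs≤1 []       S = ≤-refl
  χs≤1 (i ∷ is) S = ≤-trans (*-mono-≤ 0≤1 (χs-nonneg is S) (χ≤1 i S) (χs≤1 is S)) (≤-reflexive (*-identityˡ 1#))

  χs-update-∉ : ∀ {n k} {i : Fin n} (is : Vec (Fin n) k) → i ∉ᵛ is → ∀ S b → χs is (S [ i ]≔ b) ≡ χs is S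
  χs-update-∉ []       i∉ S b = refl
  χs-update-∉ (j ∷ is) i∉ S b = cong₂ _*_ (χ-update-≢ (λ { refl → i∉ (here refl) }) S b)
                                          (χs-update-∉ is (i∉ ∘ there) S b)

  χs-increasing : ∀ {n k} (i : Fin n) (is : Vec (Fin n) k) S → χs is (S [ i ]≔ outside) ≤ χs is (S [ i ]≔ inside)
  χs-increasing i []       S = ≤-refl
  χs-increasing i (j ∷ is) S = *-mono-≤ (χ-nonneg j (S [ i ]≔ inside)) (χs-nonneg is (S [ i ]≔ outside)) χ-step
      (χs-increasing i is S)
    where
    χ-step : χ j (S [ i ]≔ outside) ≤ χ j (S [ i ]≔ inside)
    χ-step with i Fin.≟ j
    ... | yes refl = subst₂ _≤_ (sym (χ-update-≡ i S outside)) (sym (χ-update-≡ i S inside)) 0≤1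
    ... | no  i≢j  = ≤-reflexive (trans (χ-update-≢ i≢j S outside) (sym (χ-update-≢ i≢j S inside)))

  none : ∀ {n k} → List (Vec (Fin n) k) → Subset n → ℝ
  none []       S = 1#
  none (x ∷ xs) S = (1# - χs x S) * none xs S

  0≤1-χs : ∀ {n k} (x : Vec (Fin n) k) S → 0# ≤ 1# - χs x S
  0≤1-χs x S = x≤y⇒0≤y-x (χs≤1 x S)

  none-nonneg : ∀ {n k} (xs : List (Vec (Fin n) k)) S → 0# ≤ none xs S
  none-nonneg []       S = 0≤1
  none-nonneg (x ∷ xs) S = *-nonneg (0≤1-χs x S) (none-nonneg xs S)

  none-decreasing : ∀ {n k} (i : Fin n) (xs : List (Vec (Fin n) k)) → DecreasingAt i (none xs)
  none-decreasing i []       S = ≤-refl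
  none-decreasing i (x ∷ xs) S = *-mono-≤ (0≤1-χs x (S [ i ]≔ outside)) (none-nonneg xs (S [ i ]≔ inside))
    (+-monoʳ-≤ 1# (neg-mono-≤ (χs-increasing i x S))) (none-decreasing i xs S)

  Distinct : ∀ {n k} → Vec (Fin n) k → Set
  Distinct []       = ⊤
  Distinct (i ∷ is) = i ∉ᵛ is × Distinct is

  𝔼-χs-independent : ∀ p {n k} (is : Vec (Fin n) k) → Distinct is → ∀ {f : Subset n → ℝ} →
      (∀ {i} → i ∈ᵛ is → IndependentOf i f) →
                     𝔼 p n (λ S → χs is S * f S) ≡ p ^ k * 𝔼 p n f
  𝔼-χs-independent p {n} []       _  {f} indep = trans (𝔼-cong p n λ S → *-identityˡ _) (sym (*-identityˡ _))
  𝔼-χs-independent p {n} {suc k} (i ∷ is) (i∉is , dist) {f} indep = begin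
    𝔼 p n (λ S → χ i S * χs is S * f S)
      ≡⟨ 𝔼-cong p n (λ S → *-assoc _ _ _) ⟩
    𝔼 p n (λ S → χ i S * (χs is S * f S))
      ≡⟨ 𝔼-χ-independent p i (λ S → cong₂ _*_
           (trans (χs-update-∉ is i∉is S inside) (sym (χs-update-∉ is i∉is S outside))) (indep (here refl) S)) ⟩
    p * 𝔼 p n (λ S → χs is S * f S)
      ≡⟨ cong (p *_) (𝔼-χs-independent p is dist (indep ∘ there)) ⟩
    p * (p ^ k * 𝔼 p n f)
      ≡⟨ *-assoc p _ _ ⟨
    p ^ suc k * 𝔼 p n f ∎
    where open ≡-Reasoning

  _∈?_ : ∀ {n k} (i : Fin n) (is : Vec (Fin n) k) → Dec (i ∈ᵛ is)
  i ∈? is = VecMembership._∈?_ Fin._≟_ i is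

  overlap? : ∀ {n k l} (x : Vec (Fin n) k) (y : Vec (Fin n) l) → Dec (VecAny.Any (_∈ᵛ x) y)
  overlap? x = VecAny.any? (_∈? x)

  module _ (p : ℝ) where

    -- For distinct letters, `weights p x y` is the probability that the letters of `y` lie in the
    -- random set given that those of `x` do.
    weight : ∀ {n k} → Vec (Fin n) k → Fin n → ℝ
    weight x i = if does (i ∈? x) then 1# else p

    weights : ∀ {n k l} → Vec (Fin n) k → Vec (Fin n) l → ℝ
    weights x []       = 1#
    weights x (i ∷ is) = weight x i * weights x is

  module Janson {p : ℝ} (0≤p : 0# ≤ p) (p≤1 : p ≤ 1#) where
    open Weighted 0≤p p≤1

    weight-nonneg : ∀ {n k} (x : Vec (Fin n) k) i → 0# ≤ weight p x i
    weight-nonneg x i with does (i ∈? x)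
    ... | true  = 0≤1
    ... | false = 0≤p

    weights-nonneg : ∀ {n k l} (x : Vec (Fin n) k) (y : Vec (Fin n) l) → 0# ≤ weights p x y
    weights-nonneg x []       = 0≤1
    weights-nonneg x (i ∷ is) = *-nonneg (weight-nonneg x i) (weights-nonneg x is)

    -- The one-coordinate case of Harris's inequality; iterated over the letters of a word, it
    -- supplies all the correlation that Janson's bound uses.
    𝔼-χ-decreasing : ∀ {n} (i : Fin n) {f : Subset n → ℝ} → DecreasingAt i f → 𝔼 p n (λ S → χ i S * f S) ≤ p * 𝔼 p n f
    𝔼-χ-decreasing {n} i {f} decr = begin
      𝔼 p n (λ S → χ i S * f S)
        ≡⟨ 𝔼-χ p i f ⟩
      p * f₁
        ≡⟨ cong (p *_) (solve 2 (λ p a → p :* a :+ (κ 1 :- p) :* a := a) refl p f₁) ⟨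
      p * (p * f₁ + (1# - p) * f₁)
        ≤⟨ *-monoˡ-≤ 0≤p (+-monoʳ-≤ (p * f₁) (*-monoˡ-≤ (x≤y⇒0≤y-x p≤1) (𝔼-mono n decr))) ⟩
      p * (p * f₁ + (1# - p) * 𝔼 p n (λ S → f (S [ i ]≔ outside)))
        ≡⟨ cong (p *_) (𝔼-condition p i f) ⟨
      p * 𝔼 p n f ∎
      where
      open ≤-Reasoning
      f₁ = 𝔼 p n (λ S → f (S [ i ]≔ inside))

    -- `g` is decreasing only off `x`, since it will contain the factor `χs x`. A letter in `x` is
    -- bounded by 1 instead, which is its weight.
    𝔼-χs-decreasing : ∀ {n k l} (x : Vec (Fin n) k) (y : Vec (Fin n) l) → Distinct y →
      ∀ {g : Subset n → ℝ} → (∀ S → 0# ≤ g S) → (∀ {i} → i ∉ᵛ x → DecreasingAt i g) →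
      𝔼 p n (λ S → χs y S * g S) ≤ weights p x y * 𝔼 p n g
    𝔼-χs-decreasing {n} x []       _ {g} g≥0 decr =
      ≤-reflexive (trans (𝔼-cong p n λ S → *-identityˡ _) (sym (*-identityˡ _)))
    𝔼-χs-decreasing {n} x (i ∷ is) (i∉is , dist) {g} g≥0 decr = begin
      𝔼 p n (λ S → χ i S * χs is S * g S)
        ≡⟨ 𝔼-cong p n (λ S → *-assoc _ _ _) ⟩
      𝔼 p n (λ S → χ i S * (χs is S * g S))
        ≤⟨ step ⟩
      weight p x i * 𝔼 p n (λ S → χs is S * g S)
        ≤⟨ *-monoˡ-≤ (weight-nonneg x i) (𝔼-χs-decreasing x is dist g≥0 decr) ⟩
      weight p x i * (weights p x is * 𝔼 p n g)
        ≡⟨ *-assoc _ _ _ ⟨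
      weights p x (i ∷ is) * 𝔼 p n g ∎
      where
      open ≤-Reasoning
      h : Subset n → ℝ
      h S = χs is S * g S
      step : 𝔼 p n (λ S → χ i S * h S) ≤ weight p x i * 𝔼 p n h
      step with i ∈? x
      ... | yes _   = ≤-trans (𝔼-mono n λ S → ≤-trans (*-monoʳ-≤ (*-nonneg (χs-nonneg is S) (g≥0 S)) (χ≤1 i S))
                               (≤-reflexive (*-identityˡ _))) (≤-reflexive (sym (*-identityˡ _)))
      ... | no  i∉x = 𝔼-χ-decreasing i λ S → ≤-trans
                        (*-monoˡ-≤ (χs-nonneg is (S [ i ]≔ inside)) (decr i∉x S))
                        (*-monoʳ-≤ (g≥0 (S [ i ]≔ outside)) (≤-reflexive
                            (trans (χs-update-∉ is i∉is S inside) (sym (χs-update-∉ is i∉is S outside)))))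

    independent : ∀ {n k} → Vec (Fin n) k → List (Vec (Fin n) k) → List (Vec (Fin n) k)
    independent x []       = []
    independent x (y ∷ ys) = if does (overlap? x y) then independent x ys else y ∷ independent x ys

    none-independent : ∀ {n k} (x : Vec (Fin n) k) ys {i} → i ∈ᵛ x → IndependentOf i (none (independent x ys))
    none-independent x []       i∈x S = refl
    none-independent x (y ∷ ys) {i} i∈x S with overlap? x y
    ... | yes _      = none-independent x ys i∈x S
    ... | no disjoint = cong₂ (λ a b → (1# - a) * b)
        (trans (χs-update-∉ y i∉y S inside) (sym (χs-update-∉ y i∉y S outside))) (none-independent x ys i∈x S)
      where
      i∉y : i ∉ᵛ y
      i∉y i∈y = disjoint (VecAny.map (λ { refl → i∈x }) i∈y)

    none≤none-independent : ∀ {n k} (x : Vec (Fin n) k) ys S → none ys S ≤ none (independent x ys) S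
    none≤none-independent x []       S = ≤-refl
    none≤none-independent x (y ∷ ys) S with overlap? x y
    ... | no  _ = *-monoˡ-≤ (0≤1-χs y S) (none≤none-independent x ys S)
    ... | yes _ = ≤-trans (*-monoʳ-≤ (none-nonneg ys S) 1-χ≤1)
                    (≤-trans (≤-reflexive (*-identityˡ _)) (none≤none-independent x ys S))
      where
      1-χ≤1 : 1# - χs y S ≤ 1#
      1-χ≤1 = ≤-slack (χs y S) (χs-nonneg y S) (solve 1 (λ c → κ 1 := (κ 1 :- c) :+ c) refl (χs y S))

    -- If no vector of `ys` disjoint from `x` is realised, then either none of `ys` is, or some
    -- vector meeting `x` is. The factor `I` stays on the union so that it can be decorrelated
    -- afterwards.
    none-union-bound : ∀ {n k} (x : Vec (Fin n) k) ys S → let I = none (independent x ys) S in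
                       I ≤ none ys S + ∑ ys (λ y → 𝟙 (overlap? x y) * χs y S) * I
    none-union-bound x []       S = ≤-reflexive (solve 0 (κ 1 := κ 1 :+ κ 0 :* κ 1) refl)
    none-union-bound x (y ∷ ys) S with overlap? x y
    ... | yes _ = ≤-trans (none-union-bound x ys S) (≤-slack
        (χs y S * (none (independent x ys) S - none ys S))
        (*-nonneg (χs-nonneg y S) (x≤y⇒0≤y-x (none≤none-independent x ys S)))
        (solve 4 (λ c a s i → (κ 1 :- c) :* a :+ (κ 1 :* c :+ s) :* i :=
                   (a :+ s :* i) :+ c :* (i :- a)) refl (χs y S) (none ys S) _ (none (independent x ys) S)))
    ... | no _ = ≤-trans (*-monoˡ-≤ (0≤1-χs y S) (none-union-bound x ys S)) (≤-reflexive
        (solve 4 (λ c a s i → (κ 1 :- c) :* (a :+ s :* i) :=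
                   (κ 1 :- c) :* a :+ (κ 0 :* c :+ s) :* ((κ 1 :- c) :* i)) refl
                   (χs y S) (none ys S) (∑ ys (λ y → 𝟙 (overlap? x y) * χs y S)) (none (independent x ys) S)))

    -- Each vector is compared with the later ones only, which matches the order in which `janson`
    -- removes vectors and asks no more than a one-sided antichain condition.
    WeaklyDependent : ∀ {n k} → ℝ → List (Vec (Fin n) k) → Set
    WeaklyDependent D []       = ⊤
    WeaklyDependent D (x ∷ xs) = Distinct x × ∑ xs (λ y → 𝟙 (overlap? x y) * weights p x y) ≤ D × WeaklyDependent D xs

    AllDistinct : ∀ {n k} → List (Vec (Fin n) k) → Set
    AllDistinct []       = ⊤
    AllDistinct (x ∷ xs) = Distinct x × AllDistinct xs

    WeaklyDependent⇒AllDistinct : ∀ {n k D} (xs : List (Vec (Fin n) k)) → WeaklyDependent D xs → AllDistinct xs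
    WeaklyDependent⇒AllDistinct []       _            = tt
    WeaklyDependent⇒AllDistinct (x ∷ xs) (d , _ , wd) = d , WeaklyDependent⇒AllDistinct xs wd

    private
      module _ {n k D} (0≤1-D : 0# ≤ 1# - D) (x : Vec (Fin n) k) (x-distinct : Distinct x)
               (ys : List (Vec (Fin n) k)) (ys-distinct : AllDistinct ys)
               (weak : ∑ ys (λ y → 𝟙 (overlap? x y) * weights p x y) ≤ D) where
        I : Subset n → ℝ
        I = none (independent x ys)

        𝔼I = 𝔼 p n I

        0≤𝔼I : 0# ≤ 𝔼I
        0≤𝔼I = 𝔼-nonneg n (none-nonneg (independent x ys))

        𝔼χI : 𝔼 p n (λ S → χs x S * I S) ≡ p ^ k * 𝔼I
        𝔼χI = 𝔼-χs-independent p x x-distinct (none-independent x ys)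

        pair : ∀ (zs : List (Vec (Fin n) k)) → AllDistinct zs →
               ∑ zs (λ y → 𝔼 p n (λ S → 𝟙 (overlap? x y) * (χs y S * (χs x S * I S)))) ≤
               ∑ zs (λ y → (𝟙 (overlap? x y) * weights p x y) * (p ^ k * 𝔼I))
        pair []       _          = ≤-refl
        pair (y ∷ zs) (dy , dzs) = +-mono-≤ (begin
          𝔼 p n (λ S → 𝟙 (overlap? x y) * (χs y S * (χs x S * I S)))
            ≡⟨ 𝔼-*ˡ p (𝟙 (overlap? x y)) n _ ⟩
          𝟙 (overlap? x y) * 𝔼 p n (λ S → χs y S * (χs x S * I S))
            ≤⟨ *-monoˡ-≤ (𝟙-nonneg (overlap? x y)) (𝔼-χs-decreasing x y dy
                 (λ S → *-nonneg (χs-nonneg x S) (none-nonneg (independent x ys) S))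
                 (λ {i} i∉x S → ≤-trans
                   (*-monoˡ-≤ (χs-nonneg x (S [ i ]≔ inside)) (none-decreasing i (independent x ys) S))
                   (*-monoʳ-≤ (none-nonneg (independent x ys) (S [ i ]≔ outside))
                     (≤-reflexive (trans (χs-update-∉ x i∉x S inside) (sym (χs-update-∉ x i∉x S outside))))))) ⟩
          𝟙 (overlap? x y) * (weights p x y * 𝔼 p n (λ S → χs x S * I S))
            ≡⟨ trans (cong (λ z → 𝟙 (overlap? x y) * (weights p x y * z)) 𝔼χI) (sym (*-assoc _ _ _)) ⟩
          (𝟙 (overlap? x y) * weights p x y) * (p ^ k * 𝔼I) ∎) (pair zs dzs)
          where open ≤-Reasoning

        -- The Boppana-Spencer step: given that none of `ys` is realised, `x` still is with
        -- probability at least p^k (1 - D). Vectors that avoid `x` are independent of it, and those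
        -- that meet it cost at most `D` in total once `x` is given.
        correlation : p ^ k * (1# - D) * 𝔼 p n (none ys) ≤ 𝔼 p n (λ S → χs x S * none ys S)
        correlation = begin
          p ^ k * (1# - D) * 𝔼 p n (none ys)
            ≤⟨ *-monoˡ-≤ (*-nonneg (^-nonneg 0≤p k) 0≤1-D) (𝔼-mono n (none≤none-independent x ys)) ⟩
          p ^ k * (1# - D) * 𝔼I
            ≤⟨ ≤-slack ((D - Δ) * (p ^ k * 𝔼I)) (*-nonneg (x≤y⇒0≤y-x weak) (*-nonneg (^-nonneg 0≤p k) 0≤𝔼I))
                 (solve 4 (λ a d e s → a :* e :- s :* (a :* e) :=
                    a :* (κ 1 :- d) :* e :+ (d :- s) :* (a :* e)) refl (p ^ k) D 𝔼I Δ) ⟩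
          p ^ k * 𝔼I - Δ * (p ^ k * 𝔼I)
            ≤⟨ +-cancelʳ-≤ (Δ * (p ^ k * 𝔼I)) (≤-trans (≤-reflexive undo) main) ⟩
          𝔼 p n (λ S → χs x S * none ys S) ∎
          where
          open ≤-Reasoning
          Δ = ∑ ys (λ y → 𝟙 (overlap? x y) * weights p x y)
          undo : p ^ k * 𝔼I - Δ * (p ^ k * 𝔼I) + Δ * (p ^ k * 𝔼I) ≡ p ^ k * 𝔼I
          undo = solve 2 (λ a b → a :- b :+ b := a) refl (p ^ k * 𝔼I) (Δ * (p ^ k * 𝔼I))
          pointwise : ∀ S → χs x S * I S
              ≤ χs x S * none ys S + ∑ ys (λ y → 𝟙 (overlap? x y) * (χs y S * (χs x S * I S)))
          pointwise S = ≤-trans (*-monoˡ-≤ (χs-nonneg x S) (none-union-bound x ys S)) (≤-reflexive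
            (trans (solve 4 (λ c a s i → c :* (a :+ s :* i) := c :* a :+ s :* (c :* i)) refl
                      (χs x S) (none ys S) (∑ ys (λ y → 𝟙 (overlap? x y) * χs y S)) (I S))
                   (cong (χs x S * none ys S +_) (trans (sym (∑-*ʳ (χs x S * I S) _ ys))
                     (∑-cong (λ y → *-assoc _ _ _) ys)))))
          main : p ^ k * 𝔼I ≤ 𝔼 p n (λ S → χs x S * none ys S) + Δ * (p ^ k * 𝔼I)
          main = begin
            p ^ k * 𝔼I
              ≡⟨ 𝔼χI ⟨
            𝔼 p n (λ S → χs x S * I S)
              ≤⟨ 𝔼-mono n pointwise ⟩
            𝔼 p n (λ S → χs x S * none ys S + ∑ ys (λ y → 𝟙 (overlap? x y) * (χs y S * (χs x S * I S))))
              ≡⟨ trans (𝔼-+ p n _ _) (cong (𝔼 p n (λ S → χs x S * none ys S) +_) (𝔼-∑ p n ys _)) ⟩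
            𝔼 p n (λ S → χs x S * none ys S) + ∑ ys (λ y → 𝔼 p n (λ S → 𝟙 (overlap? x y) * (χs y S * (χs x S * I S))))
              ≤⟨ +-monoʳ-≤ _ (pair ys ys-distinct) ⟩
            𝔼 p n (λ S → χs x S * none ys S) + ∑ ys (λ y → (𝟙 (overlap? x y) * weights p x y) * (p ^ k * 𝔼I))
              ≡⟨ cong (𝔼 p n (λ S → χs x S * none ys S) +_) (∑-*ʳ (p ^ k * 𝔼I) _ ys) ⟩
            𝔼 p n (λ S → χs x S * none ys S) + Δ * (p ^ k * 𝔼I) ∎

    -- `none (x ∷ xs)` is `none xs` minus the part where `x` is realised, and `correlation` bounds
    -- that part from below; the factors 1 - p^k (1 - D) accumulate.
    janson : ∀ {n k D} → 0# ≤ 1# - D → 0# ≤ 1# - p ^ k * (1# - D) → (xs : List (Vec (Fin n) k)) → WeaklyDependent D xs →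
             𝔼 p n (none xs) ≤ (1# - p ^ k * (1# - D)) ^ length xs
    janson {n} 0≤1-D 0≤1-c []       _ = ≤-reflexive (𝔼-const p n 1#)
    janson {n} {k} {D} 0≤1-D 0≤1-c (x ∷ xs) (x-distinct , weak , wd) = begin
      𝔼 p n (λ S → (1# - χs x S) * none xs S)
        ≡⟨ 𝔼-cong p n (λ S → solve 2 (λ c a → (κ 1 :- c) :* a := a :+ :- κ 1 :* (c :* a)) refl (χs x S) (none xs S)) ⟩
      𝔼 p n (λ S → none xs S + - 1# * (χs x S * none xs S))
        ≡⟨ trans (𝔼-+ p n _ _) (cong (𝔼 p n (none xs) +_) (𝔼-*ˡ p (- 1#) n _)) ⟩
      𝔼 p n (none xs) + - 1# * 𝔼 p n (λ S → χs x S * none xs S)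
        ≤⟨ ≤-slack (𝔼 p n (λ S → χs x S * none xs S) - c * 𝔼 p n (none xs))
             (x≤y⇒0≤y-x (correlation 0≤1-D x x-distinct xs (WeaklyDependent⇒AllDistinct xs wd) weak))
             (solve 3 (λ a b c → (κ 1 :- c) :* a := (a :+ :- κ 1 :* b) :+ (b :- c :* a)) refl (𝔼 p n (none xs)) _ c) ⟩
      (1# - c) * 𝔼 p n (none xs)
        ≤⟨ *-monoˡ-≤ 0≤1-c (janson 0≤1-D 0≤1-c xs wd) ⟩
      (1# - c) ^ length (x ∷ xs) ∎
      where
      open ≤-Reasoning
      c = p ^ k * (1# - D)

-- Groups on `Fin N`, words, and a solver for group identities.

-- Propositional equality permits rewriting with `cong`; an arbitrary finite group is transported
-- here by `indexGroup`.
record FinGroup (N : ℕ) : Set where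
  infixl 7 _∙_
  infix  8 _⁻¹
  field
    _∙_     : Fin N → Fin N → Fin N
    ε       : Fin N
    _⁻¹     : Fin N → Fin N
    isGroup : IsGroup _≡_ _∙_ ε _⁻¹

  group : Group 0ℓ 0ℓ
  group = record { isGroup = isGroup }

Word : ℕ → Set
Word n = List (Bool × Fin n)

module Words {N : ℕ} (𝔾 : FinGroup N) where
  open FinGroup 𝔾 public using (_∙_; ε; _⁻¹)
  open Group (FinGroup.group 𝔾) public using (assoc; identityˡ; identityʳ; inverseˡ; inverseʳ)
  open GroupProperties (FinGroup.group 𝔾) public
    using (⁻¹-involutive; ⁻¹-anti-homo-∙; ε⁻¹≈ε; ∙-cancelˡ; ∙-cancelʳ)

  G : Set
  G = Fin N

  sgn : Bool → G → G
  sgn true  x = x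
  sgn false x = x ⁻¹

  eval : ∀ {n} → Vec G n → Word n → G
  eval t []            = ε
  eval t ((b , i) ∷ w) = sgn b (lookup t i) ∙ eval t w

  infixr 7 _⊗_
  _⊗_ : Bool → Bool → Bool
  true  ⊗ c = c
  false ⊗ c = not c

  sgn-not : ∀ b x → sgn (not b) x ≡ sgn b x ⁻¹
  sgn-not true  x = refl
  sgn-not false x = sym (⁻¹-involutive x)

  sgn-⊗ : ∀ b c x → sgn (b ⊗ c) x ≡ sgn b (sgn c x)
  sgn-⊗ true  c x = refl
  sgn-⊗ false c x = sgn-not c x

  sgn-involutive : ∀ b x → sgn b (sgn b x) ≡ x
  sgn-involutive true  x = refl
  sgn-involutive false x = ⁻¹-involutive x

  eval-++ : ∀ {n} (t : Vec G n) v w → eval t (v ++ w) ≡ eval t v ∙ eval t w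
  eval-++ t []            w = sym (identityˡ _)
  eval-++ t ((b , i) ∷ v) w = trans (cong (sgn b (lookup t i) ∙_) (eval-++ t v w)) (sym (assoc _ _ _))

  infixl 7 _⊙_
  data Expr (n : ℕ) : Set where
    var : Fin n → Expr n
    _⊙_ : Expr n → Expr n → Expr n
    inv : Expr n → Expr n

  ⟦_⟧ : ∀ {n} → Expr n → Vec G n → G
  ⟦ var i ⟧   t = lookup t i
  ⟦ e₁ ⊙ e₂ ⟧ t = ⟦ e₁ ⟧ t ∙ ⟦ e₂ ⟧ t
  ⟦ inv e ⟧   t = ⟦ e ⟧ t ⁻¹

  private
    push : ∀ {n} → Bool → Fin n → Word n → Word n
    push b i []            = (b , i) ∷ []
    push b i ((c , j) ∷ w) = if (b xor c) ∧ ⌊ i Fin.≟ j ⌋ then w else (b , i) ∷ (c , j) ∷ w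

    prepend : ∀ {n} → Bool → Expr n → Word n → Word n
    prepend b     (var i)   w = push b i w
    prepend true  (x ⊙ y)   w = prepend true x (prepend true y w)
    prepend false (x ⊙ y)   w = prepend false y (prepend false x w)
    prepend b     (inv x)   w = prepend (not b) x w

    cancel : ∀ b x y → y ≡ sgn b x ∙ (sgn (not b) x ∙ y)
    cancel true  x y = sym (trans (sym (assoc x (x ⁻¹) y)) (trans (cong (_∙ y) (inverseʳ x)) (identityˡ y)))
    cancel false x y = sym (trans (sym (assoc (x ⁻¹) x y)) (trans (cong (_∙ y) (inverseˡ x)) (identityˡ y)))

    eval-push : ∀ {n} (t : Vec G n) b i w → eval t (push b i w) ≡ sgn b (lookup t i) ∙ eval t w
    eval-push t b i []               = refl
    eval-push t true  i ((true , j) ∷ w)  = refl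
    eval-push t false i ((false , j) ∷ w) = refl
    eval-push t true  i ((false , j) ∷ w) with i Fin.≟ j
    ... | yes refl = cancel true (lookup t i) (eval t w)
    ... | no  _    = refl
    eval-push t false i ((true , j) ∷ w) with i Fin.≟ j
    ... | yes refl = cancel false (lookup t i) (eval t w)
    ... | no  _    = refl

    eval-prepend : ∀ {n} (t : Vec G n) b e w → eval t (prepend b e w) ≡ sgn b (⟦ e ⟧ t) ∙ eval t w
    eval-prepend t b     (var i) w = eval-push t b i w
    eval-prepend t true  (x ⊙ y) w = trans (eval-prepend t true x (prepend true y w))
      (trans (cong (⟦ x ⟧ t ∙_) (eval-prepend t true y w)) (sym (assoc _ _ _)))
    eval-prepend t false (x ⊙ y) w = trans (eval-prepend t false y (prepend false x w))
      (trans (cong (⟦ y ⟧ t ⁻¹ ∙_) (eval-prepend t false x w))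
        (trans (sym (assoc _ _ _)) (cong (_∙ eval t w) (sym (⁻¹-anti-homo-∙ _ _)))))
    eval-prepend t true  (inv x) w = eval-prepend t false x w
    eval-prepend t false (inv x) w = trans (eval-prepend t true x w)
      (cong (_∙ eval t w) (sym (⁻¹-involutive _)))

    normalise : ∀ {n} → Expr n → Word n
    normalise e = prepend true e []

    ⟦normalise⟧ : ∀ {n} (t : Vec G n) e → ⟦ e ⟧ t ≡ eval t (normalise e)
    ⟦normalise⟧ t e = sym (trans (eval-prepend t true e []) (identityʳ _))

    sameWord : ∀ {n} → Word n → Word n → Bool
    sameWord []            []            = true
    sameWord []            (_ ∷ _)       = false
    sameWord (_ ∷ _)       []            = false
    sameWord ((b , i) ∷ v) ((c , j) ∷ w) = not (b xor c) ∧ (⌊ i Fin.≟ j ⌋ ∧ sameWord v w)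

    sameWord⇒≡ : ∀ {n} (v w : Word n) → sameWord v w ≡ true → v ≡ w
    sameWord⇒≡ []            []            _  = refl
    sameWord⇒≡ ((true , i) ∷ v) ((true , j) ∷ w) eq with i Fin.≟ j
    ... | yes refl = cong (_ ∷_) (sameWord⇒≡ v w eq)
    sameWord⇒≡ ((false , i) ∷ v) ((false , j) ∷ w) eq with i Fin.≟ j
    ... | yes refl = cong (_ ∷_) (sameWord⇒≡ v w eq)

  open Reflection (setoid G) var ⟦_⟧ ⟦_⟧ (λ _ _ → refl) using (close)

  -- Both sides are reduced in the free group on `n` letters. The comparison of reduced words is
  -- Boolean, so the last argument is `refl` for identities valid in all groups.
  group-solve : ∀ n (f : N-ary n (Expr n) (Expr n × Expr n)) →
    sameWord (normalise (proj₁ (close n f))) (normalise (proj₂ (close n f))) ≡ true →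
    Eq n _≡_ (curryⁿ ⟦ proj₁ (close n f) ⟧) (curryⁿ ⟦ proj₂ (close n f) ⟧)
  group-solve n f eq = curryⁿ-cong _≡_ ⟦ proj₁ (close n f) ⟧ ⟦ proj₂ (close n f) ⟧ λ t →
    trans (⟦normalise⟧ t (proj₁ (close n f)))
      (trans (cong (eval t) (sameWord⇒≡ (normalise (proj₁ (close n f))) (normalise (proj₂ (close n f))) eq))
        (sym (⟦normalise⟧ t (proj₂ (close n f)))))

  infix 4 _≐_
  _≐_ : ∀ {n} → Expr n → Expr n → Expr n × Expr n
  _≐_ = _,_

-- Counting solutions of equations in one or two unknowns.

module GroupCounting (R : Reals) {N : ℕ} (𝔾 : FinGroup N) where
  open Reals R hiding (_⁻¹)
  open OrderedField R
  open Sums R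
  open Words 𝔾
  open Enumeration (Fin-enumeration N) using (∑-point; ∑-𝟙≡; ∑-𝟙≤1; ∑-reindex) public

  all : List G
  all = allFin N

  conj : G → G → G
  conj y u = y ⁻¹ ∙ u ∙ y

  centralizer : G → ℝ
  centralizer u = ∑ all (λ y → 𝟙 (conj y u Fin.≟ u))

  commutingPairs : ℝ
  commutingPairs = ∑ all centralizer

  centralizer-nonneg : ∀ u → 0# ≤ centralizer u
  centralizer-nonneg u = ∑-nonneg (λ y → 𝟙-nonneg (conj y u Fin.≟ u)) all

  ∑-shiftʳ : ∀ a (f : G → ℝ) → ∑ all (λ x → f (x ∙ a)) ≡ ∑ all f
  ∑-shiftʳ a f = ∑-reindex (_∙ a) (_∙ a ⁻¹)
    (λ x → group-solve 2 (λ x a → x ⊙ inv a ⊙ a ≐ x) refl x a)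
    (λ x → group-solve 2 (λ x a → x ⊙ a ⊙ inv a ≐ x) refl x a) f

  ∑-shift : ∀ a b (f : G → ℝ) → ∑ all (λ x → f (a ∙ x ∙ b)) ≡ ∑ all f
  ∑-shift a b f = ∑-reindex (λ x → a ∙ x ∙ b) (λ x → a ⁻¹ ∙ x ∙ b ⁻¹)
    (λ x → group-solve 3 (λ x a b → a ⊙ (inv a ⊙ x ⊙ inv b) ⊙ b ≐ x) refl x a b)
    (λ x → group-solve 3 (λ x a b → inv a ⊙ (a ⊙ x ⊙ b) ⊙ inv b ≐ x) refl x a b) f

  ∑-inverse : ∀ (f : G → ℝ) → ∑ all (λ x → f (x ⁻¹)) ≡ ∑ all f
  ∑-inverse = ∑-reindex _⁻¹ _⁻¹ ⁻¹-involutive ⁻¹-involutive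

  private
    -- A nonempty fibre of y ↦ conj y u is a coset of the centralizer of u.
    coset : ∀ u y₀ y → conj (y ∙ y₀) u ≡ conj y₀ u → conj y u ≡ u
    coset u y₀ y eq = begin
      conj y u                        ≡⟨ group-solve 3 (λ u a y → inv y ⊙ u ⊙ y ≐ a ⊙ (inv
          (y ⊙ a) ⊙ u ⊙ (y ⊙ a)) ⊙ inv a) refl u y₀ y ⟩
      y₀ ∙ conj (y ∙ y₀) u ∙ y₀ ⁻¹    ≡⟨ cong (λ z → y₀ ∙ z ∙ y₀ ⁻¹) eq ⟩
      y₀ ∙ conj y₀ u ∙ y₀ ⁻¹          ≡⟨ group-solve 2 (λ u a → a ⊙ (inv a ⊙ u ⊙ a) ⊙ inv a ≐ u) refl u y₀ ⟩
      u                               ∎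
      where open ≡-Reasoning

    coset⁻¹ : ∀ u y₀ y → conj y u ≡ u → conj (y ∙ y₀) u ≡ conj y₀ u
    coset⁻¹ u y₀ y eq = trans
      (group-solve 3 (λ u a y → inv (y ⊙ a) ⊙ u ⊙ (y ⊙ a) ≐ inv a ⊙ (inv y ⊙ u ⊙ y) ⊙ a) refl u y₀ y)
      (cong (λ z → y₀ ⁻¹ ∙ z ∙ y₀) eq)

  conj-fibre : ∀ u z → ∑ all (λ y → 𝟙 (conj y u Fin.≟ z)) ≤ centralizer u
  conj-fibre u z with Fin.any? (λ y → conj y u Fin.≟ z)
  ... | yes (y₀ , refl) = ≤-trans
        (≤-reflexive (sym (∑-shiftʳ y₀ (λ y → 𝟙 (conj y u Fin.≟ conj y₀ u)))))
        (∑-mono (λ y → 𝟙-mono (conj (y ∙ y₀) u Fin.≟ conj y₀ u) (conj y u Fin.≟ u) (coset u y₀ y)) all)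
  ... | no empty = ≤-trans
        (≤-reflexive (trans (∑-cong (λ y → 𝟙-no (conj y u Fin.≟ z) (λ eq → empty (y , eq))) all) (∑-zero all)))
        (centralizer-nonneg u)

  ∃conj? : ∀ u z → Dec (∃[ y ] z ≡ conj y u)
  ∃conj? u z = Fin.any? (λ y → z Fin.≟ conj y u)

  -- The inequality half of orbit-stabiliser: the fibres of y ↦ `conj y u` over the class are
  -- disjoint, and each contains a translate of the centralizer.
  centralizer*class≤N : ∀ u → ∑ all (λ z → 𝟙 (∃conj? u z)) * centralizer u ≤ fromℕ N
  centralizer*class≤N u = begin
    ∑ all (λ z → 𝟙 (∃conj? u z)) * centralizer u
      ≡⟨ ∑-*ʳ (centralizer u) _ all ⟨
    ∑ all (λ z → 𝟙 (∃conj? u z) * centralizer u)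
      ≤⟨ ∑-mono (λ z → 𝟙*-≤ (∃conj? u z) (∑-nonneg (λ y → 𝟙-nonneg (conj y u Fin.≟ z)) all) (fibre z)) all ⟩
    ∑ all (λ z → ∑ all (λ y → 𝟙 (conj y u Fin.≟ z)))
      ≡⟨ ∑-swap (λ z y → 𝟙 (conj y u Fin.≟ z)) all all ⟩
    ∑ all (λ y → ∑ all (λ z → 𝟙 (conj y u Fin.≟ z)))
      ≡⟨ ∑-cong (λ y → trans (∑-cong (λ z → 𝟙-cong (conj y u Fin.≟ z) (z Fin.≟ conj y u) sym sym) all)
          (∑-𝟙≡ (conj y u))) all ⟩
    ∑ all (λ _ → 1#)
      ≡⟨ trans (∑-1 all) (Fin-size N) ⟩
    fromℕ N ∎
    where
    open ≤-Reasoning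
    fibre : ∀ z → ∃[ y ] z ≡ conj y u → centralizer u ≤ ∑ all (λ y → 𝟙 (conj y u Fin.≟ z))
    fibre z (y₀ , refl) = ≤-trans
      (∑-mono (λ y → 𝟙-mono (conj y u Fin.≟ u) (conj (y ∙ y₀) u Fin.≟ conj y₀ u) (coset⁻¹ u y₀ y)) all)
      (≤-reflexive (∑-shiftʳ y₀ (λ y → 𝟙 (conj y u Fin.≟ conj y₀ u))))

  -- With y = (a x b)⁻¹ the equation reads `conj y u` = v, so `conj-fibre` applies.
  intertwiners : ∀ a b u v → ∑ all (λ x → 𝟙 (a ∙ x ∙ b ∙ u Fin.≟ v ∙ (a ∙ x ∙ b))) ≤ centralizer u
  intertwiners a b u v = begin
    ∑ all (λ x → 𝟙 (a ∙ x ∙ b ∙ u Fin.≟ v ∙ (a ∙ x ∙ b)))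
      ≡⟨ ∑-shift a b (λ x → 𝟙 (x ∙ u Fin.≟ v ∙ x)) ⟩
    ∑ all (λ x → 𝟙 (x ∙ u Fin.≟ v ∙ x))
      ≡⟨ ∑-inverse (λ x → 𝟙 (x ∙ u Fin.≟ v ∙ x)) ⟨
    ∑ all (λ y → 𝟙 (y ⁻¹ ∙ u Fin.≟ v ∙ y ⁻¹))
      ≤⟨ ∑-mono (λ y → 𝟙-mono (y ⁻¹ ∙ u Fin.≟ v ∙ y ⁻¹) (conj y u Fin.≟ v) (λ eq →
           trans (cong (_∙ y) eq) (group-solve 2 (λ v y → v ⊙ inv y ⊙ y ≐ v) refl v y))) all ⟩
    ∑ all (λ y → 𝟙 (conj y u Fin.≟ v))
      ≤⟨ conj-fibre u v ⟩
    centralizer u ∎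
    where open ≤-Reasoning

  private
    twisted : ∀ a b c e x u → let k = b ∙ e ⁻¹ in a ∙ (u ∙ x) ∙ b ≡ c ∙ (u ∙ x) ⁻¹ ∙ e → a ∙ x ∙ b ≡ c ∙ x ⁻¹ ∙ e → conj (x ∙ k) u ≡ u ⁻¹
    twisted a b c e x u eq₁ eq₂ = begin
      conj (x ∙ (b ∙ e ⁻¹)) u
        ≡⟨ group-solve 5 (λ a b e x u → inv (x ⊙ (b ⊙ inv e)) ⊙ u ⊙ (x ⊙ (b ⊙ inv e)) ≐
             inv (a ⊙ x ⊙ b ⊙ inv e) ⊙ (a ⊙ (u ⊙ x) ⊙ b) ⊙ inv e) refl a b e x u ⟩
      (a ∙ x ∙ b ∙ e ⁻¹) ⁻¹ ∙ (a ∙ (u ∙ x) ∙ b) ∙ e ⁻¹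
        ≡⟨ cong₂ (λ p q → (p ∙ e ⁻¹) ⁻¹ ∙ q ∙ e ⁻¹) eq₂ eq₁ ⟩
      (c ∙ x ⁻¹ ∙ e ∙ e ⁻¹) ⁻¹ ∙ (c ∙ (u ∙ x) ⁻¹ ∙ e) ∙ e ⁻¹
        ≡⟨ group-solve 4 (λ c e x u → inv (c ⊙ inv x ⊙ e ⊙ inv e) ⊙ (c ⊙ inv (u ⊙ x) ⊙ e) ⊙ inv e ≐ inv u) refl c e
            x u ⟩
      u ⁻¹ ∎
      where open ≡-Reasoning

  -- If x and u x both solve the equation and v = x b e⁻¹, then u v u = v.
  square-solutions : ∀ a b c e → let r = ∑ all (λ x → 𝟙 (a ∙ x ∙ b Fin.≟ c ∙ x ⁻¹ ∙ e)) in r * r ≤ commutingPairs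
  square-solutions a b c e = begin
    r * r
      ≡⟨ ∑-*ˡ r S all ⟨
    ∑ all (λ x → r * S x)
      -- One factor `r` is recounted with u ∙ x in place of x, so that r² counts the pairs (x, u)
      -- for which both x and u ∙ x are solutions.
      ≡⟨ ∑-cong (λ x → trans (cong (_* S x) (sym (∑-shiftʳ x S))) (sym (∑-*ʳ (S x) _ all))) all ⟩
    ∑ all (λ x → ∑ all (λ u → S (u ∙ x) * S x))
      ≤⟨ ∑-mono (λ x → ∑-mono (bound x) all) all ⟩
    ∑ all (λ x → ∑ all (λ u → 𝟙 (conj (x ∙ k) u Fin.≟ u ⁻¹)))
      ≡⟨ ∑-swap (λ x u → 𝟙 (conj (x ∙ k) u Fin.≟ u ⁻¹)) all all ⟩
    ∑ all (λ u → ∑ all (λ x → 𝟙 (conj (x ∙ k) u Fin.≟ u ⁻¹)))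
      ≤⟨ ∑-mono (λ u → ≤-trans (≤-reflexive (∑-shiftʳ k (λ v → 𝟙 (conj v u Fin.≟ u ⁻¹)))) (conj-fibre u (u ⁻¹))) all ⟩
    commutingPairs ∎
    where
    open ≤-Reasoning
    k = b ∙ e ⁻¹
    S : G → ℝ
    S x = 𝟙 (a ∙ x ∙ b Fin.≟ c ∙ x ⁻¹ ∙ e)
    r = ∑ all S
    bound : ∀ x u → S (u ∙ x) * S x ≤ 𝟙 (conj (x ∙ k) u Fin.≟ u ⁻¹)
    bound x u = 𝟙*-≤ (_ Fin.≟ _) (𝟙-nonneg (conj (x ∙ k) u Fin.≟ u ⁻¹))
      (λ eq₁ → 𝟙-mono (_ Fin.≟ _) (conj (x ∙ k) u Fin.≟ u ⁻¹) (twisted a b c e x u eq₁))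

  private
    untangle : ∀ a b c a′ b′ c′ x y → a ∙ x ∙ b ∙ y ∙ c ≡ a′ ∙ y ∙ b′ ∙ x ∙ c′ →
               conj x (a ⁻¹ ∙ a′ ∙ y ∙ b′) ≡ b ∙ y ∙ (c ∙ c′ ⁻¹)
    untangle a b c a′ b′ c′ x y eq = begin
      conj x (a ⁻¹ ∙ a′ ∙ y ∙ b′)
        ≡⟨ group-solve 6 (λ a a′ b′ c′ x y → inv x ⊙ (inv a ⊙ a′ ⊙ y ⊙ b′) ⊙ x ≐
             inv x ⊙ inv a ⊙ (a′ ⊙ y ⊙ b′ ⊙ x ⊙ c′) ⊙ inv c′) refl a a′ b′ c′ x y ⟩
      x ⁻¹ ∙ a ⁻¹ ∙ (a′ ∙ y ∙ b′ ∙ x ∙ c′) ∙ c′ ⁻¹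
        ≡⟨ cong (λ z → x ⁻¹ ∙ a ⁻¹ ∙ z ∙ c′ ⁻¹) eq ⟨
      x ⁻¹ ∙ a ⁻¹ ∙ (a ∙ x ∙ b ∙ y ∙ c) ∙ c′ ⁻¹
        ≡⟨ group-solve 6 (λ a b c c′ x y → inv x ⊙ inv a ⊙ (a ⊙ x ⊙ b ⊙ y ⊙ c) ⊙ inv c′ ≐ b ⊙ y ⊙ (c ⊙ inv c′)) refl
            a b c c′ x y ⟩
      b ∙ y ∙ (c ∙ c′ ⁻¹) ∎
      where open ≡-Reasoning

  -- For fixed y the equation says that x conjugates `p ∙ y ∙ b′` into `b ∙ y ∙ q`, which leaves at
  -- most a centralizer's worth of x. As y runs through the group, so does `p ∙ y ∙ b′`.
  interleaved-solutions : ∀ a b c a′ b′ c′ →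
    ∑ all (λ y → ∑ all (λ x → 𝟙 (a ∙ x ∙ b ∙ y ∙ c Fin.≟ a′ ∙ y ∙ b′ ∙ x ∙ c′))) ≤ commutingPairs
  interleaved-solutions a b c a′ b′ c′ = begin
    ∑ all (λ y → ∑ all (λ x → 𝟙 (a ∙ x ∙ b ∙ y ∙ c Fin.≟ a′ ∙ y ∙ b′ ∙ x ∙ c′)))
      ≤⟨ ∑-mono (λ y → ≤-trans (∑-mono (λ x → 𝟙-mono (_ Fin.≟ _) (conj x (p ∙ y ∙ b′) Fin.≟ b ∙ y ∙ q)
          (untangle a b c a′ b′ c′ x y)) all)
                                (conj-fibre (p ∙ y ∙ b′) (b ∙ y ∙ q))) all ⟩
    ∑ all (λ y → centralizer (p ∙ y ∙ b′))
      ≡⟨ ∑-shift p b′ centralizer ⟩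
    commutingPairs ∎
    where
    open ≤-Reasoning
    p = a ⁻¹ ∙ a′
    q = c ∙ c′ ⁻¹

  linear-solutions : ∀ a b c → ∑ all (λ x → 𝟙 (a ∙ x ∙ b Fin.≟ c)) ≤ 1#
  linear-solutions a b c = ∑-𝟙≤1 (λ x → a ∙ x ∙ b Fin.≟ c) (a ⁻¹ ∙ c ∙ b ⁻¹)
    (λ { {x} refl → group-solve 3 (λ a b x → x ≐ inv a ⊙ (a ⊙ x ⊙ b) ⊙ inv b) refl a b x })

-- Signed permutations of letters and their classification.

idx : ∀ {n} → Word n → List (Fin n)
idx = map proj₂

IsPermutation : ∀ {n} → Word n → Set
IsPermutation w = Unique (idx w) × (∀ i → i ∈ idx w)

IsPermutation-resp-↭ : ∀ {n} {v w : Word n} → idx v ↭ idx w → IsPermutation v → IsPermutation w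
IsPermutation-resp-↭ {n} v↭w (unique , complete) =
  PermSetoid.Unique-resp-↭ (setoid (Fin n)) (↭⇒↭ₛ v↭w) unique , λ i → Perm.∈-resp-↭ v↭w (complete i)

identityTail : ∀ n → Word (suc n)
identityTail n = map (λ i → true , suc i) (allFin n)

identityWord : ∀ n → Word (suc n)
identityWord n = (true , zero) ∷ identityTail n

rotation : ∀ {n} → Fin (suc n) → Word (suc n)
rotation {n} j = drop (toℕ j) (identityWord n) ++ take (toℕ j) (identityWord n)

inverse : ∀ {n} → Word n → Word n
inverse []            = []
inverse ((b , i) ∷ w) = inverse w ++ (not b , i) ∷ []

inverse-++ : ∀ {n} (v w : Word n) → inverse (v ++ w) ≡ inverse w ++ inverse v
inverse-++ []            w = sym (List.++-identityʳ (inverse w))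
inverse-++ ((b , i) ∷ v) w = trans (cong (_++ _) (inverse-++ v w)) (List.++-assoc (inverse w) (inverse v) _)

inverse-involutive : ∀ {n} (w : Word n) → inverse (inverse w) ≡ w
inverse-involutive []            = refl
inverse-involutive ((b , i) ∷ w) = trans (inverse-++ (inverse w) _)
  (cong₂ (λ b w → (b , i) ∷ w) (Bool.not-involutive b) (inverse-involutive w))

idx-inverse : ∀ {n} (w : Word n) → idx (inverse w) ↭ idx w
idx-inverse []            = ↭-refl
idx-inverse ((b , i) ∷ w) = ↭-trans
  (subst (_↭ i ∷ idx (inverse w)) (sym (List.map-++ proj₂ (inverse w) ((not b , i) ∷ [])))
    (Perm.++-comm (idx (inverse w)) (i ∷ [])))
  (prep i (idx-inverse w))

AllPairs-delete : ∀ {A : Set} {ℛ : Rel A 0ℓ} xs {y ys} → AllPairs ℛ (xs ++ y ∷ ys) → AllPairs ℛ (xs ++ ys)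
AllPairs-delete []       (_ ∷ pairs)    = pairs
AllPairs-delete (x ∷ xs) (heads ∷ pairs) =
  All.++⁺ (All.++⁻ˡ xs heads) (All.tail (All.++⁻ʳ xs heads)) ∷ AllPairs-delete xs pairs

Unique-middle : ∀ {A : Set} (xs : List A) {y ys} → Unique (xs ++ y ∷ ys) → y ∉ xs × y ∉ ys
Unique-middle []       (y∉ys ∷ _)     = (λ ()) , λ y∈ys → All.lookup y∉ys y∈ys refl
Unique-middle (x ∷ xs) (heads ∷ unique) =
  (λ { (here refl)  → All.lookup heads (∈-++⁺ʳ xs (here refl)) refl
     ; (there y∈xs) → proj₁ (Unique-middle xs unique) y∈xs }) ,
  proj₂ (Unique-middle xs unique)

-- The counterexample keeps the context of the two letters, which later becomes the coefficients of
-- an equation.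
allPairs⊎counterexample : ∀ {A : Set} {ℛ : Rel A 0ℓ} → Decidable₂ ℛ → ∀ l →
  AllPairs ℛ l ⊎ (∃[ xs ] ∃[ a ] ∃[ ys ] ∃[ b ] ∃[ zs ] (l ≡ xs ++ a ∷ ys ++ b ∷ zs × ¬ ℛ a b))
allPairs⊎counterexample {A} {ℛ} ℛ? []      = inj₁ []
allPairs⊎counterexample {A} {ℛ} ℛ? (a ∷ l) with search l | allPairs⊎counterexample ℛ? l
  where
  search : ∀ l → All (ℛ a) l ⊎ (∃[ ys ] ∃[ b ] ∃[ zs ] (l ≡ ys ++ b ∷ zs × ¬ ℛ a b))
  search []      = inj₁ []
  search (b ∷ l) with ℛ? a b | search l
  ... | no ¬ℛab | _                                 = inj₂ ([] , b , l , refl , ¬ℛab)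
  ... | yes _   | inj₂ (ys , c , zs , refl , ¬ℛac) = inj₂ (b ∷ ys , c , zs , refl , ¬ℛac)
  ... | yes ℛab | inj₁ all                          = inj₁ (ℛab ∷ all)
... | inj₂ (ys , b , zs , refl , ¬ℛab) | _ = inj₂ ([] , a , ys , b , zs , refl , ¬ℛab)
... | inj₁ _ | inj₂ (xs , c , ys , b , zs , refl , ¬ℛcb) = inj₂ (a ∷ xs , c , ys , b , zs , refl , ¬ℛcb)
... | inj₁ all | inj₁ pairs = inj₁ (all ∷ pairs)

sorted-unique : ∀ {A : Set} {_≺_ : Rel A 0ℓ} → (∀ {a} → ¬ a ≺ a) → (∀ {a b} → a ≺ b → ¬ b ≺ a) →
                ∀ xs ys → AllPairs _≺_ xs → AllPairs _≺_ ys →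
                (∀ {z} → z ∈ xs → z ∈ ys) → (∀ {z} → z ∈ ys → z ∈ xs) → xs ≡ ys
sorted-unique irr asym []       []       _ _ _ _ = refl
sorted-unique irr asym []       (y ∷ ys) _ _ _ ys⊆xs with () ← ys⊆xs (here refl)
sorted-unique irr asym (x ∷ xs) []       _ _ xs⊆ys _ with () ← xs⊆ys (here refl)
sorted-unique {_≺_ = _≺_} irr asym (x ∷ xs) (y ∷ ys) (x≺ ∷ pxs) (y≺ ∷ pys) xs⊆ys ys⊆xs
  with x≡y (xs⊆ys (here refl)) (ys⊆xs (here refl))
  where
  x≡y : x ∈ y ∷ ys → y ∈ x ∷ xs → x ≡ y
  x≡y (here refl)  _            = refl
  x≡y _            (here refl)  = refl
  x≡y (there x∈ys) (there y∈xs) = ⊥-elim (asym (All.lookup y≺ x∈ys) (All.lookup x≺ y∈xs))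
... | refl = cong (x ∷_) (sorted-unique irr asym xs ys pxs pys
  (λ z∈xs → tail (All.lookup x≺ z∈xs) (xs⊆ys (there z∈xs))) (λ z∈ys → tail (All.lookup y≺ z∈ys) (ys⊆xs (there z∈ys))))
  where
  tail : ∀ {z zs} → x ≺ z → z ∈ x ∷ zs → z ∈ zs
  tail x≺z (here refl)  = ⊥-elim (irr x≺z)
  tail x≺z (there z∈zs) = z∈zs

identityTail-sorted : ∀ n → AllPairs (λ a b → proj₂ a Fin.< proj₂ b) (identityTail n)
identityTail-sorted n = AllPairs.map⁺ (AllPairs.tabulate⁺-< λ i<j → s≤s i<j)

∈-identityTail : ∀ {n} (i : Fin n) → (true , suc i) ∈ identityTail n
∈-identityTail i = ∈-map⁺ (λ i → true , suc i) (∈-allFin i)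

identityTail-∈ : ∀ {n a} → a ∈ identityTail n → ∃[ i ] a ≡ (true , suc i)
identityTail-∈ a∈ with ∈-map⁻ (λ i → true , suc i) a∈
... | i , _ , eq = i , eq

zero∉identityTail : ∀ n → zero ∉ idx (identityTail n)
zero∉identityTail n 0∈ with ∈-map⁻ proj₂ 0∈
... | a , a∈ , eq with identityTail-∈ a∈
...   | i , refl with () ← eq

identityWord-permutation : ∀ n → IsPermutation (identityWord n)
identityWord-permutation n =
  (All.¬Any⇒All¬ _ (zero∉identityTail n) ∷
   AllPairs.map⁺ (AllPairs.map (λ a<b a≡b → ℕ.<-irrefl (cong toℕ a≡b) a<b) (identityTail-sorted n))) ,
  λ { zero → here refl ; (suc i) → there (∈-map⁺ proj₂ (∈-identityTail i)) }

-- For w = p ++ zero ∷ r, solving w for the letter zero and substituting into the product of all letters in order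
-- equates the product of the other letters in order with r ++ zero ∷ p, where zero now stands for a constant.
data Shape {n} (p r : Word (suc n)) : Set where
  square : ∀ i x y → r ++ (true , zero) ∷ p ≡ x ++ (false , suc i) ∷ y → Shape p r
  crossing : ∀ i j x y z → toℕ i ℕ.< toℕ j →
    r ++ (true , zero) ∷ p ≡ x ++ (true , suc j) ∷ y ++ (true , suc i) ∷ z → Shape p r
  rotated : r ++ p ≡ identityTail n → Shape p r

zero-occurs-once : ∀ {n} (r x : Word (suc n)) {p l} → Unique (idx (r ++ (true , zero) ∷ p)) →
                   r ++ (true , zero) ∷ p ≢ x ++ (false , zero) ∷ l
zero-occurs-once []      []      _       ()
zero-occurs-once []      (_ ∷ x) (u ∷ _) refl = All.lookup u (∈-map⁺ proj₂ (∈-++⁺ʳ x (here refl))) refl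
zero-occurs-once (_ ∷ r) []      (u ∷ _) refl = All.lookup u (∈-map⁺ proj₂ (∈-++⁺ʳ r (here refl))) refl
zero-occurs-once (_ ∷ r) (_ ∷ x) (_ ∷ u) eq   = zero-occurs-once r x u (proj₂ (List.∷-injective eq))

private
  -- `zero` is comparable both ways, because it stands for a constant once it is eliminated. What
  -- can fail is then the sign of a letter or the order of two nonzero letters.
  Before : ∀ {n} → Rel (Bool × Fin (suc n)) 0ℓ
  Before (b , i) (c , j) = b ≡ true × c ≡ true × (i ≡ zero ⊎ (j ≡ zero ⊎ i Fin.< j))

  before? : ∀ {n} → Decidable₂ (Before {n})
  before? (b , i) (c , j) = b Bool.≟ true ×-dec (c Bool.≟ true ×-dec (i Fin.≟ zero ⊎-dec
      (j Fin.≟ zero ⊎-dec i Fin.<? j)))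

-- A failing pair gives one of the first two shapes. If there is none, the nonzero letters are
-- positive and increasing, and `sorted-unique` identifies them with `identityTail`.
classify : ∀ {n} (p r : Word (suc n)) → IsPermutation (r ++ (true , zero) ∷ p) → Shape p r
classify {n} p r (unique , complete) with allPairs⊎counterexample before? (r ++ (true , zero) ∷ p)
... | inj₂ (x , (false , zero)  , y , b , z , eq , _) = ⊥-elim (zero-occurs-once r x unique eq)
... | inj₂ (x , (false , suc i) , y , b , z , eq , _) = square i x _ eq
... | inj₂ (x , a@(true , _) , y , (false , suc i) , z , eq , _) =
      square i (x ++ a ∷ y) z (trans eq (sym (List.++-assoc x (a ∷ y) _)))
... | inj₂ (x , a@(true , _) , y , (false , zero) , z , eq , _) =
      ⊥-elim (zero-occurs-once r (x ++ a ∷ y) unique (trans eq (sym (List.++-assoc x (a ∷ y) _))))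
... | inj₂ (x , (true , zero) , y , (true , j) , z , eq , ¬before) = ⊥-elim (¬before (refl , refl , inj₁ refl))
... | inj₂ (x , (true , suc i) , y , (true , zero) , z , eq , ¬before) = ⊥-elim
    (¬before (refl , refl , inj₂ (inj₁ refl)))
... | inj₂ (x , (true , suc j) , y , (true , suc i) , z , eq , ¬before) = crossing i j x y z
        (ℕ.≤∧≢⇒< (ℕ.≮⇒≥ λ j<i → ¬before (refl , refl , inj₂ (inj₂ (s≤s j<i))))
            (λ i≡j → same (Fin.toℕ-injective i≡j))) eq
  where
  same : i ≢ j
  same refl = proj₂ (Unique-middle (idx x) (subst Unique (trans (cong idx eq) (List.map-++ proj₂ x _)) unique))
                (∈-map⁺ proj₂ (∈-++⁺ʳ y (here refl)))
... | inj₁ pairs = rotated (sorted-unique (ℕ.<-irrefl refl) ℕ.<-asym (r ++ p) (identityTail n)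
        (strict (r ++ p) (AllPairs-delete r pairs) zero∉) (identityTail-sorted n) r++p⊆tail tail⊆r++p)
  where
  zero∉ : zero ∉ idx (r ++ p)
  zero∉ 0∈ with Unique-middle (idx r) (subst Unique (List.map-++ proj₂ r _) unique)
                | ∈-++⁻ (idx r) (subst (zero ∈_) (List.map-++ proj₂ r p) 0∈)
  ... | 0∉r , _ | inj₁ 0∈r = 0∉r 0∈r
  ... | _ , 0∉p | inj₂ 0∈p = 0∉p 0∈p
  strict : ∀ l → AllPairs Before l → zero ∉ idx l → AllPairs (λ a b → proj₂ a Fin.< proj₂ b) l
  strict []      _              _   = []
  strict (a ∷ l) (heads ∷ prs) 0∉ = All.tabulate (λ b∈l → less (All.lookup heads b∈l) b∈l) ∷ strict l prs (0∉ ∘ there)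
    where
    less : ∀ {b} → Before a b → b ∈ l → proj₂ a Fin.< proj₂ b
    less (_ , _ , inj₁ refl)        b∈l = ⊥-elim (0∉ (here refl))
    less (_ , _ , inj₂ (inj₁ refl)) b∈l = ⊥-elim (0∉ (there (∈-map⁺ proj₂ b∈l)))
    less (_ , _ , inj₂ (inj₂ a<b))  b∈l = a<b
  positive : ∀ {a} → a ∈ r ++ p → proj₁ a ≡ true
  positive = go r pairs
    where
    go : ∀ r {a} → AllPairs Before (r ++ (true , zero) ∷ p) → a ∈ r ++ p → proj₁ a ≡ true
    go []      (heads ∷ _)  a∈          = proj₁ (proj₂ (All.lookup heads a∈))
    go (c ∷ r) (heads ∷ _)  (here refl) = proj₁ (All.lookup heads (∈-++⁺ʳ r (here refl)))
    go (c ∷ r) (_ ∷ prs)    (there a∈)  = go r prs a∈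
  r++p⊆tail : ∀ {a} → a ∈ r ++ p → a ∈ identityTail n
  r++p⊆tail {b , zero}  a∈ = ⊥-elim (zero∉ (∈-map⁺ proj₂ a∈))
  r++p⊆tail {b , suc i} a∈ with positive a∈
  ... | refl = ∈-identityTail i
  tail⊆r++p : ∀ {a} → a ∈ identityTail n → a ∈ r ++ p
  tail⊆r++p a∈ with identityTail-∈ a∈
  ... | i , refl with ∈-map⁻ proj₂ (complete (suc i))
  ...   | (b , _) , c∈ , refl with ∈-++⁻ r c∈
  ...     | inj₁ c∈r = subst (λ b → (b , suc i) ∈ r ++ p) (positive (∈-++⁺ˡ c∈r)) (∈-++⁺ˡ c∈r)
  ...     | inj₂ (there c∈p) = subst (λ b → (b , suc i) ∈ r ++ p) (positive (∈-++⁺ʳ r c∈p)) (∈-++⁺ʳ r c∈p)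

-- As `r ++ p` is increasing, the word starts with the letter of index `length r` + 1 and wraps
-- around once. An empty `p` is told apart as the trivial rotation, which fixes the product of every
-- word.
rotated⇒rotation : ∀ {n} (p r : Word (suc n)) → r ++ p ≡ identityTail n → ∃[ j ] p ++ (true , zero) ∷ r ≡ rotation j
rotated⇒rotation {n} []      r eq = zero ,
  cong ((true , zero) ∷_) (trans (sym (List.++-identityʳ r)) (trans eq (sym (List.++-identityʳ _))))
rotated⇒rotation {n} (a ∷ p) r eq = suc j , sym (begin
  drop (toℕ j) (identityTail n) ++ (true , zero) ∷ take (toℕ j) (identityTail n)
    ≡⟨ cong₂ (λ k l → drop k l ++ (true , zero) ∷ take k l) (Fin.toℕ-fromℕ< len<n) (sym eq) ⟩
  drop (length r) (r ++ a ∷ p) ++ (true , zero) ∷ take (length r) (r ++ a ∷ p)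
    ≡⟨ cong₂ (λ x y → x ++ (true , zero) ∷ y) (drop-length r) (take-length r) ⟩
  (a ∷ p) ++ (true , zero) ∷ r ∎)
  where
  open ≡-Reasoning
  drop-length : ∀ (r : Word (suc n)) {q} → drop (length r) (r ++ q) ≡ q
  drop-length []      = refl
  drop-length (_ ∷ r) = drop-length r
  take-length : ∀ (r : Word (suc n)) {q} → take (length r) (r ++ q) ≡ r
  take-length []      = refl
  take-length (c ∷ r) = cong (c ∷_) (take-length r)
  total : length r ℕ.+ suc (length p) ≡ n
  total = trans (sym (List.length-++ r)) (trans (cong length eq)
    (trans (List.length-map _ (allFin n)) (List.length-tabulate id)))
  len<n : length r ℕ.< n
  len<n = subst (length r ℕ.<_) total (ℕ.m<m+n (length r) (s≤s z≤n))
  j : Fin n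
  j = fromℕ< len<n

-- Counting words on which a permuted word has a prescribed value.

module WordCounting (R : Reals) {N : ℕ} (𝔾 : FinGroup N) where
  open Reals R hiding (_⁻¹)
  open OrderedField R
  open Sums R
  open Words 𝔾
  open GroupCounting R 𝔾
  open Vectors (Fin-enumeration N) using (Vec-enumeration; Vec-size; ∑-update) public

  tuples : ∀ n → List (Vec G n)
  tuples n = vecs all n

  eval-update-∉ : ∀ {n} (t : Vec G n) {i} x (w : Word n) → i ∉ idx w → eval (t [ i ]≔ x) w ≡ eval t w
  eval-update-∉ t x []            i∉ = refl
  eval-update-∉ t {i} x ((b , j) ∷ w) i∉ = cong₂ (λ y z → sgn b y ∙ z)
    (Vec.lookup∘update′ (λ { refl → i∉ (here refl) }) t x) (eval-update-∉ t x w (i∉ ∘ there))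

  eval-inverse : ∀ {n} (t : Vec G n) (w : Word n) → eval t (inverse w) ≡ eval t w ⁻¹
  eval-inverse t []            = sym ε⁻¹≈ε
  eval-inverse t ((b , i) ∷ w) = begin
    eval t (inverse w ++ (not b , i) ∷ [])       ≡⟨ eval-++ t (inverse w) _ ⟩
    eval t (inverse w) ∙ (sgn (not b) (lookup t i) ∙ ε)
      ≡⟨ cong₂ _∙_ (eval-inverse t w) (trans (identityʳ _) (sgn-not b (lookup t i))) ⟩
    eval t w ⁻¹ ∙ sgn b (lookup t i) ⁻¹          ≡⟨ ⁻¹-anti-homo-∙ _ _ ⟨
    (sgn b (lookup t i) ∙ eval t w) ⁻¹           ∎
    where open ≡-Reasoning

  eval-occurrence : ∀ {n} (t : Vec G n) {i} c x {b} y → i ∉ idx x → i ∉ idx y →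
                    eval (t [ i ]≔ c) (x ++ (b , i) ∷ y) ≡ eval t x ∙ sgn b c ∙ eval t y
  eval-occurrence t {i} c x {b} y i∉x i∉y = trans (eval-++ (t [ i ]≔ c) x _) (trans
    (cong₂ _∙_ (eval-update-∉ t c x i∉x) (cong₂ (λ u v → sgn b u ∙ v) (Vec.lookup∘update i t c)
        (eval-update-∉ t c y i∉y)))
    (sym (assoc _ _ _)))

  occurs-once : ∀ {n} {w : Word n} → Unique (idx w) → ∀ x {b i} y → w ≡ x ++ (b , i) ∷ y → i ∉ idx x × i ∉ idx y
  occurs-once unique x y refl = Unique-middle (idx x) (subst Unique (List.map-++ proj₂ x _) unique)

  -- Averaging with the denominator cleared: `∑-update` counts each tuple N times along direction
  -- `i`.
  fibre-bound : ∀ {n} (i : Fin n) (F : Vec G n → ℝ) K → (∀ t → ∑ all (λ x → F (t [ i ]≔ x)) ≤ K) →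
                fromℕ N * ∑ (tuples n) F ≤ fromℕ N ^ n * K
  fibre-bound {n} i F K bound = begin
    fromℕ N * ∑ (tuples n) F
      ≡⟨ cong (_* ∑ (tuples n) F) (Fin-size N) ⟨
    Enumeration.size (Fin-enumeration N) * ∑ (tuples n) F
      ≡⟨ ∑-update i F ⟨
    ∑ (tuples n) (λ t → ∑ all (λ x → F (t [ i ]≔ x)))
      ≤⟨ ∑-mono bound (tuples n) ⟩
    ∑ (tuples n) (λ _ → K)
      ≡⟨ ∑-const K (tuples n) ⟩
    Enumeration.size (Vec-enumeration n) * K
      ≡⟨ cong (_* K) (trans (Vec-size n) (cong (_^ n) (Fin-size N))) ⟩
    fromℕ N ^ n * K ∎
    where open ≤-Reasoning

  fibre-bound₂ : ∀ {n} (i j : Fin n) (F : Vec G n → ℝ) K →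
                 (∀ t → ∑ all (λ y → ∑ all (λ x → F ((t [ j ]≔ y) [ i ]≔ x))) ≤ K) →
                 fromℕ N * (fromℕ N * ∑ (tuples n) F) ≤ fromℕ N ^ n * K
  fibre-bound₂ {n} i j F K bound = ≤-trans
    (≤-reflexive (cong (fromℕ N *_) (trans (cong (_* ∑ (tuples n) F) (sym (Fin-size N))) (sym (∑-update i F)))))
    (fibre-bound j (λ t → ∑ all (λ x → F (t [ i ]≔ x))) K bound)

  eval-head : ∀ {n} (t : Vec G n) z z′ (w : Word (suc n)) → zero ∉ idx w → eval (z ∷ t) w ≡ eval (z′ ∷ t) w
  eval-head t z z′ w 0∉ = sym (eval-update-∉ (z ∷ t) z′ w 0∉)

  constrained : ∀ {n ℓ} {P : Pred (Vec G (suc n)) ℓ} → G → Decidable P → ℝ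
  constrained {n} h P? = ∑ (tuples (suc n)) (λ t → 𝟙 (eval t (identityWord n) Fin.≟ h) * 𝟙 (P? t))

  solutions : ∀ {n} → G → G → Word (suc n) → ℝ
  solutions h g w = constrained h (λ t → eval t w Fin.≟ g)

  -- Given the other letters, the product condition determines letter `zero`. It therefore suffices
  -- to count the tails that satisfy a consequence `Q` of the two conditions.
  eliminate : ∀ {n ℓ m} {P : Pred (Vec G (suc n)) ℓ} {Q : Pred (Vec G n) m} h (P? : Decidable P) (Q? : Decidable Q) →
              (∀ z t → eval (z ∷ t) (identityWord n) ≡ h → P (z ∷ t) → Q t) →
              constrained h P? ≤ ∑ (tuples n) (𝟙 ∘ Q?)
  eliminate {n} h P? Q? imp = begin
    constrained h P?
      ≡⟨ ∑-vecs all n _ ⟩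
    ∑ all (λ z → ∑ (tuples n) (λ t → 𝟙 (eval (z ∷ t) (identityWord n) Fin.≟ h) * 𝟙 (P? (z ∷ t))))
      ≤⟨ ∑-mono (λ z → ∑-mono (step z) (tuples n)) all ⟩
    ∑ all (λ z → ∑ (tuples n) (λ t → 𝟙 (ε ∙ z ∙ tail t Fin.≟ h) * 𝟙 (Q? t)))
      ≡⟨ ∑-swap (λ z t → 𝟙 (ε ∙ z ∙ tail t Fin.≟ h) * 𝟙 (Q? t)) all (tuples n) ⟩
    ∑ (tuples n) (λ t → ∑ all (λ z → 𝟙 (ε ∙ z ∙ tail t Fin.≟ h) * 𝟙 (Q? t)))
      ≤⟨ ∑-mono (λ t → ≤-trans (≤-reflexive (∑-*ʳ (𝟙 (Q? t)) _ all)) (≤-trans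
           (*-monoʳ-≤ (𝟙-nonneg (Q? t)) (linear-solutions ε (tail t) h)) (≤-reflexive (*-identityˡ _)))) (tuples n) ⟩
    ∑ (tuples n) (𝟙 ∘ Q?) ∎
    where
    open ≤-Reasoning
    tail : Vec G n → G
    tail t = eval (ε ∷ t) (identityTail n)
    step : ∀ z t → 𝟙 (eval (z ∷ t) (identityWord n) Fin.≟ h) * 𝟙 (P? (z ∷ t)) ≤ 𝟙 (ε ∙ z ∙ tail t Fin.≟ h) * 𝟙 (Q? t)
    step z t = ≤-trans
      (≤-reflexive (𝟙*-cong (eval (z ∷ t) (identityWord n) Fin.≟ h) {y = 𝟙 (P? (z ∷ t)) * 𝟙 (Q? t)} λ eq → both eq))
      (≤-trans (*-mono-≤ (𝟙-nonneg (ε ∙ z ∙ tail t Fin.≟ h)) (*-nonneg (𝟙-nonneg (P? (z ∷ t))) (𝟙-nonneg (Q? t)))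
        (𝟙-mono (eval (z ∷ t) (identityWord n) Fin.≟ h) (ε ∙ z ∙ tail t Fin.≟ h)
          (trans (cong₂ _∙_ (identityˡ z) (eval-head t ε z (identityTail n) (zero∉identityTail n)))))
        (≤-trans (*-monoʳ-≤ (𝟙-nonneg (Q? t)) (𝟙≤1 (P? (z ∷ t)))) (≤-reflexive (*-identityˡ _)))) ≤-refl)
      where
      both : eval (z ∷ t) (identityWord n) ≡ h → 𝟙 (P? (z ∷ t)) ≡ 𝟙 (P? (z ∷ t)) * 𝟙 (Q? t)
      both eq with P? (z ∷ t)
      ... | yes p = sym (trans (*-identityˡ _) (𝟙-yes (Q? t) (imp z t eq p)))
      ... | no  _ = sym (zeroˡ _)

  solutions-inverse : ∀ {n} h g (w : Word (suc n)) → solutions h g (inverse w) ≤ solutions h (g ⁻¹) w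
  solutions-inverse {n} h g w = ∑-mono (λ t → *-monoˡ-≤ (𝟙-nonneg (eval t (identityWord n) Fin.≟ h))
    (𝟙-mono (eval t (inverse w) Fin.≟ g) (eval t w Fin.≟ g ⁻¹) (λ eq →
      trans (sym (⁻¹-involutive _)) (cong _⁻¹ (trans (sym (eval-inverse t w)) eq))))) (tuples (suc n))

  split : ∀ {n} {w : Word n} → Unique (idx w) → ∀ {b i} → (b , i) ∈ w →
          ∃[ x ] ∃[ y ] (w ≡ x ++ (b , i) ∷ y × i ∉ idx x × i ∉ idx y)
  split unique bi∈w with ∈-∃++ bi∈w
  ... | x , y , eq = x , y , eq , occurs-once unique x y eq

  identityTail-unique : ∀ n → Unique (idx (identityTail n))
  identityTail-unique n with proj₁ (identityWord-permutation n)
  ... | _ ∷ unique = unique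

  -- The number of commuting pairs enters in two ways: as a square root through `square-solutions`
  -- and divided by N through `interleaved-solutions`.
  module Bounded {ρ : ℝ} (1≤ρ : 1# ≤ ρ) (Z≤ρ² : commutingPairs ≤ ρ * ρ) (Z≤Nρ : commutingPairs ≤ fromℕ N * ρ)
                 (0<N : 0# < fromℕ N) where

    0≤ρ : 0# ≤ ρ
    0≤ρ = ≤-trans 0≤1 1≤ρ

    -- Of the N^n words with a given product, at most a fraction ρ / N, with the denominator
    -- cleared.
    Rare : ∀ n → ℝ → Set
    Rare n x = fromℕ N * x ≤ fromℕ N ^ n * ρ

    Rare-≤ : ∀ {n x y} → x ≤ y → Rare n y → Rare n x
    Rare-≤ x≤y rare = ≤-trans (*-monoˡ-≤ (<⇒≤ 0<N) x≤y) rare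

    square-bound : ∀ a b c e → ∑ all (λ x → 𝟙 (a ∙ x ∙ b Fin.≟ c ∙ x ⁻¹ ∙ e)) ≤ ρ
    square-bound a b c e = square-cancel-≤ 0≤ρ (≤-trans (square-solutions a b c e) Z≤ρ²)

    -- Letter `suc i` occurs with opposite signs on the two sides; with the others fixed, it solves
    -- an equation counted by `square-solutions`.
    tail-square : ∀ {n} c i x y h → suc i ∉ idx x → suc i ∉ idx y →
      Rare n (∑ (tuples n) (λ t → 𝟙 (eval (c ∷ t) (identityTail n) Fin.≟ eval (c ∷ t) (x ++ (false , suc i) ∷ y) ∙ h)))
    tail-square {n} c i x y h i∉x i∉y with split (identityTail-unique n) (∈-identityTail i)
    ... | a , b , eq , i∉a , i∉b = fibre-bound i _ ρ λ t → ≤-trans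
      (≤-reflexive (∑-cong (λ u → 𝟙-cong (_ Fin.≟ _)
        (eval (c ∷ t) a ∙ u ∙ eval (c ∷ t) b Fin.≟ eval (c ∷ t) x ∙ u ⁻¹ ∙ (eval (c ∷ t) y ∙ h))
        (λ e → trans (sym (left t u)) (trans e (right t u)))
        (λ e → trans (left t u) (trans e (sym (right t u))))) all))
      (square-bound (eval (c ∷ t) a) (eval (c ∷ t) b) (eval (c ∷ t) x) (eval (c ∷ t) y ∙ h))
      where
      left : ∀ t u → eval (c ∷ (t [ i ]≔ u)) (identityTail n) ≡ eval (c ∷ t) a ∙ u ∙ eval (c ∷ t) b
      left t u = trans (cong (eval (c ∷ (t [ i ]≔ u))) eq) (eval-occurrence (c ∷ t) u a b i∉a i∉b)
      right : ∀ t u → eval (c ∷ (t [ i ]≔ u)) (x ++ (false , suc i) ∷ y) ∙ h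
          ≡ eval (c ∷ t) x ∙ u ⁻¹ ∙ (eval (c ∷ t) y ∙ h)
      right t u = trans (cong (_∙ h) (eval-occurrence (c ∷ t) u x y i∉x i∉y)) (assoc _ _ _)

    -- `identityTail` has i before j and the right side has j before i, with all four occurrences
    -- positive: in these two letters the equation is one of `interleaved-solutions`.
    tail-crossing : ∀ {n} c i j x y z h → toℕ i ℕ.< toℕ j →
        Unique (idx (x ++ (true , suc j) ∷ y ++ (true , suc i) ∷ z)) →
      Rare n (∑ (tuples n) (λ t → 𝟙 (eval (c ∷ t) (identityTail n) Fin.≟
                                     eval (c ∷ t) (x ++ (true , suc j) ∷ y ++ (true , suc i) ∷ z) ∙ h)))
    tail-crossing {n} c i j x y z h i<j unique with split (identityTail-unique n) (∈-identityTail i)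
    ... | a , bc , eq , i∉a , i∉bc = *-cancelˡ-≤ 0<N (≤-trans (fibre-bound₂ i j _ commutingPairs pointwise)
            (≤-trans (*-monoˡ-≤ (^-nonneg (<⇒≤ 0<N) n) Z≤Nρ)
              (≤-reflexive (solve 3 (λ a b c → a :* (b :* c) := b :* (a :* c)) refl (fromℕ N ^ n) (fromℕ N) ρ))))
      where
      j∈ : ∀ a {bc} → identityTail n ≡ a ++ (true , suc i) ∷ bc → (true , suc j) ∈ bc
      j∈ a {bc} eq = after a (identityTail-sorted n) eq (∈-identityTail j)
        where
        after : ∀ a {l} → AllPairs (λ a b → proj₂ a Fin.< proj₂ b) l → l
            ≡ a ++ (true , suc i) ∷ bc → (true , suc j) ∈ l → (true , suc j) ∈ bc
        after []      _           refl (here refl) = ⊥-elim (ℕ.<-irrefl refl i<j)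
        after []      _           refl (there j∈)  = j∈
        after (_ ∷ a) (heads ∷ _) refl (here refl) =
          ⊥-elim (ℕ.<-asym (s≤s i<j) (All.lookup heads (∈-++⁺ʳ a (here refl))))
        after (_ ∷ a) (_ ∷ prs)   refl (there j∈)  = after a prs refl j∈
      bc-unique : Unique (idx bc)
      bc-unique = suffix (idx a) (subst Unique (trans (cong idx eq) (List.map-++ proj₂ a _)) (identityTail-unique n))
        where
        suffix : ∀ (xs : List (Fin (suc n))) {y ys} → Unique (xs ++ y ∷ ys) → Unique ys
        suffix []       (_ ∷ u) = u
        suffix (_ ∷ xs) (_ ∷ u) = suffix xs u
      j≢i : suc j ≢ suc i
      j≢i refl = ℕ.<-irrefl refl i<j
      bsplit = split bc-unique (j∈ a eq)
      b = proj₁ bsplit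
      d = proj₁ (proj₂ bsplit)
      bc≡ = proj₁ (proj₂ (proj₂ bsplit))
      j∉b = proj₁ (proj₂ (proj₂ (proj₂ bsplit)))
      j∉d = proj₂ (proj₂ (proj₂ (proj₂ bsplit)))
      w≡ : identityTail n ≡ (a ++ (true , suc i) ∷ b) ++ (true , suc j) ∷ d
      w≡ = trans eq (trans (cong (λ l → a ++ (true , suc i) ∷ l) bc≡) (sym (List.++-assoc a ((true , suc i) ∷ b) _)))
      j∉ab = proj₁ (occurs-once (identityTail-unique n) (a ++ (true , suc i) ∷ b) d w≡)
      i∉b : suc i ∉ idx b
      i∉b i∈ = i∉bc (subst (suc i ∈_) (trans (sym (List.map-++ proj₂ b _)) (cong idx (sym bc≡))) (∈-++⁺ˡ i∈))
      i∉d : suc i ∉ idx d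
      i∉d i∈ = i∉bc (subst (suc i ∈_) (trans (sym (List.map-++ proj₂ b _)) (cong idx (sym bc≡)))
          (∈-++⁺ʳ (idx b) (there i∈)))
      j∉a : suc j ∉ idx a
      j∉a j∈ = j∉ab (subst (suc j ∈_) (sym (List.map-++ proj₂ a _)) (∈-++⁺ˡ j∈))
      xy = x ++ (true , suc j) ∷ y
      i-once = occurs-once unique xy z (sym (List.++-assoc x ((true , suc j) ∷ y) _))
      j-once = occurs-once unique x (y ++ (true , suc i) ∷ z) refl
      j∉y : suc j ∉ idx y
      j∉y j∈ = proj₂ j-once (subst (suc j ∈_) (sym (List.map-++ proj₂ y _)) (∈-++⁺ˡ j∈))
      j∉z : suc j ∉ idx z
      j∉z j∈ = proj₂ j-once (subst (suc j ∈_) (sym (List.map-++ proj₂ y _)) (∈-++⁺ʳ (idx y) (there j∈)))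
      i∉x : suc i ∉ idx x
      i∉x i∈ = proj₁ i-once (subst (suc i ∈_) (sym (List.map-++ proj₂ x _)) (∈-++⁺ˡ i∈))
      i∉y : suc i ∉ idx y
      i∉y i∈ = proj₁ i-once (subst (suc i ∈_) (sym (List.map-++ proj₂ x _)) (∈-++⁺ʳ (idx x) (there i∈)))
      swap : ∀ (t : Vec G n) u v → (t [ j ]≔ v) [ i ]≔ u ≡ (t [ i ]≔ u) [ j ]≔ v
      swap t u v = Vec.[]≔-commutes t j i (λ { refl → j≢i refl })
      left : ∀ t u v → eval (c ∷ ((t [ j ]≔ v) [ i ]≔ u)) (identityTail n) ≡
                       eval (c ∷ t) a ∙ u ∙ eval (c ∷ t) b ∙ v ∙ eval (c ∷ t) d
      left t u v = begin
        eval (c ∷ ((t [ j ]≔ v) [ i ]≔ u)) (identityTail n)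
          ≡⟨ cong₂ (λ t w → eval (c ∷ t) w) (swap t u v) w≡ ⟩
        eval ((c ∷ (t [ i ]≔ u)) [ suc j ]≔ v) ((a ++ (true , suc i) ∷ b) ++ (true , suc j) ∷ d)
          ≡⟨ eval-occurrence (c ∷ (t [ i ]≔ u)) v (a ++ (true , suc i) ∷ b) d j∉ab j∉d ⟩
        eval (c ∷ (t [ i ]≔ u)) (a ++ (true , suc i) ∷ b) ∙ v ∙ eval (c ∷ (t [ i ]≔ u)) d
          ≡⟨ cong₂ (λ p q → p ∙ v ∙ q) (eval-occurrence (c ∷ t) u a b i∉a i∉b) (eval-update-∉ (c ∷ t) u d i∉d) ⟩
        eval (c ∷ t) a ∙ u ∙ eval (c ∷ t) b ∙ v ∙ eval (c ∷ t) d ∎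
        where open ≡-Reasoning
      right : ∀ t u v → eval (c ∷ ((t [ j ]≔ v) [ i ]≔ u)) (x ++ (true , suc j) ∷ y ++ (true , suc i) ∷ z) ∙ h ≡
                        eval (c ∷ t) x ∙ v ∙ eval (c ∷ t) y ∙ u ∙ (eval (c ∷ t) z ∙ h)
      right t u v = begin
        eval (c ∷ ((t [ j ]≔ v) [ i ]≔ u)) (x ++ (true , suc j) ∷ y ++ (true , suc i) ∷ z) ∙ h
          ≡⟨ cong (λ w → eval (c ∷ ((t [ j ]≔ v) [ i ]≔ u)) w ∙ h) (sym (List.++-assoc x ((true , suc j) ∷ y) _)) ⟩
        eval ((c ∷ (t [ j ]≔ v)) [ suc i ]≔ u) (xy ++ (true , suc i) ∷ z) ∙ h
          ≡⟨ cong (_∙ h) (eval-occurrence (c ∷ (t [ j ]≔ v)) u xy z (proj₁ i-once) (proj₂ i-once)) ⟩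
        eval (c ∷ (t [ j ]≔ v)) xy ∙ u ∙ eval (c ∷ (t [ j ]≔ v)) z ∙ h
          ≡⟨ cong₂ (λ p q → p ∙ u ∙ q ∙ h) (eval-occurrence (c ∷ t) v x y (proj₁ j-once) j∉y)
              (eval-update-∉ (c ∷ t) v z j∉z) ⟩
        eval (c ∷ t) x ∙ v ∙ eval (c ∷ t) y ∙ u ∙ eval (c ∷ t) z ∙ h
          ≡⟨ assoc _ _ _ ⟩
        eval (c ∷ t) x ∙ v ∙ eval (c ∷ t) y ∙ u ∙ (eval (c ∷ t) z ∙ h) ∎
        where open ≡-Reasoning
      pointwise : ∀ t → _ ≤ commutingPairs
      pointwise t = ≤-trans
        (≤-reflexive (∑-cong (λ v → ∑-cong (λ u → 𝟙-cong (_ Fin.≟ _)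
          (eval (c ∷ t) a ∙ u ∙ eval (c ∷ t) b ∙ v ∙ eval (c ∷ t) d Fin.≟
           eval (c ∷ t) x ∙ v ∙ eval (c ∷ t) y ∙ u ∙ (eval (c ∷ t) z ∙ h))
          (λ e → trans (sym (left t u v)) (trans e (right t u v)))
          (λ e → trans (left t u v) (trans e (sym (right t u v))))) all) all))
        (interleaved-solutions (eval (c ∷ t) a) (eval (c ∷ t) b) (eval (c ∷ t) d)
                               (eval (c ∷ t) x) (eval (c ∷ t) y) (eval (c ∷ t) z ∙ h))

    IsRotation : ∀ {n} → Word (suc n) → Set
    IsRotation w = ∃[ j ] w ≡ rotation j

    positive-bound : ∀ {n} (w : Word (suc n)) → IsPermutation w → (true , zero) ∈ w →
                     IsRotation w ⊎ (∀ h g → Rare n (solutions h g w))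
    positive-bound {n} w perm 0∈ with split (proj₁ perm) 0∈
    ... | p , r , refl , 0∉p , 0∉r = go (classify p r perm′)
      where
      perm′ : IsPermutation (r ++ (true , zero) ∷ p)
      perm′ = IsPermutation-resp-↭ (Perm.map⁺ proj₂ (↭-trans (Perm.++-comm p ((true , zero) ∷ r))
                (↭-sym (Perm.shift (true , zero) r p)))) perm
      -- From p z r = g comes z⁻¹ = r g⁻¹ p, and the product of the other letters is z⁻¹ h; this is
      -- why `zero` is assigned g⁻¹.
      equation : ∀ h g z t → eval (z ∷ t) (identityWord n) ≡ h → eval (z ∷ t) (p ++ (true , zero) ∷ r) ≡ g →
                 eval (g ⁻¹ ∷ t) (identityTail n) ≡ eval (g ⁻¹ ∷ t) (r ++ (true , zero) ∷ p) ∙ h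
      equation h g z t refl refl = sym (begin
        eval (g ⁻¹ ∷ t) (r ++ (true , zero) ∷ p) ∙ (z ∙ i)
          ≡⟨ cong (_∙ (z ∙ i)) (trans (eval-++ (g ⁻¹ ∷ t) r _)
               (cong₂ (λ u v → u ∙ (g ⁻¹ ∙ v)) (eval-head t (g ⁻¹) z r 0∉r) (eval-head t (g ⁻¹) z p 0∉p))) ⟩
        r′ ∙ (g ⁻¹ ∙ p′) ∙ (z ∙ i)
          ≡⟨ cong (λ g → r′ ∙ (g ⁻¹ ∙ p′) ∙ (z ∙ i)) (eval-++ (z ∷ t) p _) ⟩
        r′ ∙ ((p′ ∙ (z ∙ r′)) ⁻¹ ∙ p′) ∙ (z ∙ i)
          ≡⟨ group-solve 4 (λ r p z i → r ⊙ (inv (p ⊙ (z ⊙ r)) ⊙ p) ⊙ (z ⊙ i) ≐ i) refl r′ p′ z i ⟩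
        i
          ≡⟨ eval-head t z (g ⁻¹) (identityTail n) (zero∉identityTail n) ⟩
        eval (g ⁻¹ ∷ t) (identityTail n) ∎)
        where
        open ≡-Reasoning
        r′ = eval (z ∷ t) r
        p′ = eval (z ∷ t) p
        i  = eval (z ∷ t) (identityTail n)
      reduce : ∀ h g → solutions h g (p ++ (true , zero) ∷ r) ≤
        ∑ (tuples n) (λ t → 𝟙 (eval (g ⁻¹ ∷ t) (identityTail n) Fin.≟ eval (g ⁻¹ ∷ t) (r ++ (true , zero) ∷ p) ∙ h))
      reduce h g = eliminate h (λ t → eval t (p ++ (true , zero) ∷ r) Fin.≟ g) (λ t → _ Fin.≟ _) (equation h g)
      go : Shape p r → IsRotation (p ++ (true , zero) ∷ r) ⊎ (∀ h g → Rare n (solutions h g (p ++ (true , zero) ∷ r)))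
      go (square i x y eq) = inj₂ λ h g → Rare-≤ {n} (reduce h g) (subst
        (λ w → Rare n (∑ (tuples n) (λ t → 𝟙 (eval (g ⁻¹ ∷ t) (identityTail n) Fin.≟ eval (g ⁻¹ ∷ t) w ∙ h)))) (sym eq)
        (tail-square (g ⁻¹) i x y h (proj₁ (once x y eq)) (proj₂ (once x y eq))))
        where once = occurs-once (proj₁ perm′)
      go (crossing i j x y z i<j eq) = inj₂ λ h g → Rare-≤ {n} (reduce h g) (subst
        (λ w → Rare n (∑ (tuples n) (λ t → 𝟙 (eval (g ⁻¹ ∷ t) (identityTail n) Fin.≟ eval (g ⁻¹ ∷ t) w ∙ h)))) (sym eq)
        (tail-crossing (g ⁻¹) i j x y z h i<j (subst (Unique ∘ idx) eq (proj₁ perm′))))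
      go (rotated eq) = inj₁ (rotated⇒rotation p r eq)

    -- If `zero` occurs inverted, the inverse word is treated instead, with g replaced by g⁻¹; this
    -- is the source of the inverted rotations.
    permutation-bound : ∀ {n} (w : Word (suc n)) → IsPermutation w →
      IsRotation w ⊎ (∃[ j ] w ≡ inverse (rotation j)) ⊎ (∀ h g → Rare n (solutions h g w))
    permutation-bound {n} w perm with ∈-map⁻ proj₂ (proj₂ perm zero)
    ... | (true , _) , 0∈ , refl with positive-bound w perm 0∈
    ...   | inj₁ rot  = inj₁ rot
    ...   | inj₂ rare = inj₂ (inj₂ rare)
    permutation-bound {n} w perm | (false , _) , 0∈ , refl
      with positive-bound (inverse w) (IsPermutation-resp-↭ (↭-sym (idx-inverse w)) perm) (∈-inverse w 0∈)
      where
      ∈-inverse : ∀ (w : Word (suc n)) {i} → (false , i) ∈ w → (true , i) ∈ inverse w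
      ∈-inverse (_ ∷ w) (here refl) = ∈-++⁺ʳ (inverse w) (here refl)
      ∈-inverse (_ ∷ w) (there i∈) = ∈-++⁺ˡ (∈-inverse w i∈)
    ...   | inj₁ (j , eq) = inj₂ (inj₁ (j , trans (sym (inverse-involutive w)) (cong inverse eq)))
    ...   | inj₂ rare     = inj₂ (inj₂ λ h g → Rare-≤ {n}
            (≤-trans (≤-reflexive (cong (solutions h g) (sym (inverse-involutive w))))
                (solutions-inverse h g (inverse w)))
            (rare h (g ⁻¹)))

    -- With the tail cut as a b, the conditions are z a b = h and b z a = g, so that b h = g b. The
    -- part b is nonempty, and `intertwiners` confines one of its letters.
    rotation-bound : ∀ {n} (j : Fin n) h → centralizer h ≤ ρ → ∀ g → Rare n (solutions h g (rotation (suc j)))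
    rotation-bound {n} j h C≤ρ g = Rare-≤ {n}
      (eliminate h (λ t → eval t (rotation (suc j)) Fin.≟ g) (λ t → eval (ε ∷ t) b ∙ h Fin.≟ g ∙ eval (ε ∷ t) b)
          equation) rare
      where
      k = toℕ j
      a = take k (identityTail n)
      b = drop k (identityTail n)
      ab≡ : a ++ b ≡ identityTail n
      ab≡ = List.take++drop≡id k (identityTail n)
      0∉b : zero ∉ idx b
      0∉b 0∈ = zero∉identityTail n (subst (λ w → zero ∈ idx w) ab≡
        (subst (zero ∈_) (sym (List.map-++ proj₂ a b)) (∈-++⁺ʳ (idx a) 0∈)))
      equation : ∀ z t → eval (z ∷ t) (identityWord n) ≡ h → eval (z ∷ t) (rotation (suc j)) ≡ g →
                 eval (ε ∷ t) b ∙ h ≡ g ∙ eval (ε ∷ t) b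
      equation z t refl refl = begin
        eval (ε ∷ t) b ∙ (z ∙ eval (z ∷ t) (identityTail n))
          ≡⟨ cong₂ (λ p q → p ∙ (z ∙ q)) (eval-head t ε z b 0∉b)
               (trans (cong (eval (z ∷ t)) (sym ab≡)) (eval-++ (z ∷ t) a b)) ⟩
        b′ ∙ (z ∙ (a′ ∙ b′))
          ≡⟨ group-solve 3 (λ a b z → b ⊙ (z ⊙ (a ⊙ b)) ≐ b ⊙ (z ⊙ a) ⊙ b) refl a′ b′ z ⟩
        b′ ∙ (z ∙ a′) ∙ b′
          ≡⟨ cong₂ _∙_ (eval-++ (z ∷ t) b ((true , zero) ∷ a)) (eval-head t ε z b 0∉b) ⟨
        eval (z ∷ t) (rotation (suc j)) ∙ eval (ε ∷ t) b ∎
        where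
        open ≡-Reasoning
        a′ = eval (z ∷ t) a
        b′ = eval (z ∷ t) b
      b-unique : Unique (idx b)
      b-unique = suffix (idx a) (subst Unique (trans (cong idx (sym ab≡)) (List.map-++ proj₂ a b))
          (identityTail-unique n))
        where
        suffix : ∀ (xs : List (Fin (suc n))) {ys} → Unique (xs ++ ys) → Unique ys
        suffix []       u       = u
        suffix (_ ∷ xs) (_ ∷ u) = suffix xs u
      b-nonempty : ∃[ i ] (true , suc i) ∈ b
      b-nonempty = go b refl
        where
        go : ∀ l → b ≡ l → ∃[ i ] (true , suc i) ∈ b
        go []      eq = ⊥-elim (ℕ.<-irrefl (sym (trans (sym (List.length-drop k (identityTail n))) (cong length eq)))
          (ℕ.m<n⇒0<n∸m (subst (k ℕ.<_) (sym (trans (List.length-map _ (allFin n)) (List.length-tabulate id)))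
              (Fin.toℕ<n j))))
        go (x ∷ l) eq with identityTail-∈ (subst (x ∈_) ab≡ (∈-++⁺ʳ a (subst (x ∈_) (sym eq) (here refl))))
        ... | i , refl = i , subst (_ ∈_) (sym eq) (here refl)
      rare : Rare n (∑ (tuples n) (λ t → 𝟙 (eval (ε ∷ t) b ∙ h Fin.≟ g ∙ eval (ε ∷ t) b)))
      rare with b-nonempty
      ... | i , i∈b with split b-unique i∈b
      ...   | x , y , eq , i∉x , i∉y = fibre-bound i _ ρ λ t → ≤-trans
          (≤-reflexive (∑-cong (λ u → cong (λ v → 𝟙 (v ∙ h Fin.≟ g ∙ v))
            (trans (cong (eval (ε ∷ (t [ i ]≔ u))) eq) (eval-occurrence (ε ∷ t) u x y i∉x i∉y))) all))
          (≤-trans (intertwiners (eval (ε ∷ t) x) (eval (ε ∷ t) y) h g) C≤ρ)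

    clash : ∀ {n} → G → Bool → Fin (suc n) → Fin (suc n) → ℝ
    clash h b i j = constrained h (λ t → lookup t i Fin.≟ sgn b (lookup t j))

    -- A clash of two tail letters fixes one by the other. If letter `zero` equals t_j, substitution
    -- leaves t_j with opposite signs on the two sides. If it equals t_j⁻¹, the tail must equal t_j
    -- h, a linear condition on any other tail letter.
    clash-bound : ∀ {n} h → h ≢ ε → ∀ b (i j : Fin (suc n)) → i Fin.< j → Rare n (clash h b i j)
    clash-bound {n} h h≢ε b (suc i) (suc j) (s≤s i<j) = Rare-≤ {n}
      (eliminate h (λ t → lookup t (suc i) Fin.≟ sgn b (lookup t (suc j)))
          (λ t → lookup t i Fin.≟ sgn b (lookup t j)) (λ _ _ _ eq → eq))
      (fibre-bound i _ ρ λ t → ≤-trans (∑-𝟙≤1 (λ x → lookup (t [ i ]≔ x) i Fin.≟ sgn b (lookup (t [ i ]≔ x) j))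
        (sgn b (lookup t j)) λ {x} eq → trans (sym (Vec.lookup∘update i t x))
        (trans eq (cong (sgn b) (Vec.lookup∘update′ (λ { refl → ℕ.<-irrefl refl i<j }) t x)))) 1≤ρ)
    clash-bound {n} h h≢ε true zero (suc j) _ = Rare-≤ {n}
      (eliminate h (λ t → lookup t zero Fin.≟ lookup t (suc j))
        (λ t → eval (ε ∷ t) (identityTail n) Fin.≟ eval (ε ∷ t) ((false , suc j) ∷ []) ∙ h) equation)
            (tail-square ε j [] [] h (λ ()) (λ ()))
      where
      equation : ∀ z t → eval (z ∷ t) (identityWord n) ≡ h → z ≡ lookup t j →
                 eval (ε ∷ t) (identityTail n) ≡ (lookup t j ⁻¹ ∙ ε) ∙ h
      equation z t refl refl = trans (eval-head t ε z (identityTail n) (zero∉identityTail n))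
        (sym (trans (cong (_∙ (z ∙ eval (z ∷ t) (identityTail n))) (identityʳ (z ⁻¹)))
            (group-solve 2 (λ z i → inv z ⊙ (z ⊙ i) ≐ i) refl z (eval (z ∷ t) (identityTail n)))))
    clash-bound {n} h h≢ε false zero (suc j) _ = Rare-≤ {n}
      (eliminate h (λ t → lookup t zero Fin.≟ lookup t (suc j) ⁻¹) (Q? j) equation) (rare j)
      where
      Q? : ∀ {n} (j : Fin n) t → Dec (eval (ε ∷ t) (identityTail n) ≡ lookup t j ∙ h)
      Q? j t = _ Fin.≟ _
      equation : ∀ z t → eval (z ∷ t) (identityWord n) ≡ h → z ≡ lookup t j ⁻¹ →
                 eval (ε ∷ t) (identityTail n) ≡ lookup t j ∙ h
      equation z t refl refl = trans (eval-head t ε z (identityTail n) (zero∉identityTail n))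
        (group-solve 2 (λ x i → i ≐ x ⊙ (inv x ⊙ i)) refl (lookup t j) (eval (z ∷ t) (identityTail n)))
      other : ∀ {n} (i j : Fin n) → i ≢ j → Rare n (∑ (tuples n) (𝟙 ∘ Q? j))
      other {n} i j i≢j with split (identityTail-unique n) (∈-identityTail i)
      ... | x , y , eq , i∉x , i∉y = fibre-bound i _ ρ λ t → ≤-trans
        (∑-mono (λ u → 𝟙-mono (Q? j (t [ i ]≔ u)) (eval (ε ∷ t) x ∙ u ∙ eval (ε ∷ t) y Fin.≟ lookup t j ∙ h) λ e →
          trans (sym (trans (cong (eval (ε ∷ (t [ i ]≔ u))) eq) (eval-occurrence (ε ∷ t) u x y i∉x i∉y)))
            (trans e (cong (_∙ h) (Vec.lookup∘update′ (i≢j ∘ sym) t u)))) all)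
        (≤-trans (linear-solutions (eval (ε ∷ t) x) (eval (ε ∷ t) y) (lookup t j ∙ h)) 1≤ρ)
      rare : ∀ {n} (j : Fin n) → Rare n (∑ (tuples n) (𝟙 ∘ Q? j))
      -- There is no other tail letter, and the condition reads t = t h, which h ≠ ε forbids.
      rare {1} zero = fibre-bound zero _ ρ λ t → ≤-trans
        (≤-reflexive (trans (∑-cong (λ u → 𝟙-no (Q? zero (t [ zero ]≔ u)) (never (t [ zero ]≔ u))) all)
            (∑-zero all))) 0≤ρ
        where
        never : ∀ (t : Vec G 1) → eval (ε ∷ t) (identityTail 1) ≢ lookup t zero ∙ h
        never t e = h≢ε (sym (∙-cancelˡ (lookup t zero) _ _ e))
      rare {suc (suc n)} zero    = other (suc zero) zero λ ()
      rare {suc (suc n)} (suc j) = other zero (suc j) λ ()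

-- Good words and representatives of their letter sets.

-- A missed value `k` could be punched out, giving an injection into a smaller set.
injective⇒surjective : ∀ {n} (f : Fin (suc n) → Fin (suc n)) → (∀ {i j} → f i ≡ f j → i ≡ j) → ∀ k → ∃[ i ] f i ≡ k
injective⇒surjective f inj k with Fin.any? (λ i → f i Fin.≟ k)
... | yes found = found
... | no  none  = ⊥-elim (ℕ.1+n≰n (Fin.injective⇒≤ {f = λ i → punchOut (k≢f i)}
                    (λ {i} {j} eq → inj (Fin.punchOut-injective (k≢f i) (k≢f j) eq))))
  where
  k≢f : ∀ i → k ≢ f i
  k≢f i eq = none (i , sym eq)

-- Greedy from the right: an element is kept unless a kept one already lies below it. Hence the
-- condition on pairs is one-sided.
maximal-antichain : ∀ {A : Set} {_⊑_ : Rel A 0ℓ} → Decidable₂ _⊑_ → (∀ {x} → x ⊑ x) → ∀ xs →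
  ∃[ ys ] (ys ⊆ xs × AllPairs (λ x y → ¬ y ⊑ x) ys × All (λ x → Any.Any (_⊑ x) ys) xs)
maximal-antichain _⊑?_ ⊑-refl []       = [] , [] , [] , []
maximal-antichain {_⊑_ = _⊑_} _⊑?_ ⊑-refl (x ∷ xs) with maximal-antichain _⊑?_ ⊑-refl xs
... | ys , ys⊆xs , pairs , covers with Any.any? (_⊑? x) ys
...   | yes covered = ys , x ∷ʳ ys⊆xs , pairs , covered ∷ covers
...   | no  ¬covered = x ∷ ys , refl ∷ ys⊆xs ,
          (All.tabulate (λ y∈ys y⊑x → ¬covered (Any.map (λ { refl → y⊑x }) y∈ys)) ∷ pairs) ,
          here ⊑-refl ∷ All.map there covers

module Family (R : Reals) {N : ℕ} (𝔾 : FinGroup N) where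
  open Reals R hiding (_⁻¹; _≟_)
  open OrderedField R
  open Sums R
  open Words 𝔾
  open GroupCounting R 𝔾
  open WordCounting R 𝔾

  -- Signs and elements are kept apart: the product condition concerns the elements t_i, whereas
  -- membership in the random set concerns the letters t_i^{e_i}.
  Sample : ℕ → Set
  Sample n = Vec Bool n × Vec G n

  module Signs = Vectors Bool-enumeration

  samples : ∀ n → Enumeration (Sample n)
  samples n = Signs.Vec-enumeration n ×-enumeration Vec-enumeration n

  letters : ∀ {n} → Sample n → Vec G n
  letters (e , t) = Vec.zipWith sgn e t

  lookup-letters : ∀ {n} (f : Sample n) i → lookup (letters f) i ≡ sgn (lookup (proj₁ f) i) (lookup (proj₂ f) i)
  lookup-letters (e , t) i = Vec.lookup-zipWith sgn i e t

  infix 4 _⊑_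
  -- Inclusion of letter sets. Between good words, whose letters are distinct, it amounts to
  -- equality of these sets.
  _⊑_ : ∀ {n} → Rel (Sample n) 0ℓ
  f ⊑ w = ∀ i → ∃[ k ] lookup (letters f) i ≡ lookup (letters w) k

  _⊑?_ : ∀ {n} → Decidable₂ (_⊑_ {n})
  f ⊑? w = Fin.all? λ i → Fin.any? λ k → lookup (letters f) i Fin.≟ lookup (letters w) k

  product : List G → G
  product = foldr _∙_ ε

  eval-product : ∀ {n} (t : Vec G n) w → eval t w ≡ product (map (λ (b , i) → sgn b (lookup t i)) w)
  eval-product t []      = refl
  eval-product t (a ∷ w) = cong (_ ∙_) (eval-product t w)

  eval-identityWord : ∀ {n} (t : Vec G (suc n)) → eval t (identityWord n) ≡ product (toList t)
  eval-identityWord {n} t@(x ∷ xs) = trans (eval-product t (identityWord n)) (cong (λ l → x ∙ product l) (begin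
    map (λ (b , i) → sgn b (lookup t i)) (map (λ i → true , suc i) (allFin n))   ≡⟨ List.map-∘ (allFin n) ⟨
    map (lookup xs) (allFin n)                                                  ≡⟨ List.map-tabulate id (lookup xs) ⟩
    tabulate (lookup xs)                                         ≡⟨ toList-tabulate xs ⟨
    toList xs                                                                   ∎))
    where
    open ≡-Reasoning
    toList-tabulate : ∀ {m} (v : Vec G m) → toList v ≡ tabulate (lookup v)
    toList-tabulate []      = refl
    toList-tabulate (y ∷ v) = cong (y ∷_) (toList-tabulate v)

  -- J lists the rotations that may fix h for many words: all of them, or the trivial one only.
  module Target {n : ℕ} (h : G) (h≢ε : h ≢ ε) {ρ : ℝ} (1≤ρ : 1# ≤ ρ) (Z≤ρ² : commutingPairs ≤ ρ * ρ)
                (Z≤Nρ : commutingPairs ≤ fromℕ N * ρ) (0<N : 0# < fromℕ N)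
                (J : List (Fin (suc n))) (J-large : ∀ j → j ∈ J ⊎ (∃[ i ] j ≡ suc i) × centralizer h ≤ ρ) where
    open Bounded 1≤ρ Z≤ρ² Z≤Nρ 0<N

    d : ℕ
    d = suc n

    module Patterns = Vectors (Bool-enumeration ×-enumeration Fin-enumeration d)

    patterns : Enumeration (Vec (Bool × Fin d) d)
    patterns = Patterns.Vec-enumeration d

    letter≟ : DecidableEquality (Bool × Fin d)
    letter≟ = Product.≡-dec Bool._≟_ Fin._≟_

    Allowed : Word d → Set
    Allowed w = Any.Any (λ j → w ≡ rotation j ⊎ w ≡ inverse (rotation j)) J

    allowed? : ∀ w → Dec (Allowed w)
    allowed? w = Any.any? (λ j → List.≡-dec letter≟ w (rotation j) ⊎-dec List.≡-dec letter≟ w (inverse (rotation j))) J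

    permutation? : ∀ (w : Word d) → Dec (IsPermutation w)
    permutation? w = DecUnique.unique? Fin._≟_ (idx w) ×-dec Fin.all? (λ i → ListMembership._∈?_ Fin._≟_ i (idx w))

    Irregular : Vec (Bool × Fin d) d → Set
    Irregular W = IsPermutation (toList W) × ¬ Allowed (toList W)

    irregular? : ∀ W → Dec (Irregular W)
    irregular? W = permutation? (toList W) ×-dec ¬? (allowed? (toList W))

    irregular-rare : ∀ W → Irregular W → Rare n (solutions h h (toList W))
    irregular-rare W (perm , ¬allowed) with permutation-bound (toList W) perm
    ... | inj₂ (inj₂ rare) = rare h h
    ... | inj₁ (j , eq) with J-large j
    ...   | inj₁ j∈J               = ⊥-elim (¬allowed (Any.map (λ { refl → inj₁ eq }) j∈J))
    ...   | inj₂ ((i , refl) , C≤) = subst (λ w → Rare n (solutions h h w)) (sym eq) (rotation-bound i h C≤ h)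
    irregular-rare W (perm , ¬allowed) | inj₂ (inj₁ (j , eq)) with J-large j
    ...   | inj₁ j∈J               = ⊥-elim (¬allowed (Any.map (λ { refl → inj₂ eq }) j∈J))
    ...   | inj₂ ((i , refl) , C≤) = subst (λ w → Rare n (solutions h h w)) (sym eq)
                                       (Rare-≤ {n} (solutions-inverse h h (rotation (suc i)))
                                           (rotation-bound i h C≤ (h ⁻¹)))

    irregularTerm : Vec G d → Vec (Bool × Fin d) d → ℝ
    irregularTerm t W = 𝟙 (irregular? W) * 𝟙 (eval t (toList W) Fin.≟ h)

    clashTerm : Vec G d → Bool → Fin d → Fin d → ℝ
    clashTerm t b i j = 𝟙 (i Fin.<? j) * 𝟙 (lookup t i Fin.≟ sgn b (lookup t j))

    clashRow : Vec G d → Bool → Fin d → ℝ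
    clashRow t b i = ∑ (allFin d) (clashTerm t b i)

    clashRows : Vec G d → Bool → ℝ
    clashRows t b = ∑ (allFin d) (clashRow t b)

    irregularities clashes bad : Vec G d → ℝ
    irregularities t = ∑ (Enumeration.elements patterns) (irregularTerm t)
    clashes t = ∑ (true ∷ false ∷ []) (clashRows t)
    bad t = irregularities t + clashes t

    -- `bad` is a sum of indicators, so staying below 1 excludes every irregular pattern and every
    -- clash at once; being a sum, it can be estimated term by term over all words.
    Good : Vec G d → Set
    Good t = eval t (identityWord n) ≡ h × ¬ 1# ≤ bad t

    good? : ∀ t → Dec (Good t)
    good? t = eval t (identityWord n) Fin.≟ h ×-dec ¬? (1# ≤? bad t)

    irregularTerm-nonneg : ∀ t W → 0# ≤ irregularTerm t W
    irregularTerm-nonneg t W = *-nonneg (𝟙-nonneg (irregular? W)) (𝟙-nonneg (eval t (toList W) Fin.≟ h))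

    irregularities-nonneg : ∀ t → 0# ≤ irregularities t
    irregularities-nonneg t = ∑-nonneg {f = irregularTerm t} (irregularTerm-nonneg t) (Enumeration.elements patterns)

    clashTerm-nonneg : ∀ t b i j → 0# ≤ clashTerm t b i j
    clashTerm-nonneg t b i j = *-nonneg (𝟙-nonneg (i Fin.<? j)) (𝟙-nonneg (lookup t i Fin.≟ sgn b (lookup t j)))

    clashRow-nonneg : ∀ t b i → 0# ≤ clashRow t b i
    clashRow-nonneg t b i = ∑-nonneg {f = clashTerm t b i} (clashTerm-nonneg t b i) (allFin d)

    clashRows-nonneg : ∀ t b → 0# ≤ clashRows t b
    clashRows-nonneg t b = ∑-nonneg {f = clashRow t b} (clashRow-nonneg t b) (allFin d)

    clashes-nonneg : ∀ t → 0# ≤ clashes t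
    clashes-nonneg t = ∑-nonneg {f = clashRows t} (clashRows-nonneg t) (true ∷ false ∷ [])

    good⇒regular : ∀ t → Good t → ∀ W → Irregular W → eval t (toList W) ≢ h
    good⇒regular t (_ , ¬bad) W irr eq = ¬bad (begin
      1#                   ≡⟨ *-identityˡ 1# ⟨
      1# * 1#              ≡⟨ cong₂ _*_ (𝟙-yes (irregular? W) irr) (𝟙-yes (eval t (toList W) Fin.≟ h) eq) ⟨
      irregularTerm t W    ≤⟨ Enumeration.term≤∑ patterns {irregularTerm t} (irregularTerm-nonneg t) W ⟩
      irregularities t     ≤⟨ x≤x+y (clashes-nonneg t) ⟩
      bad t                ∎)
      where open ≤-Reasoning

    good⇒no-clash : ∀ t → Good t → ∀ b i j → i Fin.< j → lookup t i ≢ sgn b (lookup t j)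
    good⇒no-clash t (_ , ¬bad) b i j i<j eq = ¬bad (begin
      1#                   ≡⟨ *-identityˡ 1# ⟨
      1# * 1#              ≡⟨ cong₂ _*_ (𝟙-yes (i Fin.<? j) i<j) (𝟙-yes (lookup t i Fin.≟ sgn b (lookup t j)) eq) ⟨
      clashTerm t b i j    ≤⟨ Enumeration.term≤∑ (Fin-enumeration d) {clashTerm t b i} (clashTerm-nonneg t b i) j ⟩
      clashRow t b i       ≤⟨ Enumeration.term≤∑ (Fin-enumeration d) {clashRow t b} (clashRow-nonneg t b) i ⟩
      clashRows t b        ≤⟨ Enumeration.term≤∑ Bool-enumeration {clashRows t} (clashRows-nonneg t) b ⟩
      clashes t            ≤⟨ x≤y+x (irregularities-nonneg t) ⟩
      bad t                ∎)
      where open ≤-Reasoning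

    -- (2d)^d counts all vectors of signed letters, an affordable overestimate for the signed
    -- permutations; 2d² counts the triples (b, i, j) of `clashTerm`.
    exceptions : ℝ
    exceptions = (fromℕ 2 * fromℕ d) ^ d + fromℕ 2 * (fromℕ d * fromℕ d)

    constant-bound : ∀ {A : Set} (xs : List A) (f : A → ℝ) {b} → (∀ x → f x ≤ b) → ∑ xs f ≤ fromℕ (length xs) * b
    constant-bound xs f {b} le = ≤-trans (∑-mono le xs) (≤-reflexive (∑-const b xs))

    N^n*ρ : ℝ
    N^n*ρ = fromℕ N ^ n * ρ

    0≤N^n*ρ : 0# ≤ N^n*ρ
    0≤N^n*ρ = *-nonneg (^-nonneg (<⇒≤ 0<N) n) 0≤ρ

    onTarget : Vec G d → ℝ
    onTarget t = 𝟙 (eval t (identityWord n) Fin.≟ h)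

    weighted-rare : ∀ {ℓ} {Q : Set ℓ} (Q? : Dec Q) (f : Vec G d → ℝ) →
      (Q → Rare n (∑ (tuples d) (λ t → onTarget t * f t))) →
      ∑ (tuples d) (λ t → fromℕ N * onTarget t * (𝟙 Q? * f t)) ≤ N^n*ρ
    weighted-rare Q? f rare = begin
      ∑ (tuples d) (λ t → fromℕ N * onTarget t * (𝟙 Q? * f t))
        ≡⟨ ∑-cong (λ t → solve 4 (λ n o q f → n :* o :* (q :* f) := q :* (n :* (o :* f))) refl (fromℕ N)
            (onTarget t) (𝟙 Q?) (f t)) (tuples d) ⟩
      ∑ (tuples d) (λ t → 𝟙 Q? * (fromℕ N * (onTarget t * f t)))
        ≡⟨ trans (∑-*ˡ (𝟙 Q?) (λ t → fromℕ N * (onTarget t * f t)) (tuples d))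
                 (cong (𝟙 Q? *_) (∑-*ˡ (fromℕ N) (λ t → onTarget t * f t) (tuples d))) ⟩
      𝟙 Q? * (fromℕ N * ∑ (tuples d) (λ t → onTarget t * f t))
        ≤⟨ 𝟙*-≤ Q? 0≤N^n*ρ rare ⟩
      N^n*ρ ∎
      where open ≤-Reasoning

    bad-bound : fromℕ N * ∑ (tuples d) (λ t → onTarget t * bad t) ≤ exceptions * N^n*ρ
    bad-bound = begin
      fromℕ N * ∑ (tuples d) (λ t → onTarget t * bad t)
        ≡⟨ ∑-*ˡ (fromℕ N) (λ t → onTarget t * bad t) (tuples d) ⟨
      ∑ (tuples d) (λ t → fromℕ N * (onTarget t * bad t))
        ≡⟨ trans (∑-cong (λ t → solve 4 (λ a b c e → a :* (b :* (c :+ e)) := a :* b :* c :+ a :* b :* e) refl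
                   (fromℕ N) (onTarget t) (irregularities t) (clashes t)) (tuples d))
                 (∑-+ (λ t → c t * irregularities t) (λ t → c t * clashes t) (tuples d)) ⟩
      ∑ (tuples d) (λ t → c t * irregularities t) + ∑ (tuples d) (λ t → c t * clashes t)
        ≡⟨ cong₂ _+_ (exchange irregularTerm (Enumeration.elements patterns))
             (trans (exchange clashRows (true ∷ false ∷ [])) (∑-cong (λ b → trans
                 (exchange (λ t → clashRow t b) (allFin d))
               (∑-cong (λ i → exchange (λ t → clashTerm t b i) (allFin d)) (allFin d))) (true ∷ false ∷ []))) ⟩
      ∑ (Enumeration.elements patterns) (λ W → ∑ (tuples d) (λ t → c t * irregularTerm t W)) +
      ∑ (true ∷ false ∷ []) (λ b → ∑ (allFin d) (λ i → ∑ (allFin d) (λ j → ∑ (tuples d)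
          (λ t → c t * clashTerm t b i j))))
        ≤⟨ +-mono-≤
             (constant-bound (Enumeration.elements patterns) (λ W → ∑ (tuples d) (λ t → c t * irregularTerm t W))
               (λ W → weighted-rare (irregular? W) (λ t → 𝟙 (eval t (toList W) Fin.≟ h)) (irregular-rare W)))
             (constant-bound (true ∷ false ∷ []) (λ b → ∑ (allFin d) (λ i → ∑ (allFin d)
                 (λ j → ∑ (tuples d) (λ t → c t * clashTerm t b i j))))
               (λ b → constant-bound (allFin d) (λ i → ∑ (allFin d) (λ j → ∑ (tuples d)
                   (λ t → c t * clashTerm t b i j)))
                 (λ i → constant-bound (allFin d) (λ j → ∑ (tuples d) (λ t → c t * clashTerm t b i j))
                   (λ j → weighted-rare (i Fin.<? j) (λ t → 𝟙 (lookup t i Fin.≟ sgn b (lookup t j)))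
                       (clash-bound h h≢ε b i j))))) ⟩
      Enumeration.size patterns * N^n*ρ + fromℕ 2 * (fromℕ (length (allFin d)) * (fromℕ (length (allFin d)) * N^n*ρ))
        ≡⟨ cong₂ (λ a b → a * N^n*ρ + fromℕ 2 * (b * (b * N^n*ρ)))
             (trans (Patterns.Vec-size d) (cong (_^ d) pattern-size)) (Fin-size d) ⟩
      (fromℕ 2 * fromℕ d) ^ d * N^n*ρ + fromℕ 2 * (fromℕ d * (fromℕ d * N^n*ρ))
        ≡⟨ solve 4 (λ a t d r → a :* r :+ t :* (d :* (d :* r)) := (a :+ t :* (d :* d)) :* r) refl
            ((fromℕ 2 * fromℕ d) ^ d) (fromℕ 2) (fromℕ d) N^n*ρ ⟩
      exceptions * N^n*ρ ∎
      where
      open ≤-Reasoning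
      c : Vec G d → ℝ
      c t = fromℕ N * onTarget t
      exchange : ∀ {A : Set} (f : Vec G d → A → ℝ) (xs : List A) →
                 ∑ (tuples d) (λ t → c t * ∑ xs (f t)) ≡ ∑ xs (λ x → ∑ (tuples d) (λ t → c t * f t x))
      exchange f xs = trans (∑-cong (λ t → sym (∑-*ˡ (c t) (f t) xs)) (tuples d))
          (∑-swap (λ t x → c t * f t x) (tuples d) xs)
      pattern-size : Enumeration.size (Bool-enumeration ×-enumeration Fin-enumeration d) ≡ fromℕ 2 * fromℕ d
      pattern-size = trans (sym (∑-1 (Enumeration.elements (Bool-enumeration ×-enumeration Fin-enumeration d))))
        (trans (∑-× Bool-enumeration (Fin-enumeration d) (λ _ → 1#))
          (trans (∑-const (∑ (allFin d) (λ _ → 1#)) (true ∷ false ∷ []))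
              (cong (fromℕ 2 *_) (trans (∑-1 (allFin d)) (Fin-size d)))))

    target-count : ∑ (tuples d) onTarget ≡ fromℕ N ^ n
    target-count = begin
      ∑ (tuples d) onTarget
        ≡⟨ ∑-vecs all n onTarget ⟩
      ∑ all (λ z → ∑ (tuples n) (λ t → onTarget (z ∷ t)))
        ≡⟨ ∑-swap (λ z t → onTarget (z ∷ t)) all (tuples n) ⟩
      ∑ (tuples n) (λ t → ∑ all (λ z → onTarget (z ∷ t)))
        ≡⟨ ∑-cong (λ t → trans (∑-cong (λ z → cong (λ u → 𝟙 (z ∙ u Fin.≟ h))
            (eval-head t z ε (identityTail n) (zero∉identityTail n))) all)
             (trans (∑-shiftʳ (eval (ε ∷ t) (identityTail n)) (λ x → 𝟙 (x Fin.≟ h))) (∑-𝟙≡ h))) (tuples n) ⟩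
      ∑ (tuples n) (λ _ → 1#)
        ≡⟨ trans (∑-1 (tuples n)) (trans (Vec-size n) (cong (_^ n) (Fin-size N))) ⟩
      fromℕ N ^ n ∎
      where open ≡-Reasoning

    -- Markov's inequality: a word with product `h` that is not good contributes at least 1 to the
    -- subtracted sum.
    good-count : fromℕ N ^ n - ∑ (tuples d) (λ t → onTarget t * bad t) ≤ ∑ (tuples d) (𝟙 ∘ good?)
    good-count = +-cancelʳ-≤ B (begin
      fromℕ N ^ n - B + B
        ≡⟨ solve 2 (λ a b → a :- b :+ b := a) refl (fromℕ N ^ n) B ⟩
      fromℕ N ^ n
        ≡⟨ target-count ⟨
      ∑ (tuples d) onTarget
        ≤⟨ ∑-mono pointwise (tuples d) ⟩
      ∑ (tuples d) (λ t → 𝟙 (good? t) + onTarget t * bad t)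
        ≡⟨ ∑-+ (𝟙 ∘ good?) (λ t → onTarget t * bad t) (tuples d) ⟩
      ∑ (tuples d) (𝟙 ∘ good?) + B ∎)
      where
      open ≤-Reasoning
      B = ∑ (tuples d) (λ t → onTarget t * bad t)
      pointwise : ∀ t → onTarget t ≤ 𝟙 (good? t) + onTarget t * bad t
      pointwise t with eval t (identityWord n) Fin.≟ h | 1# ≤? bad t
      ... | yes _ | yes 1≤bad = ≤-trans 1≤bad (≤-reflexive (solve 1 (λ b → b := κ 0 :+ κ 1 :* b) refl (bad t)))
      ... | yes _ | no  _     = x≤x+y (*-nonneg 0≤1 (+-nonneg (irregularities-nonneg t) (clashes-nonneg t)))
      ... | no  _ | _         = ≤-reflexive (solve 1 (λ b → κ 0 := κ 0 :+ κ 0 :* b) refl (bad t))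

    -- Equality of t_i^{e_i} and t_j^{e_j} means t_i = t_j^{e_i e_j}, which is a clash.
    letters-injective : ∀ f → Good (proj₂ f) → ∀ {i j} → lookup (letters f) i ≡ lookup (letters f) j → i ≡ j
    letters-injective f@(e , t) good {i} {j} eq with Fin.<-cmp i j
    ... | tri≈ _ i≡j _ = i≡j
    ... | tri< i<j _ _ = ⊥-elim (good⇒no-clash t good (lookup e i ⊗ lookup e j) i j i<j (relate i j eq))
      where
      relate : ∀ i j → lookup (letters f) i ≡ lookup (letters f) j →
          lookup t i ≡ sgn (lookup e i ⊗ lookup e j) (lookup t j)
      relate i j eq = trans (sym (sgn-involutive (lookup e i) (lookup t i))) (trans
        (cong (sgn (lookup e i)) (trans (sym (lookup-letters f i)) (trans eq (lookup-letters f j))))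
        (sym (sgn-⊗ (lookup e i) (lookup e j) (lookup t j))))
    ... | tri> _ _ j<i = ⊥-elim (good⇒no-clash t good (lookup e j ⊗ lookup e i) j i j<i (trans
        (sym (sgn-involutive (lookup e j) (lookup t j))) (trans
        (cong (sgn (lookup e j)) (trans (sym (lookup-letters f j)) (trans (sym eq) (lookup-letters f i))))
        (sym (sgn-⊗ (lookup e j) (lookup e i) (lookup t i))))))

    -- The sign is flipped and the element inverted together, so the letter t_i^{e_i} is unchanged
    -- and only the product condition is affected.
    act : Sample d → Bool × Fin d → Bool × G
    act (e , t) (b , i) = b ⊗ lookup e i , sgn b (lookup t i)

    flat : Sample d → List (Bool × G)
    flat (e , t) = toList (Vec.zip e t)

    flat-injective : ∀ {v w} → flat v ≡ flat w → v ≡ w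
    flat-injective {e , t} {e′ , t′} eq = cong₂ _,_
      (trans (sym (Vec.map-proj₁-zip e t)) (trans (cong (Vec.map proj₁) zips) (Vec.map-proj₁-zip e′ t′)))
      (trans (sym (Vec.map-proj₂-zip e t)) (trans (cong (Vec.map proj₂) zips) (Vec.map-proj₂-zip e′ t′)))
      where
      toList-inj : ∀ {m} {A : Set} (v w : Vec A m) → toList v ≡ toList w → v ≡ w
      toList-inj []      []      _  = refl
      toList-inj (x ∷ v) (y ∷ w) eq = cong₂ _∷_ (proj₁ (List.∷-injective eq))
          (toList-inj v w (proj₂ (List.∷-injective eq)))
      zips : Vec.zip e t ≡ Vec.zip e′ t′
      zips = toList-inj _ _ eq

    Matches : Sample d → Sample d → Fin d → Set
    Matches f w j = (eval (proj₂ f) (rotation j) ≡ h × flat w ≡ map (act f) (rotation j)) ⊎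
                    (eval (proj₂ f) (inverse (rotation j)) ≡ h × flat w ≡ map (act f) (inverse (rotation j)))

    -- Both words use the same letters, so w is the image of f under a signed permutation fixing the value h.
    same-letters : ∀ f w → Good (proj₂ f) → Good (proj₂ w) → f ⊑ w → Any.Any (Matches f w) J
    same-letters f@(e , t) w@(e′ , t′) good-f good-w f⊑w = conclude (allowed? (toList W))
      where
      pos : Fin d → Fin d
      pos i = proj₁ (f⊑w i)
      pos-injective : ∀ {i j} → pos i ≡ pos j → i ≡ j
      pos-injective {i} {j} eq = letters-injective f good-f
        (trans (proj₂ (f⊑w i)) (trans (cong (lookup (letters w)) eq) (sym (proj₂ (f⊑w j)))))
      -- Distinct letters make `pos` a permutation. `π` is its inverse, so that letter k of `w` is
      -- letter `π k` of `f`.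
      π : Fin d → Fin d
      π k = proj₁ (injective⇒surjective pos pos-injective k)
      π-letter : ∀ k → lookup (letters f) (π k) ≡ lookup (letters w) k
      π-letter k = trans (proj₂ (f⊑w (π k))) (cong (lookup (letters w)) (proj₂ (injective⇒surjective pos pos-injective k)))
      -- The sign for which `act f` carries entry k of the pattern to entry k of `w`.
      σ : Fin d → Bool
      σ k = lookup e′ k ⊗ lookup e (π k)
      W : Vec (Bool × Fin d) d
      W = Vec.tabulate (λ k → σ k , π k)
      ⊗-cancel : ∀ b c → (b ⊗ c) ⊗ c ≡ b
      ⊗-cancel true  true  = refl
      ⊗-cancel true  false = refl
      ⊗-cancel false true  = refl
      ⊗-cancel false false = refl
      act-W : ∀ k → act f (σ k , π k) ≡ (lookup e′ k , lookup t′ k)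
      act-W k = cong₂ _,_ (⊗-cancel (lookup e′ k) (lookup e (π k))) (begin
        sgn (σ k) (lookup t (π k))                             ≡⟨ sgn-⊗ (lookup e′ k) (lookup e (π k)) _ ⟩
        sgn (lookup e′ k) (sgn (lookup e (π k)) (lookup t (π k))) ≡⟨ cong (sgn (lookup e′ k)) (lookup-letters f (π k)) ⟨
        sgn (lookup e′ k) (lookup (letters f) (π k))           ≡⟨ cong (sgn (lookup e′ k))
            (trans (π-letter k) (lookup-letters w k)) ⟩
        sgn (lookup e′ k) (sgn (lookup e′ k) (lookup t′ k))     ≡⟨ sgn-involutive (lookup e′ k) (lookup t′ k) ⟩
        lookup t′ k                                            ∎)
        where open ≡-Reasoning
      flat-w : flat w ≡ map (act f) (toList W)
      flat-w = sym (begin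
        map (act f) (toList W)                                 ≡⟨ Vec.toList-map (act f) W ⟨
        toList (Vec.map (act f) W)                             ≡⟨ cong toList
            (Vec.tabulate-∘ (act f) (λ k → σ k , π k)) ⟨
        toList (Vec.tabulate (λ k → act f (σ k , π k)))        ≡⟨ cong toList
            (Vec.tabulate-cong (λ k → trans (act-W k) (sym (Vec.lookup-zip k e′ t′)))) ⟩
        toList (Vec.tabulate (lookup (Vec.zip e′ t′)))         ≡⟨ cong toList (Vec.tabulate∘lookup (Vec.zip e′ t′)) ⟩
        flat w                                                 ∎)
        where open ≡-Reasoning
      value : eval t (toList W) ≡ h
      value = begin
        eval t (toList W)                                      ≡⟨ eval-product t (toList W) ⟩
        product (map (λ (b , i) → sgn b (lookup t i)) (toList W)) ≡⟨ cong product (List.map-∘ (toList W)) ⟩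
        product (map proj₂ (map (act f) (toList W)))           ≡⟨ cong (product ∘ map proj₂) flat-w ⟨
        product (map proj₂ (toList (Vec.zip e′ t′)))           ≡⟨ cong product
            (trans (sym (Vec.toList-map proj₂ (Vec.zip e′ t′))) (cong toList (Vec.map-proj₂-zip e′ t′))) ⟩
        product (toList t′)                                    ≡⟨ eval-identityWord t′ ⟨
        eval t′ (identityWord n)                               ≡⟨ proj₁ good-w ⟩
        h                                                      ∎
        where open ≡-Reasoning
      toList∘tabulate : ∀ {m} {A : Set} (g : Fin m → A) → toList (Vec.tabulate g) ≡ tabulate g
      toList∘tabulate {zero}  g = refl
      toList∘tabulate {suc m} g = cong (g zero ∷_) (toList∘tabulate (g ∘ suc))
      idx-W : idx (toList W) ≡ tabulate π
      idx-W = trans (cong idx (toList∘tabulate (λ k → σ k , π k))) (List.map-tabulate (λ k → σ k , π k) proj₂)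
      permutation : IsPermutation (toList W)
      permutation =
        subst Unique (sym idx-W) (Unique.tabulate⁺ {f = π} (λ {k} {l} eq → letters-injective w good-w
          (trans (sym (π-letter k)) (trans (cong (lookup (letters f)) eq) (π-letter l))))) ,
        λ i → subst (i ∈_) (sym idx-W) (subst (_∈ tabulate π)
          (letters-injective f good-f (trans (π-letter (pos i)) (sym (proj₂ (f⊑w i))))) (∈-tabulate⁺ {f = π} (pos i)))
      conclude : Dec (Allowed (toList W)) → Any.Any (Matches f w) J
      conclude (no ¬allowed) = ⊥-elim (good⇒regular t good-f W (permutation , ¬allowed) value)
      conclude (yes allowed) = Any.map
        (λ { (inj₁ eq) → inj₁ (trans (cong (eval t) (sym eq)) value , trans flat-w (cong (map (act f)) eq))
           ; (inj₂ eq) → inj₂ (trans (cong (eval t) (sym eq)) value , trans flat-w (cong (map (act f)) eq)) }) allowed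

    involutive? : Dec (h ∙ h ≡ ε)
    involutive? = h ∙ h Fin.≟ ε

    multiplicity : ℝ
    multiplicity = fromℕ (length J) * (1# + 𝟙 involutive?)

    goodSamples : List (Sample d)
    goodSamples = filter (good? ∘ proj₂) (Enumeration.elements (samples d))

    flat≟ : DecidableEquality (List (Bool × G))
    flat≟ = List.≡-dec (Product.≡-dec Bool._≟_ Fin._≟_)

    -- A good word above `f` is the image of `f` under a rotation in `J` or the inverse of one, and
    -- `flat` is injective, so each yields at most one word. The values of a rotation and of its
    -- inverse are mutually inverse, so both can equal `h` only if h² = 1.
    class-bound : ∀ f → Good (proj₂ f) → ∑ goodSamples (λ w → 𝟙 (f ⊑? w)) ≤ multiplicity
    class-bound f@(e , t) good-f = begin
      ∑ goodSamples (λ w → 𝟙 (f ⊑? w))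
        ≡⟨ ∑-filter (good? ∘ proj₂) (λ w → 𝟙 (f ⊑? w)) ws ⟩
      ∑ ws (λ w → 𝟙 (good? (proj₂ w)) * 𝟙 (f ⊑? w))
        ≤⟨ ∑-mono (λ w → 𝟙*-≤ (good? (proj₂ w)) (∑-nonneg (match-nonneg w) J) λ good-w →
             𝟙-≤ (f ⊑? w) (∑-nonneg (match-nonneg w) J) λ f⊑w → matched w J (same-letters f w good-f good-w f⊑w)) ws ⟩
      ∑ ws (λ w → ∑ J (match w))
        ≡⟨ ∑-swap match ws J ⟩
      ∑ J (λ j → ∑ ws (λ w → match w j))
        ≤⟨ constant-bound J _ per-rotation ⟩
      multiplicity ∎
      where
      open ≤-Reasoning
      ws = Enumeration.elements (samples d)
      hit : Word d → Sample d → ℝ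
      hit l w = 𝟙 (eval t l Fin.≟ h) * 𝟙 (flat≟ (flat w) (map (act f) l))
      hit-nonneg : ∀ l w → 0# ≤ hit l w
      hit-nonneg l w = *-nonneg (𝟙-nonneg (eval t l Fin.≟ h)) (𝟙-nonneg (flat≟ (flat w) (map (act f) l)))
      hit-one : ∀ l w → eval t l ≡ h → flat w ≡ map (act f) l → 1# ≤ hit l w
      hit-one l w p q = ≤-reflexive (sym (trans (cong₂ _*_ (𝟙-yes (eval t l Fin.≟ h) p)
        (𝟙-yes (flat≟ (flat w) (map (act f) l)) q)) (*-identityˡ 1#)))
      match : Sample d → Fin d → ℝ
      match w j = hit (rotation j) w + hit (inverse (rotation j)) w
      match-nonneg : ∀ w j → 0# ≤ match w j
      match-nonneg w j = +-nonneg (hit-nonneg (rotation j) w) (hit-nonneg (inverse (rotation j)) w)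
      match-one : ∀ w j → Matches f w j → 1# ≤ match w j
      match-one w j (inj₁ (p , q)) = ≤-trans (hit-one (rotation j) w p q) (x≤x+y (hit-nonneg (inverse (rotation j)) w))
      match-one w j (inj₂ (p , q)) = ≤-trans (hit-one (inverse (rotation j)) w p q) (x≤y+x (hit-nonneg (rotation j) w))
      matched : ∀ w js → Any.Any (Matches f w) js → 1# ≤ ∑ js (match w)
      matched w (j ∷ js) (here m)  = ≤-trans (match-one w j m) (x≤x+y (∑-nonneg (match-nonneg w) js))
      matched w (j ∷ js) (there m) = ≤-trans (matched w js m) (x≤y+x (match-nonneg w j))
      hits : ∀ l → ∑ ws (hit l) ≤ 𝟙 (eval t l Fin.≟ h)
      hits l = ≤-trans (≤-reflexive (∑-*ˡ _ _ ws)) (≤-trans (*-monoˡ-≤ (𝟙-nonneg (eval t l Fin.≟ h))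
        (Enumeration.∑-𝟙-unique (samples d) (λ w → flat≟ (flat w) (map (act f) l))
            (λ p q → flat-injective (trans p (sym q)))))
        (≤-reflexive (*-identityʳ _)))
      two-ways : ∀ q → 𝟙 (q Fin.≟ h) + 𝟙 (q ⁻¹ Fin.≟ h) ≤ 1# + 𝟙 involutive?
      two-ways q with q Fin.≟ h
      ... | no  _    = ≤-trans (≤-reflexive (+-identityˡ _)) (≤-trans (𝟙≤1 (q ⁻¹ Fin.≟ h))
          (x≤x+y (𝟙-nonneg involutive?)))
      ... | yes refl = +-monoʳ-≤ 1# (𝟙-mono (q ⁻¹ Fin.≟ q) involutive? λ eq → trans (cong (q ∙_) (sym eq)) (inverseʳ q))
      per-rotation : ∀ j → ∑ ws (λ w → match w j) ≤ 1# + 𝟙 involutive?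
      per-rotation j = ≤-trans (≤-reflexive (∑-+ (hit (rotation j)) (hit (inverse (rotation j))) ws)) (≤-trans
        (+-mono-≤ (hits (rotation j)) (≤-trans (hits (inverse (rotation j)))
          (≤-reflexive (cong (λ v → 𝟙 (v Fin.≟ h)) (eval-inverse t (rotation j))))))
        (two-ways (eval t (rotation j))))

    record Representatives : Set where
      field
        chosen      : List (Sample d)
        chosen⊆     : chosen ⊆ goodSamples
        antichain   : AllPairs (λ x y → ¬ y ⊑ x) chosen
        many        : fromℕ (length goodSamples) ≤ fromℕ (length chosen) * multiplicity

    -- Double counting of the pairs f ⊑ w: every good sample has a chosen one below it, and every
    -- chosen one lies below at most `multiplicity` good samples.
    representatives : Representatives
    representatives with maximal-antichain {_⊑_ = _⊑_} _⊑?_ (λ {x} i → i , refl) goodSamples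
    ... | ys , ys⊆ , antichain , covers = record
      { chosen = ys ; chosen⊆ = ys⊆ ; antichain = antichain ; many = begin
          fromℕ (length goodSamples)
            ≡⟨ ∑-1 goodSamples ⟨
          ∑ goodSamples (λ _ → 1#)
            ≤⟨ ∑-mono-All (All.map (λ {w} → covered {w}) covers) ⟩
          ∑ goodSamples (λ w → ∑ ys (λ f → 𝟙 (f ⊑? w)))
            ≡⟨ ∑-swap (λ w f → 𝟙 (f ⊑? w)) goodSamples ys ⟩
          ∑ ys (λ f → ∑ goodSamples (λ w → 𝟙 (f ⊑? w)))
            ≤⟨ ∑-mono-All (All.map (λ {f} → class-bound f) ys-good) ⟩
          ∑ ys (λ _ → multiplicity)
            ≡⟨ ∑-const multiplicity ys ⟩
          fromℕ (length ys) * multiplicity ∎ }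
      where
      open ≤-Reasoning
      ys-good : All (Good ∘ proj₂) ys
      ys-good = Sublist.All-resp-⊆ ys⊆ (All.all-filter (good? ∘ proj₂) (Enumeration.elements (samples d)))
      covered : ∀ {w fs} → Any.Any (_⊑ w) fs → 1# ≤ ∑ fs (λ f → 𝟙 (f ⊑? w))
      covered {w} {f ∷ fs} (here f⊑w)  = ≤-trans (≤-reflexive (sym (𝟙-yes (f ⊑? w) f⊑w)))
                                           (x≤x+y (∑-nonneg (λ f → 𝟙-nonneg (f ⊑? w)) fs))
      covered {w} {f ∷ fs} (there any) = ≤-trans (covered {w} {fs} any) (x≤y+x (𝟙-nonneg (f ⊑? w)))

    goodSamples-count : fromℕ (length goodSamples) ≡ fromℕ 2 ^ d * ∑ (tuples d) (𝟙 ∘ good?)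
    goodSamples-count = begin
      fromℕ (length goodSamples)
        ≡⟨ fromℕ-filter (good? ∘ proj₂) (Enumeration.elements (samples d)) ⟩
      ∑ (Enumeration.elements (samples d)) (𝟙 ∘ good? ∘ proj₂)
        ≡⟨ ∑-× (Signs.Vec-enumeration d) (Vec-enumeration d) (𝟙 ∘ good? ∘ proj₂) ⟩
      ∑ (vecs (true ∷ false ∷ []) d) (λ _ → ∑ (tuples d) (𝟙 ∘ good?))
        ≡⟨ ∑-const _ (vecs (true ∷ false ∷ []) d) ⟩
      Enumeration.size (Signs.Vec-enumeration d) * ∑ (tuples d) (𝟙 ∘ good?)
        ≡⟨ cong (_* ∑ (tuples d) (𝟙 ∘ good?)) (Signs.Vec-size d) ⟩
      fromℕ 2 ^ d * ∑ (tuples d) (𝟙 ∘ good?) ∎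
      where open ≡-Reasoning

-- The probability that a given element is missed.

module FailureBound (R : Reals) {N : ℕ} (𝔾 : FinGroup N) where
  open Reals R hiding (_⁻¹; _≟_)
  open OrderedField R
  open Exponential R
  open Sums R
  open Expectation R
  open Words 𝔾
  open GroupCounting R 𝔾
  open WordCounting R 𝔾
  open Family R 𝔾
  open Vectors (Fin-enumeration N) using (∏; ∏-nonneg; totals; ∑-∏)

  ∏-update-function : ∀ {k} (fs : Vec (G → ℝ) k) i a t → lookup fs i (lookup t i) ≡ a (lookup t i) →
                      ∏ (fs [ i ]≔ a) t ≡ ∏ fs t
  ∏-update-function (f ∷ fs) zero    a (x ∷ t) eq = cong (_* ∏ fs t) (sym eq)
  ∏-update-function (f ∷ fs) (suc i) a (x ∷ t) eq = cong (f x *_) (∏-update-function fs i a t eq)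

  ∏-update-argument : ∀ {k} (fs : Vec (G → ℝ) k) j c z t →
      (∏ (fs [ j ]≔ (λ _ → c)) (t [ j ]≔ z)) ≡ ∏ (fs [ j ]≔ (λ _ → c)) t
  ∏-update-argument (f ∷ fs) zero    c z (x ∷ t) = refl
  ∏-update-argument (f ∷ fs) (suc j) c z (x ∷ t) = cong (f x *_) (∏-update-argument fs j c z t)

  multiply : ∀ {k} → Vec ℝ k → ℝ
  multiply []      = 1#
  multiply (x ∷ v) = x * multiply v

  multiply-update : ∀ {k} (v : Vec ℝ k) i a → multiply (v [ i ]≔ a) * lookup v i ≡ multiply v * a
  multiply-update (x ∷ v) zero    a = solve 3 (λ a m x → a :* m :* x := x :* m :* a) refl a (multiply v) x
  multiply-update (x ∷ v) (suc i) a = trans (*-assoc x _ _) (trans (cong (x *_) (multiply-update v i a))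
      (sym (*-assoc x _ _)))

  multiply-replicate : ∀ k w → multiply (replicate k w) ≡ w ^ k
  multiply-replicate zero    w = refl
  multiply-replicate (suc k) w = cong (w *_) (multiply-replicate k w)

  -- Multiplication of both sides by w² restores the two overwritten entries one after the other,
  -- wherever they stand.
  multiply-two : ∀ {m} {i j : Fin (suc (suc m))} → i ≢ j → ∀ {w} → 0# < w → ∀ a b →
                 multiply ((replicate _ w [ i ]≔ a) [ j ]≔ b) ≡ a * b * w ^ m
  multiply-two {m} {i} {j} i≢j {w} 0<w a b = *-cancelˡ-≡ (*-pos 0<w 0<w) (begin
    w * w * multiply (v [ j ]≔ b)
      ≡⟨ solve 2 (λ w m → w :* w :* m := m :* w :* w) refl w _ ⟩
    multiply (v [ j ]≔ b) * w * w
      ≡⟨ cong (λ z → multiply (v [ j ]≔ b) * z * w) (trans (Vec.lookup∘update′ (i≢j ∘ sym) (replicate _ w) a)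
          (Vec.lookup-replicate j w)) ⟨
    multiply (v [ j ]≔ b) * lookup v j * w
      ≡⟨ cong (_* w) (multiply-update v j b) ⟩
    multiply v * b * w
      ≡⟨ solve 3 (λ m b w → m :* b :* w := m :* w :* b) refl (multiply v) b w ⟩
    multiply v * w * b
      ≡⟨ cong (λ z → multiply v * z * b) (Vec.lookup-replicate i w) ⟨
    multiply v * lookup (replicate (suc (suc m)) w) i * b
      ≡⟨ cong (_* b) (multiply-update (replicate (suc (suc m)) w) i a) ⟩
    multiply (replicate (suc (suc m)) w) * a * b
      ≡⟨ cong (λ z → z * a * b) (multiply-replicate (suc (suc m)) w) ⟩
    w * (w * w ^ m) * a * b
      ≡⟨ solve 4 (λ w p a b → w :* (w :* p) :* a :* b := w :* w :* (a :* b :* p)) refl w (w ^ m) a b ⟩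
    w * w * (a * b * w ^ m) ∎)
    where
    open ≡-Reasoning
    v = replicate _ w [ i ]≔ a

  totals≤multiply : ∀ {k} (fs : Vec (G → ℝ) k) (v : Vec ℝ k) → (∀ i x → 0# ≤ lookup fs i x) →
                    (∀ i → ∑ all (lookup fs i) ≤ lookup v i) → totals fs ≤ multiply v
  totals≤multiply []       []      _    _  = ≤-refl
  totals≤multiply (f ∷ fs) (x ∷ v) fs≥0 le = *-mono-≤
    (≤-trans (∑-nonneg {f = f} (fs≥0 zero) all) (le zero)) (totals-nonneg fs (fs≥0 ∘ suc)) (le zero)
    (totals≤multiply fs v (fs≥0 ∘ suc) (le ∘ suc))
    where
    totals-nonneg : ∀ {k} (fs : Vec (G → ℝ) k) → (∀ i x → 0# ≤ lookup fs i x) → 0# ≤ totals fs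
    totals-nonneg []       _    = 0≤1
    totals-nonneg (f ∷ fs) fs≥0 = *-nonneg (∑-nonneg {f = f} (fs≥0 zero) all) (totals-nonneg fs (fs≥0 ∘ suc))

  ∑-sgn : ∀ b (f : G → ℝ) → ∑ all (λ u → f (sgn b u)) ≡ ∑ all f
  ∑-sgn true  f = refl
  ∑-sgn false f = ∑-inverse f

  members : ∀ {k} (x : Vec G k) → ∑ all (λ u → 𝟙 (u ∈? x)) ≤ fromℕ k
  members {k} x = begin
    ∑ all (λ u → 𝟙 (u ∈? x))
      ≤⟨ ∑-mono (λ u → 𝟙-≤ (u ∈? x) (∑-nonneg (λ i → 𝟙-nonneg (u Fin.≟ lookup x i)) (allFin k)) λ u∈x →
           ≤-trans (≤-reflexive (sym (𝟙-yes (u Fin.≟ lookup x (VecAny.index u∈x)) (VecAny.lookup-index u∈x))))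
             (Enumeration.term≤∑ (Fin-enumeration k) (λ i → 𝟙-nonneg (u Fin.≟ lookup x i)) (VecAny.index u∈x))) all ⟩
    ∑ all (λ u → ∑ (allFin k) (λ i → 𝟙 (u Fin.≟ lookup x i)))
      ≡⟨ ∑-swap (λ u i → 𝟙 (u Fin.≟ lookup x i)) all (allFin k) ⟩
    ∑ (allFin k) (λ i → ∑ all (λ u → 𝟙 (u Fin.≟ lookup x i)))
      ≡⟨ ∑-cong (λ i → ∑-𝟙≡ (lookup x i)) (allFin k) ⟩
    ∑ (allFin k) (λ _ → 1#)
      ≡⟨ trans (∑-1 (allFin k)) (Fin-size k) ⟩
    fromℕ k ∎
    where open ≤-Reasoning

  module _ {m : ℕ} {p : ℝ} (0≤p : 0# ≤ p) (p≤1 : p ≤ 1#) (0<N : 0# < fromℕ N) where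
    open Janson 0≤p p≤1

    private
      d : ℕ
      d = suc (suc m)

    -- An upper bound on the total `weight` of one letter: p for each of the N elements, and 1 for
    -- each of the d letters of `x`.
    W : ℝ
    W = fromℕ N * p + fromℕ d

    0<W : 0# < W
    0<W = <-≤-trans (0<fromℕ-suc (suc m)) (x≤y+x (*-nonneg (<⇒≤ 0<N) 0≤p))

    -- A letter inside `x` has at most d choices, a letter outside `x` has weight p and is fixed by
    -- the product, and each of the other m letters has total weight at most `W`.
    pairBound : ℝ
    pairBound = fromℕ d * p * W ^ m

    -- The extra factors count the sign vectors and the positions of the inside and the outside
    -- letter.
    dependence : ℝ
    dependence = fromℕ 2 ^ d * (fromℕ d * (fromℕ d * pairBound))

    module _ (h : G) (x : Vec G d) where

      target : Vec G d → ℝ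
      target t = 𝟙 (eval t (identityWord (suc m)) Fin.≟ h)

      rows : Vec Bool d → Vec (G → ℝ) d
      rows = Vec.map (λ b u → weight p x (sgn b u))

      rows-lookup : ∀ e i → lookup (rows e) i ≡ (λ u → weight p x (sgn (lookup e i) u))
      rows-lookup e i = Vec.lookup-map i _ e

      weights-rows : ∀ {k} (e : Vec Bool k) (t : Vec G k) →
                     weights p x (Vec.zipWith sgn e t) ≡ ∏ (Vec.map (λ b u → weight p x (sgn b u)) e) t
      weights-rows []      []      = refl
      weights-rows (b ∷ e) (u ∷ t) = cong (weight p x (sgn b u) *_) (weights-rows e t)

      row-sum : ∀ b → ∑ all (λ u → weight p x (sgn b u)) ≤ W
      row-sum b = begin
        ∑ all (λ u → weight p x (sgn b u))   ≡⟨ ∑-sgn b (weight p x) ⟩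
        ∑ all (weight p x)                   ≤⟨ ∑-mono weight≤ all ⟩
        ∑ all (λ u → p + 𝟙 (u ∈? x))         ≡⟨ ∑-+ (λ _ → p) (λ u → 𝟙 (u ∈? x)) all ⟩
        ∑ all (λ _ → p) + ∑ all (λ u → 𝟙 (u ∈? x))
          ≤⟨ +-mono-≤ (≤-reflexive (trans (∑-const p all) (cong (_* p) (Fin-size N)))) (members x) ⟩
        W ∎
        where
        open ≤-Reasoning
        weight≤ : ∀ u → weight p x u ≤ p + 𝟙 (u ∈? x)
        weight≤ u with u ∈? x
        ... | yes _ = x≤y+x 0≤p
        ... | no  _ = x≤x+y ≤-refl

      module _ (e : Vec Bool d) (i j : Fin d) (i≢j : i ≢ j) where

        entry : G → ℝ
        entry u = 𝟙 (sgn (lookup e i) u ∈? x)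

        -- Row `i` becomes the indicator of membership in `x` and row `j` the constant p, so that
        -- the sum over all tuples factorises.
        rows′ special : Vec (G → ℝ) d
        rows′   = rows e [ i ]≔ entry
        special = rows′ [ j ]≔ (λ _ → p)

        limits′ limits : Vec ℝ d
        limits′ = replicate d W [ i ]≔ fromℕ d
        limits  = limits′ [ j ]≔ (fromℕ N * p)

        special-cases : ∀ k → (k ≡ j × lookup special k ≡ (λ _ → p) × lookup limits k ≡ fromℕ N * p) ⊎
                              (k ≡ i × lookup special k ≡ entry × lookup limits k ≡ fromℕ d) ⊎
                              (lookup special k ≡ (λ u → weight p x (sgn (lookup e k) u)) × lookup limits k ≡ W)
        special-cases k with k Fin.≟ j
        ... | yes refl = inj₁ (refl , Vec.lookup∘update k rows′ _ , Vec.lookup∘update k limits′ _)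
        ... | no  k≢j with k Fin.≟ i
        ...   | yes refl = inj₂ (inj₁ (refl ,
                trans (Vec.lookup∘update′ k≢j rows′ _) (Vec.lookup∘update k (rows e) entry) ,
                trans (Vec.lookup∘update′ k≢j limits′ _) (Vec.lookup∘update k (replicate d W) _)))
        ...   | no  k≢i  = inj₂ (inj₂ (
                trans (Vec.lookup∘update′ k≢j rows′ _) (trans (Vec.lookup∘update′ k≢i (rows e) entry)
                    (rows-lookup e k)) ,
                trans (Vec.lookup∘update′ k≢j limits′ _)
                  (trans (Vec.lookup∘update′ k≢i (replicate d W) _) (Vec.lookup-replicate k W))))

        special-nonneg : ∀ k u → 0# ≤ lookup special k u
        special-nonneg k u with special-cases k
        ... | inj₁ (_ , eq , _)        = subst (λ f → 0# ≤ f u) (sym eq) 0≤p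
        ... | inj₂ (inj₁ (_ , eq , _)) = subst (λ f → 0# ≤ f u) (sym eq) (𝟙-nonneg (sgn (lookup e i) u ∈? x))
        ... | inj₂ (inj₂ (eq , _))     = subst (λ f → 0# ≤ f u) (sym eq) (weight-nonneg x (sgn (lookup e k) u))

        special-total : totals special ≤ fromℕ d * (fromℕ N * p) * W ^ m
        special-total = ≤-trans (totals≤multiply special limits special-nonneg bound)
          (≤-reflexive (multiply-two i≢j 0<W (fromℕ d) (fromℕ N * p)))
          where
          bound : ∀ k → ∑ all (lookup special k) ≤ lookup limits k
          bound k with special-cases k
          ... | inj₁ (_ , eq , lim)        = subst₂ (λ f l → ∑ all f ≤ l) (sym eq) (sym lim)
                                               (≤-reflexive (trans (∑-const p all) (cong (_* p) (Fin-size N))))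
          ... | inj₂ (inj₁ (_ , eq , lim)) = subst₂ (λ f l → ∑ all f ≤ l) (sym eq) (sym lim)
                                               (≤-trans (≤-reflexive (∑-sgn (lookup e i) (λ u → 𝟙 (u ∈? x))))
                                                   (members x))
          ... | inj₂ (inj₂ (eq , lim))     = subst₂ (λ f l → ∑ all f ≤ l) (sym eq) (sym lim) (row-sum (lookup e k))

        -- The factor of letter `j` is constant, so the product condition can be spent on summing
        -- over that letter; this saves the factor N present in `special-total`.
        special-sum : ∑ (tuples d) (λ t → target t * ∏ special t) ≤ pairBound
        special-sum = *-cancelˡ-≤ 0<N (begin
          fromℕ N * ∑ (tuples d) (λ t → target t * ∏ special t)
            ≡⟨ trans (cong (_* ∑ (tuples d) (λ t → target t * ∏ special t)) (sym (Fin-size N)))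
                (sym (Vectors.∑-update (Fin-enumeration N) j (λ t → target t * ∏ special t))) ⟩
          ∑ (tuples d) (λ t → ∑ all (λ z → target (t [ j ]≔ z) * ∏ special (t [ j ]≔ z)))
            ≤⟨ ∑-mono fibre (tuples d) ⟩
          ∑ (tuples d) (∏ special)
            ≡⟨ ∑-∏ special ⟩
          totals special
            ≤⟨ special-total ⟩
          fromℕ d * (fromℕ N * p) * W ^ m
            ≡⟨ solve 4 (λ d n p w → d :* (n :* p) :* w := n :* (d :* p :* w)) refl (fromℕ d) (fromℕ N) p (W ^ m) ⟩
          fromℕ N * pairBound ∎)
          where
          open ≤-Reasoning
          target-fibre : ∀ t → ∑ all (λ z → target (t [ j ]≔ z)) ≤ 1#
          target-fibre t with split (proj₁ (identityWord-permutation (suc m))) (occurs j)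
            where
            occurs : ∀ j → (true , j) ∈ identityWord (suc m)
            occurs zero    = here refl
            occurs (suc j) = there (∈-identityTail j)
          ... | a , b , eq , j∉a , j∉b = ≤-trans (≤-reflexive (∑-cong (λ z → cong (λ v → 𝟙 (v Fin.≟ h))
                (trans (cong (eval (t [ j ]≔ z)) eq) (eval-occurrence t z a b j∉a j∉b))) all))
                (linear-solutions (eval t a) (eval t b) h)
          fibre : ∀ t → ∑ all (λ z → target (t [ j ]≔ z) * ∏ special (t [ j ]≔ z)) ≤ ∏ special t
          fibre t = ≤-trans (≤-reflexive (trans
            (∑-cong (λ z → cong (target (t [ j ]≔ z) *_) (∏-update-argument (rows e [ i ]≔ entry) j p z t)) all)
            (∑-*ʳ (∏ special t) (λ z → target (t [ j ]≔ z)) all)))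
            (≤-trans (*-monoʳ-≤ (∏-nonneg special special-nonneg t) (target-fibre t)) (≤-reflexive (*-identityˡ _)))

      dependent : Vec Bool d → Fin d → Fin d → Vec G d → ℝ
      dependent e i j t = 𝟙 (lookup (letters (e , t)) i ∈? x) * (𝟙 (¬? (lookup (letters (e , t)) j ∈? x)) * weights
          p x (letters (e , t)))

      dependent-nonneg : ∀ e i j t → 0# ≤ dependent e i j t
      dependent-nonneg e i j t = *-nonneg (𝟙-nonneg (_ ∈? x)) (*-nonneg
          (𝟙-nonneg (¬? (lookup (letters (e , t)) j ∈? x))) (weights-nonneg x (letters (e , t))))

      pair-sum : ∀ e i j → ∑ (tuples d) (λ t → target t * dependent e i j t) ≤ pairBound
      pair-sum e i j with i Fin.≟ j
      ... | yes refl = ≤-trans (≤-reflexive (trans (∑-cong vanish (tuples d)) (∑-zero (tuples d))))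
                         (*-nonneg (*-nonneg (fromℕ-nonneg d) 0≤p) (^-nonneg (<⇒≤ 0<W) m))
        where
        vanish : ∀ t → target t * dependent e i i t ≡ 0#
        vanish t with lookup (letters (e , t)) i ∈? x
        ... | yes _ = solve 2 (λ o w → o :* (κ 1 :* (κ 0 :* w)) := κ 0) refl (target t) _
        ... | no  _ = solve 2 (λ o w → o :* (κ 0 :* (κ 1 :* w)) := κ 0) refl (target t) _
      ... | no i≢j = ≤-trans (∑-mono (λ t → *-monoˡ-≤ (𝟙-nonneg (eval t (identityWord (suc m)) Fin.≟ h))
          (pointwise t)) (tuples d))
                       (special-sum e i j i≢j)
        where
        pointwise : ∀ t → dependent e i j t ≤ ∏ (special e i j i≢j) t
        pointwise t = 𝟙*-≤ (lookup (letters (e , t)) i ∈? x) nonneg λ si∈x →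
                      𝟙*-≤ (¬? (lookup (letters (e , t)) j ∈? x)) nonneg λ sj∉x → ≤-reflexive (equal si∈x sj∉x)
          where
          nonneg = ∏-nonneg (special e i j i≢j) (special-nonneg e i j i≢j) t
          weight-∈ : ∀ {u} → u ∈ᵛ x → weight p x u ≡ 1#
          weight-∈ {u} u∈x with u ∈? x
          ... | yes _   = refl
          ... | no  u∉x = ⊥-elim (u∉x u∈x)
          weight-∉ : ∀ {u} → u ∉ᵛ x → weight p x u ≡ p
          weight-∉ {u} u∉x with u ∈? x
          ... | yes u∈x = ⊥-elim (u∉x u∈x)
          ... | no  _   = refl
          equal : lookup (letters (e , t)) i ∈ᵛ x → lookup (letters (e , t)) j ∉ᵛ x →
                  weights p x (letters (e , t)) ≡ ∏ (special e i j i≢j) t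
          equal si∈x sj∉x = trans (weights-rows e t) (sym (trans
            (∏-update-function (rows e [ i ]≔ entry e i j i≢j) j (λ _ → p) t
              (trans (cong (_$ lookup t j) (trans (Vec.lookup∘update′ (i≢j ∘ sym) (rows e) _) (rows-lookup e j)))
                (weight-∉ (subst (_∉ᵛ x) (lookup-letters (e , t) j) sj∉x))))
            (∏-update-function (rows e) i (entry e i j i≢j) t
              (trans (cong (_$ lookup t i) (rows-lookup e i))
                (trans (weight-∈ si∈x′) (sym (𝟙-yes (sgn (lookup e i) (lookup t i) ∈? x) si∈x′)))))))
            where si∈x′ = subst (_∈ᵛ x) (lookup-letters (e , t) i) si∈x

      overlapping : Sample d → ℝ
      overlapping f = ∑ (allFin d) (λ i → ∑ (allFin d) (λ j → target (proj₂ f) * dependent (proj₁ f) i j (proj₂ f)))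

      overlapping-sum : ∑ (Enumeration.elements (samples d)) overlapping ≤ dependence
      overlapping-sum = begin
        ∑ (Enumeration.elements (samples d)) overlapping
          ≡⟨ ∑-× (Signs.Vec-enumeration d) (Vec-enumeration d) overlapping ⟩
        ∑ es (λ e → ∑ (tuples d) (λ t → ∑ (allFin d) (λ i → ∑ (allFin d) (term e t i))))
          ≡⟨ ∑-cong (λ e → trans (∑-swap (λ t i → ∑ (allFin d) (term e t i)) (tuples d) (allFin d))
               (∑-cong (λ i → ∑-swap (λ t j → term e t i j) (tuples d) (allFin d)) (allFin d))) es ⟩
        ∑ es (λ e → ∑ (allFin d) (λ i → ∑ (allFin d) (λ j → ∑ (tuples d) (λ t → term e t i j))))
          ≤⟨ ∑-mono (λ e → ∑-mono (λ i → ∑-mono (λ j → pair-sum e i j) (allFin d)) (allFin d)) es ⟩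
        ∑ es (λ e → ∑ (allFin d) (λ i → ∑ (allFin d) (λ j → pairBound)))
          ≡⟨ trans (∑-const _ es) (cong₂ _*_ (Signs.Vec-size d) (trans (∑-const _ (allFin d))
               (cong₂ _*_ (Fin-size d) (trans (∑-const _ (allFin d)) (cong (_* pairBound) (Fin-size d)))))) ⟩
        dependence ∎
        where
        open ≤-Reasoning
        es = vecs (true ∷ false ∷ []) d
        term : Vec Bool d → Vec G d → Fin d → Fin d → ℝ
        term e t i j = target t * dependent e i j t

      -- The word meets `x` at some position i by overlap, and leaves `x` at some position j because
      -- its letters are not all in `x`; the pair (i, j) is one of the summands.
      overlap-term : ∀ f → eval (proj₂ f) (identityWord (suc m)) ≡ h →
          ¬ (∀ i → ∃[ k ] lookup (letters f) i ≡ lookup x k) →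
                     𝟙 (overlap? x (letters f)) * weights p x (letters f) ≤ overlapping f
      overlap-term f@(e , t) value ¬⊑ = 𝟙*-≤ (overlap? x (letters f))
        (∑-nonneg (λ i → ∑-nonneg (term-nonneg i) (allFin d)) (allFin d)) λ common →
        witness (VecAny.index common) (VecAny.lookup-index common)
                (Fin.¬∀⟶∃¬ d (λ i → ∃[ k ] lookup (letters f) i ≡ lookup x k) (λ i → Fin.any? λ k → _ Fin.≟ _) ¬⊑)
        where
        term-nonneg : ∀ i j → 0# ≤ target t * dependent e i j t
        term-nonneg i j = *-nonneg (𝟙-nonneg (eval t (identityWord (suc m)) Fin.≟ h)) (dependent-nonneg e i j t)
        witness : ∀ i → lookup (letters f) i ∈ᵛ x → ∃[ j ] ¬ (∃[ k ] lookup (letters f) j ≡ lookup x k) →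
                  weights p x (letters f) ≤ overlapping f
        witness i si∈x (j , none) = begin
          weights p x (letters f)
            ≡⟨ solve 1 (λ w → w := κ 1 :* (κ 1 :* (κ 1 :* w))) refl (weights p x (letters f)) ⟩
          1# * (1# * (1# * weights p x (letters f)))
            ≡⟨ cong₂ _*_ (𝟙-yes (eval t (identityWord (suc m)) Fin.≟ h) value)
                (cong₂ _*_ (𝟙-yes (lookup (letters f) i ∈? x) si∈x)
                 (cong (_* weights p x (letters f)) (𝟙-yes (¬? (lookup (letters f) j ∈? x)) sj∉x))) ⟨
          target t * dependent e i j t
            ≤⟨ Enumeration.term≤∑ (Fin-enumeration d) {λ j → target t * dependent e i j t} (term-nonneg i) j ⟩
          ∑ (allFin d) (λ j → target t * dependent e i j t)
            ≤⟨ Enumeration.term≤∑ (Fin-enumeration d) {λ i → ∑ (allFin d) (λ j → target t * dependent e i j t)}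
                 (λ i → ∑-nonneg (term-nonneg i) (allFin d)) i ⟩
          overlapping f ∎
          where
          open ≤-Reasoning
          sj∉x : lookup (letters f) j ∉ᵛ x
          sj∉x sj∈x = none (VecAny.index sj∈x , VecAny.lookup-index sj∈x)

    injective⇒Distinct : ∀ {k} (v : Vec G k) → (∀ {i j} → lookup v i ≡ lookup v j → i ≡ j) → Distinct v
    injective⇒Distinct []      _   = tt
    injective⇒Distinct (x ∷ v) inj = (λ x∈v → zero≢suc (inj {zero} {suc (VecAny.index x∈v)}
        (VecAny.lookup-index x∈v))) ,
                                     injective⇒Distinct v (λ eq → Fin.suc-injective (inj eq))
      where
      zero≢suc : ∀ {k} {i : Fin k} → Fin.zero ≡ suc i → ⊥
      zero≢suc ()

    exp-bound : ∀ {c} → 0# ≤ 1# - c → ∀ l → (1# - c) ^ l ≤ exp (- (fromℕ l * c))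
    exp-bound {c} 0≤1-c l = ≤-trans (^-mono-≤ 0≤1-c (1+x≤exp (- c)) l) (≤-reflexive (trans (sym (exp-multiple l (- c)))
      (cong exp (solve 2 (λ l c → l :* (:- c) := :- (l :* c)) refl (fromℕ l) c))))

    module _ (h : G) (h≢ε : h ≢ ε) {ρ : ℝ} (1≤ρ : 1# ≤ ρ) (Z≤ρ² : commutingPairs ≤ ρ * ρ)
        (Z≤Nρ : commutingPairs ≤ fromℕ N * ρ)
             (J : List (Fin d)) (J-large : ∀ j → j ∈ J ⊎ (∃[ i ] j ≡ suc i) × centralizer h ≤ ρ) where
      open Target h h≢ε 1≤ρ Z≤ρ² Z≤Nρ 0<N J J-large hiding (d)
      open Representatives representatives

      family : List (Vec G d)
      family = map letters chosen

      -- The antichain gives every later member a letter outside the current one, after which the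
      -- sum is extended from the members to all samples.
      weaklyDependent : WeaklyDependent dependence family
      weaklyDependent = go chosen chosen⊆ antichain
        where
        go : ∀ fs → fs ⊆ goodSamples → AllPairs (λ x y → ¬ y ⊑ x) fs → WeaklyDependent dependence (map letters fs)
        go []       _   _               = tt
        go (x ∷ fs) sub (¬⊑x ∷ pairs) with Sublist.All-resp-⊆ sub (All.all-filter (good? ∘ proj₂)
            (Enumeration.elements (samples d)))
        ... | good-x ∷ good-fs = injective⇒Distinct (letters x) (λ {i} {j} → letters-injective x good-x {i}
            {j}) , (begin
            ∑ (map letters fs) (λ y → 𝟙 (overlap? (letters x) y) * weights p (letters x) y)
              ≡⟨ ∑-map _ letters fs ⟩
            ∑ fs (λ f → 𝟙 (overlap? (letters x) (letters f)) * weights p (letters x) (letters f))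
              ≤⟨ ∑-mono-All (All.zipWith (λ {f} (good , ¬⊑) → overlap-term h (letters x) f (proj₁ good) ¬⊑)
                  (good-fs , ¬⊑x)) ⟩
            ∑ fs (overlapping h (letters x))
              ≤⟨ ∑-sublist {f = overlapping h (letters x)} nonneg fs⊆ ⟩
            ∑ (Enumeration.elements (samples d)) (overlapping h (letters x))
              ≤⟨ overlapping-sum h (letters x) ⟩
            dependence ∎) , go fs (Sublist.∷ˡ⁻ sub) pairs
          where
          open ≤-Reasoning
          fs⊆ : fs ⊆ Enumeration.elements (samples d)
          fs⊆ = ⊆-trans (Sublist.∷ˡ⁻ sub) (Sublist.filter-⊆ (good? ∘ proj₂) (Enumeration.elements (samples d)))
          nonneg : ∀ f → 0# ≤ overlapping h (letters x) f
          nonneg f = ∑-nonneg (λ i → ∑-nonneg (λ j → *-nonneg (𝟙-nonneg (eval (proj₂ f) (identityWord (suc m)) Fin.≟ h))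
                       (dependent-nonneg h (letters x) (proj₁ f) i j (proj₂ f))) (allFin d)) (allFin d)

      family-value : All (λ f → eval (proj₂ f) (identityWord (suc m)) ≡ h) chosen
      family-value = All.map proj₁ (Sublist.All-resp-⊆ chosen⊆ (All.all-filter (good? ∘ proj₂)
          (Enumeration.elements (samples d))))

      -- `β` bounds the proportion of bad words, so at least (1 - β) N^(d-1) are good. With 2^d sign
      -- vectors and at most `multiplicity` samples per representative, the family is large enough
      -- for `janson` to give this exponent.
      failure-bound : ∀ {β μ} → 0# ≤ 1# - dependence → dependence ≤ 1# → exceptions * ρ ≤ β * fromℕ N →
          0# < multiplicity →
        μ ≤ (1# - dependence) * (1# - β) * (fromℕ 2 ^ d * p ^ d * fromℕ N ^ suc m) →
        𝔼 p N (none family) ≤ exp (- (μ / multiplicity))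
      failure-bound {β} {μ} 0≤1-D D≤1 rare 0<mult μ≤ = begin
        𝔼 p N (none family)
          ≤⟨ janson 0≤1-D 0≤1-c family weaklyDependent ⟩
        (1# - c) ^ length family
          ≤⟨ exp-bound 0≤1-c (length family) ⟩
        exp (- (fromℕ (length family) * c))
          ≤⟨ exp-mono-≤ (neg-mono-≤ (/≤ 0<mult enough)) ⟩
        exp (- (μ / multiplicity)) ∎
        where
        open ≤-Reasoning
        c = p ^ d * (1# - dependence)
        p^≤1 : p ^ d ≤ 1#
        p^≤1 = ≤-trans (^-mono-≤ 0≤p p≤1 d) (≤-reflexive (one^ d))
          where
          one^ : ∀ k → 1# ^ k ≡ 1#
          one^ zero    = refl
          one^ (suc k) = trans (*-identityˡ _) (one^ k)
        0≤D : 0# ≤ dependence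
        0≤D = *-nonneg (^-nonneg (fromℕ-nonneg 2) d) (*-nonneg (fromℕ-nonneg d) (*-nonneg (fromℕ-nonneg d)
                (*-nonneg (*-nonneg (fromℕ-nonneg d) 0≤p) (^-nonneg (<⇒≤ 0<W) m))))
        c≤1 : c ≤ 1#
        c≤1 = ≤-trans (*-mono-≤ 0≤1 0≤1-D p^≤1 (≤-slack dependence 0≤D
            (solve 1 (λ D → κ 1 := (κ 1 :- D) :+ D) refl dependence)))
                (≤-reflexive (*-identityˡ 1#))
        0≤1-c : 0# ≤ 1# - c
        0≤1-c = x≤y⇒0≤y-x c≤1
        B = ∑ (tuples d) (λ t → onTarget t * bad t)
        B≤ : B ≤ β * fromℕ N ^ suc m
        B≤ = *-cancelˡ-≤ 0<N (begin
          fromℕ N * B                              ≤⟨ bad-bound ⟩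
          exceptions * (fromℕ N ^ suc m * ρ)       ≡⟨ solve 3 (λ e n r → e :* (n :* r) := n :* (e :* r)) refl
              exceptions (fromℕ N ^ suc m) ρ ⟩
          fromℕ N ^ suc m * (exceptions * ρ)       ≤⟨ *-monoˡ-≤ (^-nonneg (<⇒≤ 0<N) (suc m)) rare ⟩
          fromℕ N ^ suc m * (β * fromℕ N)          ≡⟨ solve 3 (λ n b k → n :* (b :* k) := k :* (b :* n)) refl
              (fromℕ N ^ suc m) β (fromℕ N) ⟩
          fromℕ N * (β * fromℕ N ^ suc m)          ∎)
        enough : μ ≤ fromℕ (length family) * c * multiplicity
        enough = begin
          μ
            ≤⟨ μ≤ ⟩
          (1# - dependence) * (1# - β) * (fromℕ 2 ^ d * p ^ d * fromℕ N ^ suc m)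
            ≡⟨ solve 5 (λ D b t p n → (κ 1 :- D) :* (κ 1 :- b) :* (t :* p :* n) :=
                 p :* (κ 1 :- D) :* (t :* (n :- b :* n))) refl dependence β (fromℕ 2 ^ d) (p ^ d) (fromℕ N ^ suc m) ⟩
          c * (fromℕ 2 ^ d * (fromℕ N ^ suc m - β * fromℕ N ^ suc m))
            ≤⟨ *-monoˡ-≤ (*-nonneg (^-nonneg 0≤p d) 0≤1-D) (*-monoˡ-≤ (^-nonneg (fromℕ-nonneg 2) d)
                 (≤-trans (+-monoʳ-≤ (fromℕ N ^ suc m) (neg-mono-≤ B≤)) good-count)) ⟩
          c * (fromℕ 2 ^ d * ∑ (tuples d) (𝟙 ∘ good?))
            ≡⟨ cong (c *_) goodSamples-count ⟨
          c * fromℕ (length goodSamples)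
            ≤⟨ *-monoˡ-≤ (*-nonneg (^-nonneg 0≤p d) 0≤1-D) many ⟩
          c * (fromℕ (length chosen) * multiplicity)
            ≡⟨ cong (λ l → c * (fromℕ l * multiplicity)) (List.length-map letters chosen) ⟨
          c * (fromℕ (length family) * multiplicity)
            ≡⟨ solve 3 (λ c l k → c :* (l :* k) := l :* c :* k) refl c (fromℕ (length family)) multiplicity ⟩
          fromℕ (length family) * c * multiplicity ∎

-- Transport of the group structure to indices.

module IndexGroup {c ℓ N} (𝔽 : FiniteGroup c ℓ N) where
  open FiniteGroup 𝔽 using (group; enumeration)
  open Group group using (_≈_; reflexive; ∙-cong; ⁻¹-cong)
    renaming (Carrier to H; _∙_ to _⋆_; _⁻¹ to _′; ε to e; refl to ≈-refl; sym to ≈-sym; trans to ≈-trans; assoc to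
        ·-assoc;
              identityˡ to ·-identityˡ; identityʳ to ·-identityʳ; inverseˡ to ·-inverseˡ; inverseʳ to ·-inverseʳ) public
  open Inverse enumeration public using ()
    renaming (to to element; from to index; from-cong to index-cong; strictlyInverseˡ to element-index;
        strictlyInverseʳ to index-element)

  element-injective : ∀ {i j} → element i ≈ element j → i ≡ j
  element-injective {i} {j} eq = trans (sym (index-element i)) (trans (index-cong eq) (index-element j))

  indexGroup : FinGroup N
  indexGroup = record
    { _∙_ = λ i j → index (element i ⋆ element j)
    ; ε   = index e
    ; _⁻¹ = λ i → index (element i ′)
    ; isGroup = record
      { isMonoid = record
        { isSemigroup = record
          { isMagma = record
            { isEquivalence = record { refl = refl ; sym = sym ; trans = trans }
            ; ∙-cong        = cong₂ (λ i j → index (element i ⋆ element j))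
            }
          ; assoc = λ i j k → index-cong (≈-trans (∙-cong (element-index _) ≈-refl)
              (≈-trans (·-assoc _ _ _) (∙-cong ≈-refl (≈-sym (element-index _)))))
          }
        ; identity = (λ i → trans (index-cong (≈-trans (∙-cong (element-index e) ≈-refl) (·-identityˡ _)))
            (index-element i)) ,
                     (λ i → trans (index-cong (≈-trans (∙-cong ≈-refl (element-index e)) (·-identityʳ _)))
                         (index-element i))
        }
      ; inverse = (λ i → index-cong (≈-trans (∙-cong (element-index _) ≈-refl) (·-inverseˡ _))) ,
                  (λ i → index-cong (≈-trans (∙-cong ≈-refl (element-index _)) (·-inverseʳ _)))
      ; ⁻¹-cong = cong (λ i → index (element i ′))
      }
    }

-- From realised words to walks in the Cayley graph.

module CayleyDiameter {c ℓ N} (𝔽 : FiniteGroup c ℓ N) where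
  open FiniteGroup 𝔽 using (_∈ˢ_; module Cayley; DiameterExceeds)
  open IndexGroup 𝔽
  open Words indexGroup using (_∙_; ε; _⁻¹; sgn)
  open GroupProperties (FiniteGroup.group 𝔽) using (⁻¹-anti-homo-∙)

  element-∙ : ∀ i j → element (i ∙ j) ≈ element i ⋆ element j
  element-∙ i j = element-index _

  product : ∀ {k} → Vec (Fin N) k → Fin N
  product []      = ε
  product (x ∷ t) = x ∙ product t

  Labelled : Subset N → ∀ {k} → Vec (Fin N) k → Set
  Labelled S t = ∀ i → ∃[ b ] lookup S (sgn b (lookup t i)) ≡ inside

  module _ (S : Subset N) where
    open Cayley S

    distance-resp : ∀ {k g g′ h h′} → g ≈ g′ → h ≈ h′ → DistanceAtMost k g h → DistanceAtMost k g′ h′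
    distance-resp p q (k , k≤ , w) = k , k≤ , walk-resp p q w

    -- A letter equal to the identity yields no edge and is skipped, hence a distance of at most k
    -- rather than a walk of length k.
    labelled-walk : ∀ {k} (t : Vec (Fin N) k) → Labelled S t → ∀ g → DistanceAtMost k g (g ⋆ element (product t))
    labelled-walk []      _     g = 0 , z≤n , stop (≈-sym (≈-trans (∙-cong ≈-refl (element-index e)) (·-identityʳ g)))
    labelled-walk (x ∷ t) label g with x Fin.≟ ε
    ... | yes refl = let (k , k≤ , w) = labelled-walk t (label ∘ suc) g in
          k , ℕ.m≤n⇒m≤1+n k≤ , walk-resp ≈-refl (∙-cong ≈-refl (≈-sym (≈-trans (element-∙ ε (product t))
            (≈-trans (∙-cong (element-index e) ≈-refl) (·-identityˡ _))))) w
    ... | no x≢ε = let (k , k≤ , w) = labelled-walk t (label ∘ suc) (g ⋆ element x) in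
          suc k , s≤s k≤ , step (moves , edge (label zero)) (walk-resp ≈-refl
            (≈-trans (·-assoc _ _ _) (∙-cong ≈-refl (≈-sym (element-∙ x (product t))))) w)
      where
      forward : g ′ ⋆ (g ⋆ element x) ≈ element x
      forward = ≈-trans (≈-sym (·-assoc _ _ _)) (≈-trans (∙-cong (·-inverseˡ g) ≈-refl) (·-identityˡ _))
      backward : (g ⋆ element x) ′ ⋆ g ≈ element x ′
      backward = ≈-trans (∙-cong (⁻¹-anti-homo-∙ g (element x)) ≈-refl)
        (≈-trans (·-assoc _ _ _) (≈-trans (∙-cong ≈-refl (·-inverseˡ g)) (·-identityʳ _)))
      moves : ¬ g ≈ g ⋆ element x
      moves eq = x≢ε (element-injective (≈-trans (≈-sym forward)
        (≈-trans (∙-cong ≈-refl (≈-sym eq)) (≈-trans (·-inverseˡ g) (≈-sym (element-index e))))))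
      edge : ∃[ b ] lookup S (sgn b x) ≡ inside → (g ′ ⋆ (g ⋆ element x)) ∈ˢ S ⊎ ((g ⋆ element x) ′ ⋆ g) ∈ˢ S
      edge (true  , eq) = inj₁ (Vec.lookup⇒[]= _ S (trans (cong (lookup S)
          (trans (index-cong forward) (index-element x))) eq))
      edge (false , eq) = inj₂ (Vec.lookup⇒[]= _ S (trans (cong (lookup S) (index-cong backward)) eq))

    diameter : ∀ {k} → (∀ h → h ≢ ε → ∃[ t ] product {k} t ≡ h × Labelled S t) → DiameterAtMost k
    diameter {k} words g g′ with index (g ′ ⋆ g′) Fin.≟ ε
    ... | yes eq = 0 , z≤n , stop (≈-trans (≈-sym (·-identityʳ g)) (≈-trans (∙-cong ≈-refl (≈-sym trivial)) quotient))
      where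
      quotient : g ⋆ (g ′ ⋆ g′) ≈ g′
      quotient = ≈-trans (≈-sym (·-assoc _ _ _)) (≈-trans (∙-cong (·-inverseʳ g) ≈-refl) (·-identityˡ _))
      trivial : g ′ ⋆ g′ ≈ e
      trivial = ≈-trans (≈-sym (element-index _)) (≈-trans (reflexive (cong element eq)) (element-index e))
    ... | no h≢ε = let (t , eq , label) = words (index (g ′ ⋆ g′)) h≢ε in
          distance-resp ≈-refl (≈-trans (∙-cong ≈-refl (≈-trans (reflexive (cong element eq)) (element-index _)))
              quotient)
            (labelled-walk t label g)
      where
      quotient : g ⋆ (g ′ ⋆ g′) ≈ g′
      quotient = ≈-trans (≈-sym (·-assoc _ _ _)) (≈-trans (∙-cong (·-inverseʳ g) ≈-refl) (·-identityˡ _))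

  walk-mono : ∀ {S T} → S Subset.⊆ T → ∀ {k g h} → Cayley.Walk S k g h → Cayley.Walk T k g h
  walk-mono S⊆T (Cayley.stop eq)              = Cayley.stop eq
  walk-mono S⊆T (Cayley.step (g≉x , edge) w) = Cayley.step (g≉x , Sum.map S⊆T S⊆T edge) (walk-mono S⊆T w)

  exceeds-antitone : ∀ {S T d} → S Subset.⊆ T → DiameterExceeds d T → DiameterExceeds d S
  exceeds-antitone S⊆T exceeds diam = exceeds λ g h → let (k , k≤ , w) = diam g h in k , k≤ , walk-mono S⊆T w

-- The union bound over all group elements.

module UnionBound (R : Reals) {c ℓ N} (𝔽 : FiniteGroup c ℓ N) where
  open Reals R hiding (_⁻¹; _≟_)
  open OrderedField R
  open Exponential R
  open Sums R
  open Expectation R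
  open FiniteGroup 𝔽 using (#; cl; involution?; DiameterExceeds; diameterExceeds?; _∈ClassOf?_)
  open IndexGroup 𝔽
  open CayleyDiameter 𝔽
  open Words indexGroup using (G; _∙_; ε; _⁻¹; sgn; eval)
  open GroupCounting R indexGroup
  open WordCounting R indexGroup using (tuples)
  open Family R indexGroup hiding (product)
  open FailureBound R indexGroup

  element-conj : ∀ y x → element (conj y x) ≈ element y ′ ⋆ element x ⋆ element y
  element-conj y x = ≈-trans (element-∙ _ _) (∙-cong (≈-trans (element-∙ _ _) (∙-cong (element-index _) ≈-refl)) ≈-refl)

  cl≡ : ∀ h → fromℕ (cl (element h)) ≡ ∑ all (λ z → 𝟙 (∃conj? h z))
  cl≡ h = trans (fromℕ-filter ((_∈ClassOf? element h) ∘ element) all) (∑-cong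
      (λ z → 𝟙-cong (element z ∈ClassOf? element h) (∃conj? h z)
    (λ (y , eq) → index y , element-injective (≈-trans eq (≈-sym (≈-trans (element-conj (index y) h)
      (∙-cong (∙-cong (⁻¹-cong (element-index y)) ≈-refl) (element-index y))))))
    (λ { (y , refl) → element y , element-conj y h })) all)

  involution≡ : ∀ h → 𝟙 (involution? (element h)) ≡ 𝟙 (h ∙ h Fin.≟ ε)
  involution≡ h = 𝟙-cong (involution? (element h)) (h ∙ h Fin.≟ ε) index-cong
    (λ eq → ≈-trans (≈-sym (element-∙ h h)) (≈-trans (reflexive (cong element eq)) (element-index e)))

  centralizer≤N : ∀ h → centralizer h ≤ fromℕ N
  centralizer≤N h = ≤-trans (∑-mono (λ y → 𝟙≤1 (conj y h Fin.≟ h)) all) (≤-reflexive (trans (∑-1 all) (Fin-size N)))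

  module _ (M : ℝ) (0<M : 0# < M) where

    small? : ∀ h → Dec (fromℕ (cl (element h)) ≤ M)
    small? h = fromℕ (cl (element h)) ≤? M

    #small : ℝ
    #small = fromℕ (# (λ x → fromℕ (cl x) ≤? M))

    #small≡ : #small ≡ ∑ all (𝟙 ∘ small?)
    #small≡ = fromℕ-filter small? all

    -- By `centralizer*class≤N`, a class larger than `M` leaves at most N / M ≤ τ for the
    -- centralizer.
    large-centralizer : ∀ {τ} → 0# ≤ τ → fromℕ N ≤ τ * M → ∀ h → ¬ fromℕ (cl (element h)) ≤ M → centralizer h ≤ τ
    large-centralizer {τ} 0≤τ N≤τM h ¬small = *-cancelˡ-≤ (≤-<-trans (<⇒≤ 0<M) (≰⇒> ¬small)) (begin
      fromℕ (cl (element h)) * centralizer h   ≡⟨ cong (_* centralizer h) (cl≡ h) ⟩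
      ∑ all (λ z → 𝟙 (∃conj? h z)) * centralizer h ≤⟨ centralizer*class≤N h ⟩
      fromℕ N                                  ≤⟨ N≤τM ⟩
      τ * M                                    ≤⟨ *-monoˡ-≤ 0≤τ (<⇒≤ (≰⇒> ¬small)) ⟩
      τ * fromℕ (cl (element h))               ≡⟨ *-comm _ _ ⟩
      fromℕ (cl (element h)) * τ               ∎)
      where open ≤-Reasoning

    -- Elements of small class are charged the trivial bound N, all others τ.
    commutingPairs-bound : ∀ {τ} → 0# ≤ τ → fromℕ N ≤ τ * M → commutingPairs ≤ fromℕ N * τ + #small * fromℕ N
    commutingPairs-bound {τ} 0≤τ N≤τM = begin
      ∑ all centralizer
        ≤⟨ ∑-mono split all ⟩
      ∑ all (λ h → τ + 𝟙 (small? h) * fromℕ N)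
        ≡⟨ ∑-+ (λ _ → τ) (λ h → 𝟙 (small? h) * fromℕ N) all ⟩
      ∑ all (λ _ → τ) + ∑ all (λ h → 𝟙 (small? h) * fromℕ N)
        ≡⟨ cong₂ _+_ (trans (∑-const τ all) (cong (_* τ) (Fin-size N)))
             (trans (∑-*ʳ (fromℕ N) (𝟙 ∘ small?) all) (cong (_* fromℕ N) (sym #small≡))) ⟩
      fromℕ N * τ + #small * fromℕ N ∎
      where
      open ≤-Reasoning
      split : ∀ h → centralizer h ≤ τ + 𝟙 (small? h) * fromℕ N
      split h with small? h
      ... | yes _      = ≤-trans (centralizer≤N h) (≤-trans (≤-reflexive (sym (*-identityˡ _))) (x≤y+x 0≤τ))
      ... | no  ¬small = ≤-trans (large-centralizer 0≤τ N≤τM h ¬small) (x≤x+y (≤-reflexive (sym (zeroˡ _))))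

    module _ (m : ℕ) {p : ℝ} (0≤p : 0# ≤ p) (p≤1 : p ≤ 1#) (0<N : 0# < fromℕ N) {τ ρ : ℝ} (0≤τ : 0# ≤ τ)
        (N≤τM : fromℕ N ≤ τ * M)
             (τ≤ρ : τ ≤ ρ) (1≤ρ : 1# ≤ ρ) (sum≤ρ² : fromℕ N * τ + #small * fromℕ N ≤ ρ * ρ)
             (sum≤Nρ : fromℕ N * τ + #small * fromℕ N ≤ fromℕ N * ρ) where

      private
        d : ℕ
        d = suc (suc m)

        Z = commutingPairs-bound 0≤τ N≤τM

        D : ℝ
        D = dependence {m} 0≤p p≤1 0<N

        J : G → List (Fin d)
        J h = if does (small? h) then allFin d else zero ∷ []

        J-large : ∀ h j → j ∈ J h ⊎ (∃[ i ] j ≡ suc i) × centralizer h ≤ ρ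
        J-large h j with small? h
        J-large h j       | yes _      = inj₁ (∈-allFin j)
        J-large h zero    | no  _      = inj₁ (here refl)
        J-large h (suc i) | no  ¬small = inj₂ ((i , refl) , ≤-trans (large-centralizer 0≤τ N≤τM h ¬small) τ≤ρ)

      exceptional : ℝ
      exceptional = (fromℕ 2 * fromℕ d) ^ d + fromℕ 2 * (fromℕ d * fromℕ d)

      module _ {β μ : ℝ} (0≤1-D : 0# ≤ 1# - D) (D≤1 : D ≤ 1#) (rare : exceptional * ρ ≤ β * fromℕ N) (0≤μ : 0# ≤ μ)
               (μ≤ : μ ≤ (1# - D) * (1# - β) * (fromℕ 2 ^ d * p ^ d * fromℕ N ^ suc m)) where

        private
          multiplicity : G → ℝ
          multiplicity h = fromℕ (length (J h)) * (1# + 𝟙 (h ∙ h Fin.≟ ε))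

          0<length : ∀ h → 0# < fromℕ (length (J h))
          0<length h with small? h
          ... | yes _ = subst (0# <_) (sym (Fin-size d)) (0<fromℕ-suc (suc m))
          ... | no  _ = 0<fromℕ-suc 0

          0<multiplicity : ∀ h → 0# < multiplicity h
          0<multiplicity h = *-pos (0<length h) (<-≤-trans 0<1 (x≤x+y (𝟙-nonneg (h ∙ h Fin.≟ ε))))

          chosenFamily : ∀ h → h ≢ ε → List (Vec G d)
          chosenFamily h h≢ε = family 0≤p p≤1 0<N h h≢ε 1≤ρ (≤-trans Z sum≤ρ²) (≤-trans Z sum≤Nρ) (J h) (J-large h)

          -- The identity gets an empty family so that the sum may run over the whole group; the
          -- indicator in `familyFailure` cancels its contribution.
          familyOf : G → List (Vec G d)
          familyOf h with h Fin.≟ ε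
          ... | yes _  = []
          ... | no h≢ε = chosenFamily h h≢ε

          familyFailure : G → Subset N → ℝ
          familyFailure h S = 𝟙 (¬? (h Fin.≟ ε)) * none (familyOf h) S

          expectation-bound : ∀ h → 𝔼 p N (familyFailure h) ≤ exp (- (μ / multiplicity h))
          expectation-bound h with h Fin.≟ ε
          ... | yes _  = ≤-trans (≤-reflexive (trans (𝔼-cong p N (λ S → zeroˡ 1#)) (𝔼-const p N 0#))) (exp-nonneg _)
          ... | no h≢ε = ≤-trans (≤-reflexive (𝔼-cong p N (λ S → *-identityˡ _)))
                           (failure-bound 0≤p p≤1 0<N h h≢ε 1≤ρ (≤-trans Z sum≤ρ²) (≤-trans Z sum≤Nρ) (J h) (J-large h)
                             0≤1-D D≤1 rare (0<multiplicity h) μ≤)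

          χs-cases : ∀ {k} (x : Vec G k) S → χs x S ≡ 0# ⊎ (∀ i → lookup S (lookup x i) ≡ inside)
          χs-cases []      S = inj₂ λ ()
          χs-cases (i ∷ x) S with lookup S i in eq | χs-cases x S
          ... | false | _        = inj₁ (zeroˡ _)
          ... | true  | inj₁ eq₀ = inj₁ (trans (*-identityˡ _) eq₀)
          ... | true  | inj₂ ins = inj₂ λ { zero → eq ; (suc j) → ins j }

          none-cases : ∀ {k} (xs : List (Vec G k)) S →
              none xs S ≡ 1# ⊎ (∃[ x ] x ∈ xs × (∀ i → lookup S (lookup x i) ≡ inside))
          none-cases []       S = inj₁ refl
          none-cases (x ∷ xs) S with χs-cases x S | none-cases xs S
          ... | inj₂ ins | _                      = inj₂ (x , here refl , ins)
          ... | inj₁ _   | inj₂ (y , y∈ , ins)    = inj₂ (y , there y∈ , ins)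
          ... | inj₁ eq₀ | inj₁ eq₁               = inj₁ (trans (cong₂ (λ a b → (1# - a) * b) eq₀ eq₁)
                (solve 0 ((κ 1 :- κ 0) :* κ 1 := κ 1) refl))

          product≡eval : ∀ {k} (t : Vec G (suc k)) → CayleyDiameter.product 𝔽 t ≡ eval t (identityWord k)
          product≡eval t = trans (go t) (sym (eval-identityWord t))
            where
            go : ∀ {k} (t : Vec G k) → CayleyDiameter.product 𝔽 t ≡ Family.product R indexGroup (toList t)
            go []      = refl
            go (x ∷ t) = cong (x ∙_) (go t)

          word-from-family : ∀ h → h ≢ ε → ∀ S x → x ∈ familyOf h → (∀ i → lookup S (lookup x i) ≡ inside) →
                             ∃[ t ] CayleyDiameter.product 𝔽 {d} t ≡ h × Labelled S t
          word-from-family h h≢ε S x x∈ ins with h Fin.≟ ε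
          ... | yes h≡ε = ⊥-elim (h≢ε h≡ε)
          ... | no  h≢ε with ∈-map⁻ letters x∈
          ...   | f , f∈ , refl = proj₂ f ,
                  trans (product≡eval (proj₂ f)) (All.lookup (family-value 0≤p p≤1 0<N h h≢ε 1≤ρ (≤-trans Z sum≤ρ²)
                      (≤-trans Z sum≤Nρ) (J h) (J-large h)) f∈) ,
                  λ i → lookup (proj₁ f) i , trans (cong (lookup S) (sym (lookup-letters f i))) (ins i)

          failure-cases : ∀ S → 𝟙 (diameterExceeds? d S) ≤ ∑ all (λ h → familyFailure h S)
          failure-cases S = 𝟙-≤ (diameterExceeds? d S) (∑-nonneg {f = λ h → familyFailure h S} nonneg
              all) λ exceeds → by exceeds
            where
            nonneg : ∀ h → 0# ≤ familyFailure h S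
            nonneg h = *-nonneg (𝟙-nonneg (¬? (h Fin.≟ ε))) (none-nonneg (familyOf h) S)
            by : DiameterExceeds d S → 1# ≤ ∑ all (λ h → familyFailure h S)
            by exceeds with Fin.any? (λ h → 1# ≤? familyFailure h S)
            ... | yes (h , 1≤) = ≤-trans 1≤ (Enumeration.term≤∑ (Fin-enumeration N) {λ h → familyFailure h S} nonneg h)
            ... | no  none<1   = ⊥-elim (exceeds (diameter S λ h h≢ε → reach h h≢ε (none-cases (familyOf h) S)))
              where
              reach : ∀ h → h ≢ ε → none (familyOf h) S
                  ≡ 1# ⊎ (∃[ x ] x ∈ familyOf h × (∀ i → lookup S (lookup x i) ≡ inside)) →
                      ∃[ t ] CayleyDiameter.product 𝔽 {d} t ≡ h × Labelled S t
              reach h h≢ε (inj₁ eq) = ⊥-elim (none<1 (h , ≤-reflexive (sym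
                (trans (cong₂ _*_ (𝟙-yes (¬? (h Fin.≟ ε)) h≢ε) eq) (*-identityˡ 1#)))))
              reach h h≢ε (inj₂ (x , x∈ , ins)) = word-from-family h h≢ε S x x∈ ins

        private
          -- The multiplicities are 1, 2, d and 2d: generic elements, involutions, elements of small
          -- class, and involutions of small class.
          b₁ b₂ b₃ b₄ : ℝ
          b₁ = exp (- μ)
          b₂ = exp (- (μ / fromℕ 2))
          b₃ = exp (- (μ / fromℕ d))
          b₄ = exp (- (μ / fromℕ (2 ℕ.* d)))

          rewriteDenominator : ∀ {a b x} → a ≡ b → exp (- (μ / b)) ≤ x → exp (- (μ / a)) ≤ x
          rewriteDenominator refl le = le

          -- Each element is charged to the term of its own kind, the other terms being nonnegative.
          -- The decisions are arguments, so that matching on them reduces the length of `J` and all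
          -- indicators together.
          cases : ∀ {a b} {P : Set a} {Q : Set b} (P? : Dec P) (Q? : Dec Q) →
            exp (- (μ / (fromℕ (length (if does Q? then allFin d else zero ∷ [])) * (1# + 𝟙 P?)))) ≤
            b₁ + 𝟙 P? * b₂ + 𝟙 Q? * b₃ + 𝟙 (P? ×-dec Q?) * b₄
          cases (no _) (no _) = rewriteDenominator
                  (solve 0 ((κ 1 :+ κ 0) :* (κ 1 :+ κ 0) := κ 1) refl)
                  (≤-trans (≤-reflexive (cong (λ z → exp (- z)) (trans (sym (*-identityʳ _)) (/-cancel 0<1 μ))))
                    (≤-reflexive (solve 4 (λ a b c e → a := a :+ κ 0 :* b :+ κ 0 :* c :+ κ 0 :* e) refl b₁ b₂ b₃ b₄)))
          cases (yes _) (no _) = rewriteDenominator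
                  (solve 0 ((κ 1 :+ κ 0) :* (κ 1 :+ κ 1) := κ 2) refl)
                  (≤-slack b₁ (exp-nonneg _) (solve 4 (λ a b c e → a :+ κ 1 :* b :+ κ 0 :* c :+ κ 0 :* e := b :+ a)
                      refl b₁ b₂ b₃ b₄))
          cases (no _) (yes _) = rewriteDenominator
                  (trans (cong (_* (1# + 0#)) (Fin-size d)) (solve 1 (λ d → d :* (κ 1 :+ κ 0) := d) refl (fromℕ d)))
                  (≤-slack b₁ (exp-nonneg _) (solve 4 (λ a b c e → a :+ κ 0 :* b :+ κ 1 :* c :+ κ 0 :* e := c :+ a)
                      refl b₁ b₂ b₃ b₄))
          cases (yes _) (yes _) = rewriteDenominator
                  (trans (cong (_* (1# + 1#)) (Fin-size d)) (trans (solve 1 (λ d → d :* (κ 1 :+ κ 1) := κ 2 :* d)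
                      refl (fromℕ d)) (sym (fromℕ-* 2 d))))
                  (≤-slack (b₁ + b₂ + b₃) (+-nonneg (+-nonneg (exp-nonneg _) (exp-nonneg _)) (exp-nonneg _))
                    (solve 4 (λ a b c e → a :+ κ 1 :* b :+ κ 1 :* c :+ κ 1 :* e := e :+ (a :+ b :+ c)) refl b₁ b₂ b₃
                        b₄))

          classwise : ∀ h → exp (- (μ / multiplicity h)) ≤
            b₁ + 𝟙 (involution? (element h)) * b₂ + 𝟙 (small? h) * b₃ + 𝟙 (involution? (element h) ×-dec small? h) * b₄
          classwise h = rewriteDenominator (cong (λ i → fromℕ (length (J h)) * (1# + i)) (sym (involution≡ h)))
            (cases (involution? (element h)) (small? h))

        exceeds-probability : ∀ {q} → p ≤ q → q ≤ 1# → Pr q (diameterExceeds? d) ≤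
          fromℕ N * b₁ + fromℕ (# involution?) * b₂ + #small * b₃ +
          fromℕ (# (λ x → involution? x ×-dec (fromℕ (cl x) ≤? M))) * b₄
        exceeds-probability {q} p≤q q≤1 = begin
          Pr q (diameterExceeds? d)
            ≡⟨ Pr≡𝔼 q (diameterExceeds? d) ⟩
          𝔼 q N (λ S → 𝟙 (diameterExceeds? d S))
            -- Exceeding the diameter is a decreasing event, so the probability q may be lowered to
            -- the threshold p.
            ≤⟨ 𝔼-antitone 0≤p p≤q q≤1 (λ {S} {T} S⊆T → 𝟙-mono (diameterExceeds? d T) (diameterExceeds? d S)
                (exceeds-antitone S⊆T)) ⟩
          𝔼 p N (λ S → 𝟙 (diameterExceeds? d S))
            ≤⟨ Weighted.𝔼-mono 0≤p p≤1 N failure-cases ⟩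
          𝔼 p N (λ S → ∑ all (λ h → familyFailure h S))
            ≡⟨ 𝔼-∑ p N all familyFailure ⟩
          ∑ all (λ h → 𝔼 p N (familyFailure h))
            ≤⟨ ∑-mono (λ h → ≤-trans (expectation-bound h) (classwise h)) all ⟩
          ∑ all (λ h → b₁ + i h * b₂ + s h * b₃ + is h * b₄)
            ≡⟨ trans (∑-+ (λ h → b₁ + i h * b₂ + s h * b₃) (λ h → is h * b₄) all) (cong (_+ ∑ all (λ h → is h * b₄))
                 (trans (∑-+ (λ h → b₁ + i h * b₂) (λ h → s h * b₃) all) (cong (_+ ∑ all (λ h → s h * b₃))
                   (∑-+ (λ _ → b₁) (λ h → i h * b₂) all)))) ⟩
          ∑ all (λ _ → b₁) + ∑ all (λ h → i h * b₂) + ∑ all (λ h → s h * b₃) + ∑ all (λ h → is h * b₄)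
            ≡⟨ cong₂ _+_ (cong₂ _+_ (cong₂ _+_ (trans (∑-const b₁ all) (cong (_* b₁) (Fin-size N)))
                 (trans (∑-*ʳ b₂ i all) (cong (_* b₂) (sym (fromℕ-filter (involution? ∘ element) all)))))
                 (trans (∑-*ʳ b₃ s all) (cong (_* b₃) (sym #small≡))))
                 (trans (∑-*ʳ b₄ is all) (cong (_* b₄) (sym (fromℕ-filter
                     (λ h → involution? (element h) ×-dec small? h) all)))) ⟩
          fromℕ N * b₁ + fromℕ (# involution?) * b₂ + #small * b₃ +
          fromℕ (# (λ x → involution? x ×-dec (fromℕ (cl x) ≤? M))) * b₄ ∎
          where
          open ≤-Reasoning
          i s is : G → ℝ
          i h  = 𝟙 (involution? (element h))
          s h  = 𝟙 (small? h)
          is h = 𝟙 (involution? (element h) ×-dec small? h)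

-- Estimates relating d, log N and log log N.

module Asymptotics (R : Reals) where
  open Reals R
  open OrderedField R
  open Exponential R

  -- With h = y/2 ≥ 32 one has exp y = (exp h)² ≥ h² ≥ 32 h.
  16y≤exp-y : ∀ {y} → fromℕ 64 ≤ y → fromℕ 16 * y ≤ exp y
  16y≤exp-y {y} 64≤y = begin
    fromℕ 16 * y                ≡⟨ cong (fromℕ 16 *_) 2h≡y ⟨
    fromℕ 16 * (fromℕ 2 * h)    ≡⟨ solve 1 (λ h → κ 16 :* (κ 2 :* h) := κ 32 :* h) refl h ⟩
    fromℕ 32 * h                ≤⟨ *-mono-≤ 0≤h 0≤h 32≤h ≤-refl ⟩
    h * h                       ≤⟨ *-mono-≤ (exp-nonneg h) 0≤h h≤exp h≤exp ⟩
    exp h * exp h               ≡⟨ exp-+ h h ⟨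
    exp (h + h)                 ≡⟨ cong exp (trans (solve 1 (λ h → h :+ h := κ 2 :* h) refl h) 2h≡y) ⟩
    exp y                       ∎
    where
    open ≤-Reasoning
    h = y / fromℕ 2
    2h≡y : fromℕ 2 * h ≡ y
    2h≡y = trans (*-comm _ _) (/-cancel 0<2 y)
    32≤h : fromℕ 32 ≤ h
    32≤h = ≤/ 0<2 (≤-trans (≤-reflexive (solve 0 (κ 32 :* κ 2 := κ 64) refl)) 64≤y)
    0≤h : 0# ≤ h
    0≤h = ≤-trans (fromℕ-nonneg 32) 32≤h
    h≤exp : h ≤ exp h
    h≤exp = ≤-trans (x≤y+x 0≤1) (1+x≤exp h)

  -- L, y and u stand for log N, log log N and √ (log N log log N).
  module Scale {L y u : ℝ} (m : ℕ) (exp-y : exp y ≡ L) (64≤y : fromℕ 64 ≤ y) (0≤u : 0# ≤ u) (u²≡Ly : u * u ≡ L * y)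
               (ddy : fromℕ (suc (suc m)) * fromℕ (suc (suc m)) * (fromℕ 2 * y) ≤ L) where

    d : ℕ
    d = suc (suc m)

    D : ℝ
    D = fromℕ d

    0≤y : 0# ≤ y
    0≤y = ≤-trans (fromℕ-nonneg 64) 64≤y

    0<L : 0# < L
    0<L = subst (0# <_) exp-y (0<exp y)

    0≤L : 0# ≤ L
    0≤L = <⇒≤ 0<L

    0≤D : 0# ≤ D
    0≤D = fromℕ-nonneg d

    1≤D : 1# ≤ D
    1≤D = 1≤fromℕ-suc (suc m)

    0≤DD : 0# ≤ D * D
    0≤DD = *-nonneg 0≤D 0≤D

    1≤DD : 1# ≤ D * D
    1≤DD = ≤-trans (≤-reflexive (sym (*-identityˡ 1#))) (*-mono-≤ 0≤D 0≤1 1≤D 1≤D)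

    16y≤L : fromℕ 16 * y ≤ L
    16y≤L = subst (fromℕ 16 * y ≤_) exp-y (16y≤exp-y 64≤y)

    0≤y-2 : 0# ≤ y - fromℕ 2
    0≤y-2 = x≤y⇒0≤y-x (≤-trans (fromℕ-mono-≤ (ℕ.m≤m+n 2 62)) 64≤y)

    4DD≤L : fromℕ 4 * (D * D) ≤ L
    4DD≤L = ≤-slack ((L - D * D * (fromℕ 2 * y)) + fromℕ 2 * (D * D * (y - fromℕ 2)))
      (+-nonneg (x≤y⇒0≤y-x ddy) (*-nonneg (fromℕ-nonneg 2) (*-nonneg 0≤DD 0≤y-2)))
      (solve 3 (λ L e y → L := κ 4 :* (e :* e) :+ ((L :- e :* e :* (κ 2 :* y)) :+
         κ 2 :* (e :* e :* (y :- κ 2)))) refl L D y)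

    4≤L : fromℕ 4 ≤ L
    4≤L = ≤-trans (≤-trans (≤-reflexive (sym (*-identityʳ _))) (*-monoˡ-≤ (fromℕ-nonneg 4) 1≤DD)) 4DD≤L

    DD≤L : D * D ≤ L
    DD≤L = ≤-trans (≤-slack (fromℕ 3 * (D * D)) (*-nonneg (fromℕ-nonneg 3) 0≤DD)
      (solve 1 (λ e → κ 4 :* (e :* e) := e :* e :+ κ 3 :* (e :* e)) refl D)) 4DD≤L

    D≤L : D ≤ L
    D≤L = ≤-trans (≤-trans (≤-reflexive (sym (*-identityˡ D))) (*-monoʳ-≤ 0≤D 1≤D)) DD≤L

    -- Squared: 16 D² y² ≤ 8 L y = 8 u² by `ddy`, and a further u² rounds √8 up to 3.
    4Dy≤3u : fromℕ 4 * (D * y) ≤ fromℕ 3 * u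
    4Dy≤3u = square-cancel-≤ (*-nonneg (fromℕ-nonneg 3) 0≤u) (≤-slack
      (fromℕ 8 * y * (L - D * D * (fromℕ 2 * y)) + u * u)
      (+-nonneg (*-nonneg (*-nonneg (fromℕ-nonneg 8) 0≤y) (x≤y⇒0≤y-x ddy)) (*-nonneg 0≤u 0≤u))
      (trans (solve 1 (λ u → κ 3 :* u :* (κ 3 :* u) := κ 8 :* (u :* u) :+ u :* u) refl u)
        (trans (cong (λ z → fromℕ 8 * z + u * u) u²≡Ly)
          (solve 4 (λ L y e u → κ 8 :* (L :* y) :+ u :* u := κ 4 :* (e :* y) :* (κ 4 :* (e :* y)) :+
            (κ 8 :* y :* (L :- e :* e :* (κ 2 :* y)) :+ u :* u)) refl L y D u))))

    -- Squared, this is 16 L y ≤ L², which is `16y≤L` times L.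
    4u≤L : fromℕ 4 * u ≤ L
    4u≤L = square-cancel-≤ 0≤L (≤-slack (L * (L - fromℕ 16 * y)) (*-nonneg 0≤L (x≤y⇒0≤y-x 16y≤L))
      (trans (solve 2 (λ L y → L :* L := κ 16 :* (L :* y) :+ L :* (L :- κ 16 :* y)) refl L y)
        (trans (cong (λ z → fromℕ 16 * z + L * (L - fromℕ 16 * y)) (sym u²≡Ly))
          (cong (_+ L * (L - fromℕ 16 * y)) (solve 1 (λ u → κ 16 :* (u :* u) := κ 4 :* u :* (κ 4 :* u)) refl u)))))

    B≤u : ∀ {B} → B * B ≤ L → B ≤ u
    B≤u {B} B²≤L = square-cancel-≤ 0≤u (≤-trans B²≤L (≤-slack (L * (y - fromℕ 2) + L)
      (+-nonneg (*-nonneg 0≤L 0≤y-2) 0≤L)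
      (trans u²≡Ly (solve 2 (λ L y → L :* y := L :+ (L :* (y :- κ 2) :+ L)) refl L y))))

    DB≤L : ∀ {B} → B * B ≤ L → D * B ≤ L
    DB≤L {B} B²≤L = square-cancel-≤ 0≤L (≤-trans (≤-reflexive (solve 2
        (λ e b → e :* b :* (e :* b) := e :* e :* (b :* b)) refl D B))
      (*-mono-≤ 0≤L (square-nonneg B) DD≤L B²≤L))

    L^k≡exp : ∀ k → L ^ k ≡ exp (fromℕ k * y)
    L^k≡exp k = trans (cong (_^ k) (sym exp-y)) (sym (exp-multiple k y))

    private
      2D = fromℕ 2 * D

      1≤2D : 1# ≤ 2D
      1≤2D = ≤-trans (≤-reflexive (sym (*-identityˡ 1#))) (*-mono-≤ (fromℕ-nonneg 2) 0≤1 (1≤fromℕ-suc 1) 1≤D)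

      0≤2D : 0# ≤ 2D
      0≤2D = ≤-trans 0≤1 1≤2D

    [2D]^d≤exp : 2D ^ d ≤ exp (D * y)
    [2D]^d≤exp = ≤-trans (^-mono-≤ 0≤2D 2D≤L d) (≤-reflexive (L^k≡exp d))
      where
      2D≤L : 2D ≤ L
      2D≤L = ≤-trans (≤-trans (≤-reflexive (sym (*-identityˡ 2D))) (*-monoʳ-≤ 0≤2D 1≤2D))
        (≤-trans (≤-reflexive (solve 1 (λ e → κ 2 :* e :* (κ 2 :* e) := κ 4 :* (e :* e)) refl D)) 4DD≤L)

    -- Both kinds of exceptions number at most (2D)^d ≤ exp (D y), and D y - u ≤ -u/4. The crude
    -- bound exp v ≥ v at v = u/4 then asks for ζ u ≥ 16.
    exceptions-bound : ∀ {ζ} → 0# ≤ ζ → fromℕ 16 ≤ ζ * u →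
                       (2D ^ d + fromℕ 2 * (D * D)) * (fromℕ 2 * exp (- u)) ≤ ζ
    exceptions-bound {ζ} 0≤ζ 16≤ζu = begin
      (2D ^ d + fromℕ 2 * (D * D)) * (fromℕ 2 * exp (- u))
        ≤⟨ *-monoʳ-≤ (*-nonneg (fromℕ-nonneg 2) (exp-nonneg _)) (+-monoʳ-≤ (2D ^ d) 2DD≤) ⟩
      (2D ^ d + 2D ^ d) * (fromℕ 2 * exp (- u))
        ≡⟨ solve 2 (λ a e → (a :+ a) :* (κ 2 :* e) := κ 4 :* (a :* e)) refl (2D ^ d) (exp (- u)) ⟩
      fromℕ 4 * (2D ^ d * exp (- u))
        ≤⟨ *-monoˡ-≤ (fromℕ-nonneg 4) (*-monoʳ-≤ (exp-nonneg _) [2D]^d≤exp) ⟩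
      fromℕ 4 * (exp (D * y) * exp (- u))
        ≡⟨ cong (fromℕ 4 *_) (exp-+ (D * y) (- u)) ⟨
      fromℕ 4 * exp (D * y + - u)
        ≤⟨ *-monoˡ-≤ (fromℕ-nonneg 4) (exp-mono-≤ exponent) ⟩
      fromℕ 4 * exp (- v)
        ≤⟨ *-monoʳ-≤ (exp-nonneg _) 4≤ ⟩
      ζ * exp v * exp (- v)
        ≡⟨ trans (*-assoc _ _ _) (trans (cong (ζ *_) (exp-inverse v)) (*-identityʳ ζ)) ⟩
      ζ ∎
      where
      open ≤-Reasoning
      0<4 : 0# < fromℕ 4
      0<4 = 0<fromℕ-suc 3
      v = u / fromℕ 4
      4v≡u : fromℕ 4 * v ≡ u
      4v≡u = trans (*-comm _ _) (/-cancel 0<4 u)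
      exponent : D * y + - u ≤ - v
      exponent = *-cancelˡ-≤ 0<4 (≤-slack (fromℕ 3 * u - fromℕ 4 * (D * y)) (x≤y⇒0≤y-x 4Dy≤3u)
        (trans (solve 1 (λ v → κ 4 :* (:- v) := :- (κ 4 :* v)) refl v) (trans (cong -_ 4v≡u)
          (solve 2 (λ a u → :- u := κ 4 :* (a :+ :- u) :+ (κ 3 :* u :- κ 4 :* a)) refl (D * y) u))))
      4≤ : fromℕ 4 ≤ ζ * exp v
      4≤ = ≤-trans (*-cancelˡ-≤ 0<4 (≤-trans (≤-reflexive (solve 0 (κ 4 :* κ 4 := κ 16) refl))
        (≤-trans 16≤ζu (≤-reflexive (trans (cong (ζ *_) (sym 4v≡u)) (solve 2
            (λ z v → z :* (κ 4 :* v) := κ 4 :* (z :* v)) refl ζ v))))))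
        (*-monoˡ-≤ 0≤ζ (≤-trans (x≤y+x 0≤1) (1+x≤exp v)))
      2DD≤ : fromℕ 2 * (D * D) ≤ 2D ^ d
      2DD≤ = ≤-trans (≤-slack (fromℕ 2 * (D * D)) (*-nonneg (fromℕ-nonneg 2) 0≤DD)
        (solve 1 (λ e → κ 2 :* e :* (κ 2 :* e :* κ 1) := κ 2 :* (e :* e) :+ κ 2 :* (e :* e)) refl D))
        (*-monoˡ-≤ 0≤2D (*-monoˡ-≤ 0≤2D (1≤^ 1≤2D m)))

    module _ {n p ε : ℝ} (exp-L : exp L ≡ n) (0≤p : 0# ≤ p) (0<ε : 0# < ε) (ε≤1 : ε ≤ 1#)
             (λ≡ : fromℕ 2 ^ d * p ^ d * n ^ suc m ≡ (1# + ε) * L) where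

      q : ℝ
      q = n * p

      0<n : 0# < n
      0<n = subst (0# <_) exp-L (0<exp L)

      0≤q : 0# ≤ q
      0≤q = *-nonneg (<⇒≤ 0<n) 0≤p

      -- (2q)^d = N (1+ε) log N exceeds N, whereas (L⁵)^d ≤ N.
      L⁴≤q : L ^ 4 ≤ q
      L⁴≤q with L ^ 4 ≤? q
      ... | yes le = le
      ... | no  ≰  = ⊥-elim (<⇒≱ 1<λ (*-cancelˡ-≤ 0<n (begin
        n * ((1# + ε) * L)            ≡⟨ cong (n *_) λ≡ ⟨
        n * (fromℕ 2 ^ d * p ^ d * n ^ suc m)
          ≡⟨ solve 4 (λ n t p k → n :* (t :* p :* k) := t :* (n :* k :* p)) refl n (fromℕ 2 ^ d) (p ^ d) (n ^ suc m) ⟩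
        fromℕ 2 ^ d * (n ^ d * p ^ d) ≡⟨ cong (fromℕ 2 ^ d *_) (^-distrib-* n p d) ⟨
        fromℕ 2 ^ d * q ^ d           ≡⟨ ^-distrib-* (fromℕ 2) q d ⟨
        (fromℕ 2 * q) ^ d             ≤⟨ ^-mono-≤ (*-nonneg (fromℕ-nonneg 2) 0≤q)
            (*-mono-≤ 0≤L 0≤q 2≤L (<⇒≤ (≰⇒> ≰))) d ⟩
        (L ^ 5) ^ d                   ≡⟨ trans (^-assocʳ L 5 d) (L^k≡exp (5 ℕ.* d)) ⟩
        exp (fromℕ (5 ℕ.* d) * y)     ≤⟨ exp-mono-≤ 5Dy≤L ⟩
        exp L                         ≡⟨ exp-L ⟩
        n                             ≡⟨ *-identityʳ n ⟨
        n * 1#                        ∎)))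
        where
        open ≤-Reasoning
        2≤L : fromℕ 2 ≤ L
        2≤L = ≤-trans (fromℕ-mono-≤ (ℕ.m≤m+n 2 2)) 4≤L
        1<λ : 1# < (1# + ε) * L
        1<λ = <-≤-trans (1≤fromℕ-suc 1 , λ 1≡2 → 0≢1 (sym (trans (solve 0 (κ 1 := κ 2 :- κ 1) refl)
                (trans (cong (_- 1#) (sym 1≡2)) (-‿inverseʳ 1#)))))
          (≤-trans 2≤L (≤-slack (ε * L) (*-nonneg (<⇒≤ 0<ε) 0≤L) (solve 2 (λ e l → (κ 1 :+ e) :* l := l :+ e :* l)
              refl ε L)))
        -- In sixteenths: 80 D y ≤ 60 u ≤ 15 L, by `4Dy≤3u` and `4u≤L`.
        5Dy≤L : fromℕ (5 ℕ.* d) * y ≤ L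
        5Dy≤L = subst (λ z → z * y ≤ L) (sym (fromℕ-* 5 d)) (*-cancelˡ-≤ (0<fromℕ-suc 15) (≤-slack
          (fromℕ 20 * (fromℕ 3 * u - fromℕ 4 * (D * y)) + fromℕ 15 * (L - fromℕ 4 * u) + L)
          (+-nonneg (+-nonneg (*-nonneg (fromℕ-nonneg 20) (x≤y⇒0≤y-x 4Dy≤3u))
              (*-nonneg (fromℕ-nonneg 15) (x≤y⇒0≤y-x 4u≤L))) 0≤L)
          (solve 4 (λ L e y u → κ 16 :* L := κ 16 :* (κ 5 :* e :* y) :+
             (κ 20 :* (κ 3 :* u :- κ 4 :* (e :* y)) :+ κ 15 :* (L :- κ 4 :* u) :+ L)) refl L D y u)))

      1≤L : 1# ≤ L
      1≤L = ≤-trans (1≤fromℕ-suc 3) 4≤L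

      L≤q : L ≤ q
      L≤q = ≤-trans (≤-trans (≤-reflexive (sym (*-identityʳ L))) (*-monoˡ-≤ 0≤L (1≤^ 1≤L 3))) L⁴≤q

      0<q : 0# < q
      0<q = <-≤-trans 0<L L≤q

      -- (1 + D/q)^m ≤ exp (m D / q), and m D ≤ D² ≤ L ≤ q.
      W^m-bound : (q + D) ^ m ≤ q ^ m * exp 1#
      W^m-bound = begin
        (q + D) ^ m                  ≤⟨ ^-mono-≤ (+-nonneg 0≤q 0≤D) W≤ m ⟩
        (q * exp s) ^ m              ≡⟨ ^-distrib-* q (exp s) m ⟩
        q ^ m * exp s ^ m            ≡⟨ cong (q ^ m *_) (exp-multiple m s) ⟨
        q ^ m * exp (fromℕ m * s)    ≤⟨ *-monoˡ-≤ (^-nonneg 0≤q m) (exp-mono-≤ ms≤1) ⟩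
        q ^ m * exp 1#               ∎
        where
        open ≤-Reasoning
        s = D / q
        W≤ : q + D ≤ q * exp s
        W≤ = ≤-trans (≤-reflexive (trans (cong (q +_) (sym (/-cancel 0<q D)))
               (solve 2 (λ q s → q :+ s :* q := q :* (κ 1 :+ s)) refl q s)))
             (*-monoˡ-≤ 0≤q (1+x≤exp s))
        ms≤1 : fromℕ m * s ≤ 1#
        ms≤1 = ≤-trans (*-monoʳ-≤ (/-nonneg 0≤D 0<q) (fromℕ-mono-≤ (ℕ.m≤n+m m 2))) (*-cancelʳ-≤ 0<q (begin
          D * s * q     ≡⟨ trans (*-assoc _ _ _) (cong (D *_) (/-cancel 0<q D)) ⟩
          D * D         ≤⟨ ≤-trans DD≤L L≤q ⟩
          q             ≡⟨ *-identityˡ q ⟨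
          1# * q        ∎))

      -- Times q, the left side is at most e D³ times the mean (1 + ε) L. As D² ≤ L and D ≤ L, this
      -- is at most 2 e L³, which `L⁴≤q` outweighs.
      dependence-bound : ∀ {ζ} → 0# ≤ ζ → fromℕ 2 * exp 1# ≤ ζ * L →
                         fromℕ 2 ^ d * (D * (D * (D * p * (q + D) ^ m))) ≤ ζ
      dependence-bound {ζ} 0≤ζ 2e≤ζL = *-cancelʳ-≤ 0<q (begin
        fromℕ 2 ^ d * (D * (D * (D * p * (q + D) ^ m))) * q
          ≡⟨ solve 5 (λ t e p w q → t :* (e :* (e :* (e :* p :* w))) :* q := t :* (e :* e :* e) :* p :* q :* w) refl
              (fromℕ 2 ^ d) D p _ q ⟩
        fromℕ 2 ^ d * (D * D * D) * p * q * (q + D) ^ m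
          ≤⟨ *-monoˡ-≤ (*-nonneg (*-nonneg (*-nonneg (^-nonneg (fromℕ-nonneg 2) d) (*-nonneg 0≤DD 0≤D)) 0≤p) 0≤q)
              W^m-bound ⟩
        fromℕ 2 ^ d * (D * D * D) * p * q * (q ^ m * exp 1#)
          ≡⟨ solve 6 (λ t c p q r e → t :* c :* p :* q :* (r :* e) := c :* e :* (t :* p :* (q :* r))) refl
              (fromℕ 2 ^ d) (D * D * D) p q (q ^ m) (exp 1#) ⟩
        D * D * D * exp 1# * (fromℕ 2 ^ d * p * q ^ suc m)
          ≡⟨ cong (λ z → D * D * D * exp 1# * (fromℕ 2 ^ d * p * z)) (^-distrib-* n p (suc m)) ⟩
        D * D * D * exp 1# * (fromℕ 2 ^ d * p * (n ^ suc m * p ^ suc m))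
          ≡⟨ cong (D * D * D * exp 1# *_) (trans (solve 4 (λ t p n r → t :* p :* (n :* r) := t :* (p :* r) :* n)
              refl (fromℕ 2 ^ d) p (n ^ suc m) (p ^ suc m)) λ≡) ⟩
        D * D * D * exp 1# * ((1# + ε) * L)
          ≤⟨ *-mono-≤ (*-nonneg (*-nonneg 0≤L 0≤L) (exp-nonneg 1#)) (*-nonneg (+-nonneg 0≤1 (<⇒≤ 0<ε)) 0≤L)
               (*-monoʳ-≤ (exp-nonneg 1#) (*-mono-≤ 0≤L 0≤D DD≤L D≤L))
               (*-monoʳ-≤ 0≤L (≤-trans (+-monoʳ-≤ 1# ε≤1) (≤-reflexive (solve 0 (κ 1 :+ κ 1 := κ 2) refl)))) ⟩
        L * L * exp 1# * (fromℕ 2 * L)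
          ≡⟨ solve 2 (λ l e → l :* l :* e :* (κ 2 :* l) := κ 2 :* e :* (l :* (l :* l))) refl L (exp 1#) ⟩
        fromℕ 2 * exp 1# * (L * (L * L))
          ≤⟨ *-monoʳ-≤ (*-nonneg 0≤L (*-nonneg 0≤L 0≤L)) 2e≤ζL ⟩
        ζ * L * (L * (L * L))
          ≡⟨ solve 2 (λ z l → z :* l :* (l :* (l :* l)) := z :* (l :* (l :* (l :* (l :* κ 1))))) refl ζ L ⟩
        ζ * L ^ 4
          ≤⟨ *-monoˡ-≤ 0≤ζ L⁴≤q ⟩
        ζ * q ∎)
        where open ≤-Reasoning

  -- (1 - ζ)² (1 + 16 ζ) exceeds 1 + 12 ζ by at least 2 ζ (1 - 16 ζ) ≥ 0: a quarter of the surplus ε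
  -- pays for dependence and for bad words.
  mean-bound : ∀ {ε ζ D β L} → 0# ≤ ε → ε ≤ 1# → fromℕ 16 * ζ ≡ ε → 0# ≤ L → D ≤ ζ → β ≤ ζ → ζ ≤ 1# →
    (1# + fromℕ 12 * ζ) * L ≤ (1# - D) * (1# - β) * ((1# + ε) * L)
  mean-bound {ε} {ζ} {D} {β} {L} 0≤ε ε≤1 refl 0≤L D≤ζ β≤ζ ζ≤1 = ≤-trans
    (≤-slack (ζ * ζ * (1# + ε) * L + (fromℕ 2 * ζ * (1# - ε)) * L)
      (+-nonneg (*-nonneg (*-nonneg (square-nonneg ζ) (+-nonneg 0≤1 0≤ε)) 0≤L)
                (*-nonneg (*-nonneg (*-nonneg (fromℕ-nonneg 2) 0≤ζ) (x≤y⇒0≤y-x ε≤1)) 0≤L))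
      (solve 2 (λ z l → (κ 1 :- z) :* (κ 1 :- z) :* ((κ 1 :+ κ 16 :* z) :* l) :=
        (κ 1 :+ κ 12 :* z) :* l :+ (z :* z :* (κ 1 :+ κ 16 :* z) :* l :+
        (κ 2 :* z :* (κ 1 :- κ 16 :* z)) :* l)) refl ζ L))
    (*-monoʳ-≤ (*-nonneg (+-nonneg 0≤1 0≤ε) 0≤L)
      (*-mono-≤ (x≤y⇒0≤y-x (≤-trans D≤ζ ζ≤1)) (x≤y⇒0≤y-x ζ≤1) (+-monoʳ-≤ 1# (neg-mono-≤ D≤ζ))
          (+-monoʳ-≤ 1# (neg-mono-≤ β≤ζ))))
    where
    0≤ζ : 0# ≤ ζ
    0≤ζ = *-cancelˡ-≤ (0<fromℕ-suc 15) (≤-trans (≤-reflexive (zeroʳ _)) 0≤ε)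

-- Explicit thresholds and the four sums of the union bound.

module Threshold (R : Reals) {ε δ : Reals.ℝ R} (0<ε : Reals._<_ R (Reals.0# R) ε) (ε<1 : Reals._<_ R ε (Reals.1# R))
                 (0<δ : Reals._<_ R (Reals.0# R) δ) where
  open Reals R
  open OrderedField R
  open Exponential R
  open Asymptotics R

  ζ : ℝ
  ζ = ε / fromℕ 16

  16ζ≡ε : fromℕ 16 * ζ ≡ ε
  16ζ≡ε = trans (*-comm _ _) (/-cancel (0<fromℕ-suc 15) ε)

  0<ζ : 0# < ζ
  0<ζ = /-pos 0<ε (0<fromℕ-suc 15)

  0≤ζ : 0# ≤ ζ
  0≤ζ = <⇒≤ 0<ζ

  ζ≤1 : ζ ≤ 1#
  ζ≤1 = ≤-trans (≤-slack (fromℕ 15 * ζ) (*-nonneg (fromℕ-nonneg 15) 0≤ζ)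
    (trans (sym 16ζ≡ε) (solve 1 (λ z → κ 16 :* z := z :+ κ 15 :* z) refl ζ))) (<⇒≤ ε<1)

  -- `B₁` makes ζ B at least 16 + 2e, for `exceptions-bound` and `dependence-bound`; `B₂` makes ε δ
  -- B at least 32, for `4<δexpT`.
  B B₁ B₂ : ℝ
  B₁ = (fromℕ 16 + fromℕ 2 * exp 1#) / ζ
  B₂ = fromℕ 32 / (ε * δ)
  B  = B₁ + B₂

  0≤16+2e : 0# ≤ fromℕ 16 + fromℕ 2 * exp 1#
  0≤16+2e = +-nonneg (fromℕ-nonneg 16) (*-nonneg (fromℕ-nonneg 2) (exp-nonneg 1#))

  0≤B₁ : 0# ≤ B₁
  0≤B₁ = /-nonneg 0≤16+2e 0<ζ

  0≤B₂ : 0# ≤ B₂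
  0≤B₂ = /-nonneg (fromℕ-nonneg 32) (*-pos 0<ε 0<δ)

  0≤B : 0# ≤ B
  0≤B = +-nonneg 0≤B₁ 0≤B₂

  16+2e≤ζB : fromℕ 16 + fromℕ 2 * exp 1# ≤ ζ * B
  16+2e≤ζB = ≤-trans (≤-reflexive (trans (sym (/-cancel 0<ζ _)) (*-comm _ _))) (*-monoˡ-≤ 0≤ζ (x≤x+y 0≤B₂))

  32≤εδB : fromℕ 32 ≤ ε * δ * B
  32≤εδB = ≤-trans (≤-reflexive (trans (sym (/-cancel (*-pos 0<ε 0<δ) (fromℕ 32))) (*-comm _ _)))
    (*-monoˡ-≤ (<⇒≤ (*-pos 0<ε 0<δ)) (x≤y+x 0≤B₁))

  -- The three summands secure log L ≥ 64, B² ≤ L and B ≤ L in turn.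
  L₀ : ℝ
  L₀ = exp (fromℕ 64) + B * B + B

  0<L₀ : 0# < L₀
  0<L₀ = <-≤-trans (0<exp (fromℕ 64)) (≤-trans (x≤x+y (*-nonneg 0≤B 0≤B)) (x≤x+y 0≤B))

  module _ {c ℓ N} (m : ℕ) (𝔽 : FiniteGroup c ℓ N) {L y u : ℝ} (exp-L : exp L ≡ fromℕ N) (exp-y : exp y ≡ L)
           (0≤u : 0# ≤ u) (u²≡Ly : u * u ≡ L * y) (L₀≤L : L₀ ≤ L)
           (ddy : fromℕ (suc (suc m)) * fromℕ (suc (suc m)) * (fromℕ 2 * y) ≤ L) where
    open FiniteGroup 𝔽 using (#; cl; involution?; diameterExceeds?)

    private
      64≤y : fromℕ 64 ≤ y
      64≤y = exp-cancel-≤ (≤-trans (≤-trans (x≤x+y (*-nonneg 0≤B 0≤B)) (x≤x+y 0≤B))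
          (≤-trans L₀≤L (≤-reflexive (sym exp-y))))

      open Scale m exp-y 64≤y 0≤u u²≡Ly ddy

      B²≤L : B * B ≤ L
      B²≤L = ≤-trans (≤-trans (x≤y+x (exp-nonneg (fromℕ 64))) (x≤x+y 0≤B)) L₀≤L

      B≤L : B ≤ L
      B≤L = ≤-trans (x≤y+x (+-nonneg (exp-nonneg (fromℕ 64)) (*-nonneg 0≤B 0≤B))) L₀≤L

      0<N : 0# < fromℕ N
      0<N = subst (0# <_) exp-L (0<exp L)

      0≤N : 0# ≤ fromℕ N
      0≤N = <⇒≤ 0<N

      -- `τ` is N / M, the bound on centralizers of large classes. Commuting pairs then number at
      -- most 2 N τ, which is half of ρ². `μ` is the mean left after the losses of `mean-bound`, and
      -- `w` is 1/d.
      M τ ρ μ w : ℝ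
      M = exp (fromℕ 2 * u)
      τ = fromℕ N * exp (- (fromℕ 2 * u))
      ρ = fromℕ 2 * exp (- u) * fromℕ N
      μ = (1# + fromℕ 12 * ζ) * L
      w = 1# / D

      0<D : 0# < D
      0<D = 0<fromℕ-suc (suc m)

      0≤wL : 0# ≤ w * L
      0≤wL = *-nonneg (/-nonneg 0≤1 0<D) 0≤L

      2wL≤L : fromℕ 2 * (w * L) ≤ L
      2wL≤L = ≤-trans (*-monoʳ-≤ 0≤wL (fromℕ-mono-≤ {2} {d} (s≤s (s≤s z≤n)))) (≤-reflexive
        (trans (solve 3 (λ e w l → e :* (w :* l) := w :* e :* l) refl D w L)
            (trans (cong (_* L) (/-cancel 0<D 1#)) (*-identityˡ L))))

      0≤τ : 0# ≤ τ
      0≤τ = *-nonneg 0≤N (exp-nonneg _)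

      N≤τM : fromℕ N ≤ τ * M
      N≤τM = ≤-reflexive (sym (trans (*-assoc _ _ _) (trans (cong (fromℕ N *_)
          (trans (*-comm _ _) (exp-inverse (fromℕ 2 * u)))) (*-identityʳ _))))

      exp-2u : exp (- u) * exp (- u) ≡ exp (- (fromℕ 2 * u))
      exp-2u = trans (sym (exp-+ (- u) (- u))) (cong exp (solve 1 (λ u → :- u :+ :- u := :- (κ 2 :* u)) refl u))

      exp-2u≤exp-u : exp (- (fromℕ 2 * u)) ≤ exp (- u)
      exp-2u≤exp-u = exp-mono-≤ (≤-slack u 0≤u (solve 1 (λ u → :- u := :- (κ 2 :* u) :+ u) refl u))

      2τ≤ρ : fromℕ 2 * τ ≤ ρ
      2τ≤ρ = ≤-trans (≤-reflexive (solve 2 (λ n e → κ 2 :* (n :* e) := κ 2 :* e :* n) refl (fromℕ N) _))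
        (*-monoʳ-≤ 0≤N (*-monoˡ-≤ (fromℕ-nonneg 2) exp-2u≤exp-u))

      τ≤ρ : τ ≤ ρ
      τ≤ρ = ≤-trans (≤-slack τ 0≤τ (solve 1 (λ t → κ 2 :* t := t :+ t) refl τ)) 2τ≤ρ

      1≤ρ : 1# ≤ ρ
      1≤ρ = ≤-trans (1≤exp (x≤y⇒0≤y-x u≤L)) (≤-trans (≤-reflexive (trans (exp-+ L (- u))
          (trans (*-comm _ _) (cong (exp (- u) *_) exp-L))))
        (≤-slack (exp (- u) * fromℕ N) (*-nonneg (exp-nonneg _) 0≤N) (solve 2
            (λ e n → κ 2 :* e :* n := e :* n :+ e :* n) refl (exp (- u)) (fromℕ N))))
        where
        u≤L : u ≤ L
        u≤L = ≤-trans (≤-slack (fromℕ 3 * u) (*-nonneg (fromℕ-nonneg 3) 0≤u)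
            (solve 1 (λ u → κ 4 :* u := u :+ κ 3 :* u) refl u)) 4u≤L

      16≤ζu : fromℕ 16 ≤ ζ * u
      16≤ζu = ≤-trans (≤-trans (x≤x+y (*-nonneg (fromℕ-nonneg 2) (exp-nonneg 1#))) 16+2e≤ζB) (*-monoˡ-≤ 0≤ζ (B≤u B²≤L))

      2e≤ζL : fromℕ 2 * exp 1# ≤ ζ * L
      2e≤ζL = ≤-trans (≤-trans (x≤y+x (fromℕ-nonneg 16)) 16+2e≤ζB) (*-monoˡ-≤ 0≤ζ B≤L)

      -- A margin common to the four sums: their exponents beat the class counts by 12 ζ L, 2 ζ L,
      -- 12 ζ L / d and 6 ζ L / d, each at least `T`, which is 2 ζ L / d.
      T : ℝ
      T = fromℕ 2 * ζ * (w * L)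

      -- D² ≤ L and B² ≤ L give B ≤ L / d, so δ T is already at least 4, and exp T exceeds T.
      4<δexpT : fromℕ 4 < δ * exp T
      4<δexpT = ≤-<-trans 4≤δT (<-≤-trans δT< (*-monoˡ-≤ (<⇒≤ 0<δ) (1+x≤exp T)))
        where
        B≤wL : B ≤ w * L
        B≤wL = *-cancelˡ-≤ 0<D (≤-trans (DB≤L B²≤L) (≤-reflexive (sym (trans (sym (*-assoc _ _ _))
          (trans (cong (_* L) (trans (*-comm _ _) (/-cancel 0<D 1#))) (*-identityˡ L))))))
        4≤δT : fromℕ 4 ≤ δ * T
        4≤δT = *-cancelˡ-≤ (0<fromℕ-suc 7) (begin
          fromℕ 8 * fromℕ 4         ≡⟨ solve 0 (κ 8 :* κ 4 := κ 32) refl ⟩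
          fromℕ 32                  ≤⟨ 32≤εδB ⟩
          ε * δ * B                 ≤⟨ *-monoˡ-≤ (<⇒≤ (*-pos 0<ε 0<δ)) B≤wL ⟩
          ε * δ * (w * L)           ≡⟨ cong (λ e → e * δ * (w * L)) 16ζ≡ε ⟨
          fromℕ 16 * ζ * δ * (w * L) ≡⟨ solve 3 (λ z t x → κ 16 :* z :* t :* x := κ 8 :* (t :* (κ 2 :* z :* x)))
              refl ζ δ (w * L) ⟩
          fromℕ 8 * (δ * T)         ∎)
          where open ≤-Reasoning
        δT< : δ * T < δ * (1# + T)
        δT< = *-monoˡ-< 0<δ (≤-slack 1# 0≤1 (+-comm 1# T) , λ T≡1+T → 0≢1 (sym (trans
          (solve 1 (λ t → κ 1 := (κ 1 :+ t) :- t) refl T) (trans (cong (_- T) (sym T≡1+T)) (-‿inverseʳ T)))))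

      term-bound : ∀ {x} a b → x ≤ exp a → T + a ≤ b → x * exp (- b) ≤ exp (- T)
      term-bound {x} a b x≤ le = ≤-trans (*-monoʳ-≤ (exp-nonneg _) x≤) (≤-trans (≤-reflexive (sym (exp-+ a (- b))))
        (exp-mono-≤ (≤-slack (b - (T + a)) (x≤y⇒0≤y-x le) (solve 3 (λ t a b → :- t := (a :+ :- b) :+
            (b :- (t :+ a))) refl T a b))))

      T≤ζL : T ≤ ζ * L
      T≤ζL = ≤-trans (≤-reflexive (solve 2 (λ z x → κ 2 :* z :* x := z :* (κ 2 :* x)) refl ζ (w * L)))
          (*-monoˡ-≤ 0≤ζ 2wL≤L)

      0≤ζL : 0# ≤ ζ * L
      0≤ζL = *-nonneg 0≤ζ 0≤L

      0≤ζwL : 0# ≤ ζ * (w * L)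
      0≤ζwL = *-nonneg 0≤ζ 0≤wL

      all-bound : T + L ≤ μ
      all-bound = ≤-trans (+-monoˡ-≤ L T≤ζL) (≤-slack (fromℕ 11 * (ζ * L)) (*-nonneg (fromℕ-nonneg 11) 0≤ζL)
        (solve 2 (λ z l → (κ 1 :+ κ 12 :* z) :* l := (z :* l :+ l) :+ κ 11 :* (z :* l)) refl ζ L))

      involution-bound : T + (fromℕ 2 + ε) / fromℕ 4 * L ≤ μ / fromℕ 2
      involution-bound = *-cancelˡ-≤ (0<fromℕ-suc 3) (begin
        fromℕ 4 * (T + (fromℕ 2 + ε) / fromℕ 4 * L)
          ≡⟨ solve 3 (λ t a l → κ 4 :* (t :+ a :* l) := κ 4 :* t :+ a :* κ 4 :* l) refl T ((fromℕ 2 + ε) / fromℕ 4) L ⟩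
        fromℕ 4 * T + (fromℕ 2 + ε) / fromℕ 4 * fromℕ 4 * L
          ≡⟨ cong (λ z → fromℕ 4 * T + z * L) (trans (/-cancel (0<fromℕ-suc 3) _) (cong (fromℕ 2 +_) (sym 16ζ≡ε))) ⟩
        fromℕ 4 * T + (fromℕ 2 + fromℕ 16 * ζ) * L
          ≤⟨ +-monoˡ-≤ _ (*-monoˡ-≤ (fromℕ-nonneg 4) T≤ζL) ⟩
        fromℕ 4 * (ζ * L) + (fromℕ 2 + fromℕ 16 * ζ) * L
          ≤⟨ ≤-slack (fromℕ 4 * (ζ * L)) (*-nonneg (fromℕ-nonneg 4) 0≤ζL)
               (solve 2 (λ z l → κ 2 :* ((κ 1 :+ κ 12 :* z) :* l) :=
                 (κ 4 :* (z :* l) :+ (κ 2 :+ κ 16 :* z) :* l) :+ κ 4 :* (z :* l)) refl ζ L) ⟩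
        fromℕ 2 * μ
          ≡⟨ cong (fromℕ 2 *_) (/-cancel 0<2 μ) ⟨
        fromℕ 2 * (μ / fromℕ 2 * fromℕ 2)
          ≡⟨ solve 1 (λ x → κ 2 :* (x :* κ 2) := κ 4 :* x) refl (μ / fromℕ 2) ⟩
        fromℕ 4 * (μ / fromℕ 2) ∎)
        where open ≤-Reasoning

      small-bound : T + w * L ≤ μ / D
      small-bound = ≤-slack (fromℕ 10 * (ζ * (w * L))) (*-nonneg (fromℕ-nonneg 10) 0≤ζwL)
        (solve 3 (λ z i l → (κ 1 :+ κ 12 :* z) :* l :* i :=
          (κ 2 :* z :* (κ 1 :* i :* l) :+ κ 1 :* i :* l) :+ κ 10 :* (z :* (κ 1 :* i :* l))) refl ζ (D ⁻¹) L)

      w₂ : ℝ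
      w₂ = 1# / fromℕ (2 ℕ.* d)

      2w₂≡w : w ≡ fromℕ 2 * w₂
      2w₂≡w = *-cancelˡ-≡ 0<D (trans (trans (*-comm D w) (/-cancel 0<D 1#)) (sym (trans
        (solve 2 (λ e v → e :* (κ 2 :* v) := v :* (κ 2 :* e)) refl D w₂)
        (trans (cong (w₂ *_) (sym (fromℕ-* 2 d))) (/-cancel (0<fromℕ-suc (suc m ℕ.+ (d ℕ.+ 0))) 1#)))))

      both-bound : T + w₂ * L ≤ μ / fromℕ (2 ℕ.* d)
      both-bound = ≤-trans (≤-reflexive (cong (λ w → fromℕ 2 * ζ * (w * L) + w₂ * L) 2w₂≡w))
        (≤-slack (fromℕ 8 * (ζ * (w₂ * L))) (*-nonneg (fromℕ-nonneg 8)
            (*-nonneg 0≤ζ (*-nonneg (/-nonneg 0≤1 (0<fromℕ-suc (suc m ℕ.+ (d ℕ.+ 0)))) 0≤L)))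
          (solve 3 (λ z i l → (κ 1 :+ κ 12 :* z) :* l :* i :=
            (κ 2 :* z :* (κ 2 :* (κ 1 :* i) :* l) :+ κ 1 :* i :* l) :+ κ 8 :* (z :* (κ 1 :* i :* l)))
            refl ζ (fromℕ (2 ℕ.* d) ⁻¹) L))

    diameter-bound : ∀ {p q} →
      fromℕ (# involution?) ≤ exp ((fromℕ 2 + ε) / fromℕ 4 * L) →
      fromℕ (# (λ x → fromℕ (cl x) ≤? M)) ≤ exp (w * L) →
      fromℕ (# (λ x → involution? x ×-dec (fromℕ (cl x) ≤? M))) ≤ exp (w₂ * L) →
      0# ≤ p → fromℕ 2 ^ d * p ^ d * fromℕ N ^ suc m ≡ (1# + ε) * L → p ≤ q → q ≤ 1# →
      Pr q (diameterExceeds? d) < δ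
    diameter-bound {p} {q} inv≤ small≤ both≤ 0≤p λ≡ p≤q q≤1 = ≤-<-trans
      (≤-trans (exceeds-probability M (0<exp _) m 0≤p p≤1 0<N 0≤τ N≤τM τ≤ρ 1≤ρ sum≤ρ² sum≤Nρ
                 (x≤y⇒0≤y-x (≤-trans D≤ζ ζ≤1)) (≤-trans D≤ζ ζ≤1) rare 0≤μ μ≤ p≤q q≤1)
               (+-mono-≤ (+-mono-≤ (+-mono-≤
                 (term-bound L μ (≤-reflexive (sym exp-L)) all-bound)
                 (term-bound _ _ inv≤ involution-bound))
                 (term-bound _ _ small≤ small-bound))
                 (term-bound _ _ both≤ both-bound)))
      4exp<δ
      where
      open UnionBound R 𝔽
      p≤1 = ≤-trans p≤q q≤1
      -- As d ≥ 2, (b) leaves at most exp (L/2) elements of small class, which is at most N exp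
      -- (-2u) because 4u ≤ L.
      small≤τ : fromℕ (# (λ x → fromℕ (cl x) ≤? M)) ≤ τ
      small≤τ = ≤-trans small≤ (≤-trans (exp-mono-≤ (*-cancelˡ-≤ 0<2 (≤-slack
          ((L - fromℕ 2 * (w * L)) + (L - fromℕ 4 * u))
        (+-nonneg (x≤y⇒0≤y-x 2wL≤L) (x≤y⇒0≤y-x 4u≤L))
        (solve 3 (λ l x u → κ 2 :* (l :+ :- (κ 2 :* u)) := κ 2 :* x :+
          ((l :- κ 2 :* x) :+ (l :- κ 4 :* u))) refl L (w * L) u))))
        (≤-reflexive (trans (exp-+ L (- (fromℕ 2 * u))) (cong (_* exp (- (fromℕ 2 * u))) exp-L))))
      sum≤ : fromℕ N * τ + fromℕ (# (λ x → fromℕ (cl x) ≤? M)) * fromℕ N ≤ fromℕ N * (fromℕ 2 * τ)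
      sum≤ = ≤-trans (+-monoʳ-≤ (fromℕ N * τ) (*-monoʳ-≤ 0≤N small≤τ))
        (≤-reflexive (solve 2 (λ n t → n :* t :+ t :* n := n :* (κ 2 :* t)) refl (fromℕ N) τ))
      sum≤Nρ = ≤-trans sum≤ (*-monoˡ-≤ 0≤N 2τ≤ρ)
      sum≤ρ² = ≤-trans sum≤ (≤-slack (fromℕ N * (fromℕ 2 * τ)) (*-nonneg 0≤N (*-nonneg (fromℕ-nonneg 2) 0≤τ))
        (trans (solve 2 (λ e n → κ 2 :* e :* n :* (κ 2 :* e :* n) := κ 4 :* (n :* (n :* (e :* e)))) refl (exp (- u))
            (fromℕ N))
          (trans (cong (λ z → fromℕ 4 * (fromℕ N * (fromℕ N * z))) exp-2u)
            (solve 2 (λ n t → κ 4 :* (n :* t) := n :* (κ 2 :* t) :+ n :* (κ 2 :* t)) refl (fromℕ N) τ))))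
      D≤ζ : fromℕ 2 ^ d * (D * (D * (D * p * (fromℕ N * p + D) ^ m))) ≤ ζ
      D≤ζ = dependence-bound exp-L 0≤p 0<ε (<⇒≤ ε<1) λ≡ 0≤ζ 2e≤ζL
      rare : ((fromℕ 2 * D) ^ d + fromℕ 2 * (D * D)) * ρ ≤ ζ * fromℕ N
      rare = ≤-trans (≤-reflexive (sym (*-assoc _ _ _))) (*-monoʳ-≤ 0≤N (exceptions-bound 0≤ζ 16≤ζu))
      0≤μ : 0# ≤ μ
      0≤μ = *-nonneg (+-nonneg 0≤1 (*-nonneg (fromℕ-nonneg 12) 0≤ζ)) 0≤L
      μ≤ = ≤-trans (mean-bound (<⇒≤ 0<ε) (<⇒≤ ε<1) 16ζ≡ε 0≤L D≤ζ ≤-refl ζ≤1)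
        (≤-reflexive (cong ((1# - fromℕ 2 ^ d * (D * (D * (D * p * (fromℕ N * p + D) ^ m)))) * (1# - ζ) *_) (sym λ≡)))
      e = exp (- T)
      4exp<δ : e + e + e + e < δ
      4exp<δ = subst₂ _<_ (solve 1 (λ e → e :* κ 4 := e :+ e :+ e :+ e) refl e)
        (trans (solve 3 (λ e d f → e :* (d :* f) := d :* (f :* e)) refl e δ (exp T))
            (trans (cong (δ *_) (exp-inverse T)) (*-identityʳ δ)))
        (*-monoˡ-< (0<exp (- T)) 4<δexpT)

-- Translation to the quantities of the theorem.

module Main (R : Reals) where
  open Reals R
  open OrderedField R
  open Exponential R

  sqrt-pos : ∀ {x} → 0# < x → 0# < √ x × √ x * √ x ≡ x
  sqrt-pos {x} 0<x = proj₁ (root-pos 1 0<x) , trans (cong (√ x *_) (sym (*-identityʳ _))) (proj₂ (root-pos 1 0<x))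

  square-bound : ∀ {γ L y D} → 0# < γ → γ < 1# → 0# < L → 0# < y → 0# ≤ D →
                 D ≤ (1# - γ) * √ (L / (fromℕ 2 * y)) → D * D * (fromℕ 2 * y) ≤ L
  square-bound {γ} {L} {y} {D} 0<γ γ<1 0<L 0<y 0≤D D≤ = begin
    D * D * (fromℕ 2 * y)                 ≤⟨ *-monoʳ-≤ (<⇒≤ 0<2y) (*-mono-≤ (<⇒≤ 0<r) 0≤D D≤r D≤r) ⟩
    r * r * (fromℕ 2 * y)                 ≡⟨ cong (_* (fromℕ 2 * y)) (proj₂ (sqrt-pos 0<L/2y)) ⟩
    L / (fromℕ 2 * y) * (fromℕ 2 * y)     ≡⟨ /-cancel 0<2y L ⟩
    L                                     ∎
    where
    open ≤-Reasoning
    0<2y : 0# < fromℕ 2 * y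
    0<2y = *-pos 0<2 0<y
    0<L/2y : 0# < L / (fromℕ 2 * y)
    0<L/2y = /-pos 0<L 0<2y
    r = √ (L / (fromℕ 2 * y))
    0<r : 0# < r
    0<r = proj₁ (sqrt-pos 0<L/2y)
    D≤r : D ≤ r
    D≤r = ≤-trans D≤ (≤-slack (γ * r) (*-nonneg (<⇒≤ 0<γ) (<⇒≤ 0<r))
      (solve 2 (λ g r → r := (κ 1 :- g) :* r :+ g :* r) refl γ r))

  threshold : ℕ → ℕ → ℝ → ℝ
  threshold N d ε = ((1# + ε) / fromℕ 2 ^ d) * (log (fromℕ N) / fromℕ N ^ (d ∸ 1))

  expected-words : ∀ {t x l v p} → 0# < t → 0# < v → p ≡ (x / t) * (l / v) → t * p * v ≡ x * l
  expected-words {t} {x} {l} {v} 0<t 0<v refl = trans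
    (solve 4 (λ t v a b → t :* (a :* b) :* v := a :* t :* (b :* v)) refl t v (x / t) (l / v))
    (cong₂ _*_ (/-cancel 0<t x) (/-cancel 0<v l))

  conclusion : ∀ {c ℓ} {γ ε δ} → 0# < γ → γ < 1# → (0<ε : 0# < ε) (ε<1 : ε < 1#) (0<δ : 0# < δ) → let open Threshold R 0<ε ε<1 0<δ in
    ∀ N m → exp L₀ ≤ fromℕ N → let d = suc (suc m) in fromℕ d ≤ diameterBound γ N →
    (𝔽 : FiniteGroup c ℓ N) → let open FiniteGroup 𝔽 in
    fromℕ (# involution?) ≤ fromℕ N ^ʳ ((fromℕ 2 + ε) / fromℕ 4) →
    fromℕ (# (λ x → fromℕ (cl x) ≤? classBound N)) ≤ fromℕ N ^ʳ (1# / fromℕ d) →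
    fromℕ (# (λ x → involution? x ×-dec (fromℕ (cl x) ≤? classBound N))) ≤ fromℕ N ^ʳ (1# / fromℕ (2 ℕ.* d)) →
    ∀ p → p ≤ 1# → root d (threshold N d ε) ≤ p → Pr p (diameterExceeds? d) < δ
  conclusion {γ = γ} {ε} 0<γ γ<1 0<ε ε<1 0<δ N m expL₀≤N d≤ 𝔽 inv≤ small≤ both≤ p p≤1 root≤p =
    diameter-bound m 𝔽 exp-L exp-y (<⇒≤ (proj₁ u-pos)) (proj₂ u-pos) L₀≤L
        (square-bound 0<γ γ<1 0<L 0<y (fromℕ-nonneg d) d≤)
      inv≤ small≤ both≤ (<⇒≤ (proj₁ p₀-pos)) (expected-words (^-pos 0<2 d) (^-pos 0<N (suc m)) (proj₂ p₀-pos))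
          root≤p p≤1
    where
    open Threshold R 0<ε ε<1 0<δ
    d = suc (suc m)
    L = log (fromℕ N)
    0<N : 0# < fromℕ N
    0<N = <-≤-trans (0<exp L₀) expL₀≤N
    exp-L : exp L ≡ fromℕ N
    exp-L = exp-log 0<N
    L₀≤L : L₀ ≤ L
    L₀≤L = exp-cancel-≤ (≤-trans expL₀≤N (≤-reflexive (sym exp-L)))
    0<L : 0# < L
    0<L = <-≤-trans 0<L₀ L₀≤L
    exp-y : exp (log L) ≡ L
    exp-y = exp-log 0<L
    0<y : 0# < log L
    0<y = <-≤-trans (0<fromℕ-suc 63) (exp-cancel-≤ (≤-trans (≤-trans (x≤x+y (*-nonneg 0≤B 0≤B)) (x≤x+y 0≤B))
            (≤-trans L₀≤L (≤-reflexive (sym exp-y)))))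
    u-pos = sqrt-pos (*-pos 0<L 0<y)
    p₀-pos = root-pos (suc m) (*-pos (/-pos (<-≤-trans 0<1 (x≤x+y (<⇒≤ 0<ε))) (^-pos 0<2 d))
        (/-pos 0<L (^-pos 0<N (suc m))))

theorem6 : ∀ {c ℓ} (R : Reals) → let open Reals R in
    ∀ (γ : ℝ) → 0# < γ → γ < 1# →
    ∃[ ε₀ ] (0# < ε₀ × (∀ (ε : ℝ) → 0# < ε → ε < ε₀ →
    ∀ (δ : ℝ) → 0# < δ →
    ∃[ N₀ ] (∀ (N d : ℕ) → N₀ ℕ.≤ N →
    2 ℕ.≤ d → fromℕ d ≤ diameterBound γ N →
    (G : FiniteGroup c ℓ N) → let open FiniteGroup G in
    fromℕ (# involution?) ≤ fromℕ N ^ʳ ((fromℕ 2 + ε) / fromℕ 4) →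
    fromℕ (# (λ x → fromℕ (cl x) ≤? classBound N)) ≤ fromℕ N ^ʳ (1# / fromℕ d) →
    fromℕ (# (λ x → involution? x ×-dec (fromℕ (cl x) ≤? classBound N))) ≤ fromℕ N ^ʳ (1# / fromℕ (2 ℕ.* d)) →
    ∀ (p : ℝ) → 0# ≤ p → p ≤ 1# →
    root d (((1# + ε) / fromℕ 2 ^ d) * (log (fromℕ N) / fromℕ N ^ (d ∸ 1))) ≤ p →
    Pr p (diameterExceeds? d) < δ)))
-- ε₀ = 1 serves for every γ. N₀ is computed from `L₀`, hence from ε and δ, before d, the group and
-- p are given; this is the uniformity.
theorem6 R γ 0<γ γ<1 = 1# , 0<1 , λ ε 0<ε ε<1 δ 0<δ →
  let N₀ , expL₀≤N₀ = archimedean (exp (Threshold.L₀ R 0<ε ε<1 0<δ)) in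
  N₀ , λ { N (suc (suc m)) N₀≤N (s≤s (s≤s z≤n)) d≤ 𝔽 inv≤ small≤ both≤ p _ p≤1 root≤p →
    Main.conclusion R 0<γ γ<1 0<ε ε<1 0<δ N m (≤-trans expL₀≤N₀ (fromℕ-mono-≤ N₀≤N)) d≤ 𝔽
      inv≤ small≤ both≤ p p≤1 root≤p }
  where
  open Reals R
  open OrderedField R
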